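{- Let $q$ be a prime power, $1\le s\le 4$, and $\delta,\varepsilon\in\mathbb F_q^*$ with $\delta^2\varepsilon\neq1$. If $\delta^3\varepsilon^2+(1-3\delta)\varepsilon+1\neq0$, then there exists $x\in\mathbb F_{q^5}$ satisfying simultaneously $$\varepsilon\,\mathrm N_{q^5/q}(x)=-1\quad\text{and}\quad \delta^2\varepsilon x^{q^s}-\delta\varepsilon x^{q^{2s}+q^s+1}(1-x)^{q^{3s}}+(1-x)^{q^s+1}=0.$$
   Context: $\mathrm N_{q^5/q}(x)=x^{1+q+q^2+q^3+q^4}$. -}

module Defs where

open import Level using (_⊔_)
open import Data.Nat using (ℕ; suc; _+_) renaming (_^_ to _^ℕ_)
open import Data.Nat.Primality using (Prime)
open import Data.Fin using (Fin)
open import Data.Product using (Σ; ∃; _×_)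
open import Relation.Nullary using (¬_)
open import Relation.Binary.PropositionalEquality using (_≡_)
open import Algebra.Bundles using (CommutativeRing)

IsPrimePower : ℕ → Set
IsPrimePower q = Σ ℕ λ p → Σ ℕ λ k → Prime p × (q ≡ p ^ℕ suc k)

record IsFiniteField {c ℓ} (R : CommutativeRing c ℓ) (n : ℕ) : Set (c ⊔ ℓ) where
  open CommutativeRing R
  field
    0≉1         : ¬ (0# ≈ 1#)
    inverse     : ∀ x → ¬ (x ≈ 0#) → ∃ λ y → x * y ≈ 1#
    enum        : Fin n → Carrier
    enum-inj    : ∀ i j → enum i ≈ enum j → i ≡ j
    enum-surj   : ∀ x → ∃ λ i → enum i ≈ x

-- exponent of the norm N_{q^5/q}: 1 + q + q^2 + q^3 + q^4
normExp : ℕ → ℕ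
normExp q = 1 + q + q ^ℕ 2 + q ^ℕ 3 + q ^ℕ 4

module RingOps {c ℓ} (K : CommutativeRing c ℓ) where
  open import Algebra.Bundles using (Semiring)
  open import Algebra.Definitions.RawSemiring
    (Semiring.rawSemiring (CommutativeRing.semiring K)) public
    using (_^_; _×_)

{-# OPTIONS --safe #-}
module Submission where

-- Put η = δε, let σ be the q^s-power map and x_i = σ^i x. If u is such that the u_i = σ^i u satisfy the Lyness
-- recurrence u_{i-1} u_{i+1} = 1 + u_i and u_0 u_1 u_2 u_3 u_4 = k := δηm²/Δ, where m = δη - 1, n = 1 - η and Δ is
-- δ times the cubic of the statement, then x = - u_3 (m - n u_1) / (n (1 + u_2 + u_3) + ηm) solves both equations
-- unless the denominator vanishes, which happens for a single value ν of u. The hypotheses on δ and ε say that k is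
-- defined and non-zero.
--
-- Such u are the points Q of the elliptic (or nodal) curve S(a,b) := (1+a)(1+b)(1+a+b) - kab = 0 whose Frobenius image is
-- Q + P, with P a point of order five. They are found as roots of G = S(X, X^q), a polynomial of degree 2q+1. If S(a,b) = 0
-- and S(b,c) = 0 then c = a or ac = 1 + b, so a root of G satisfies X^{q²} = X or is of the required kind. In the first
-- case X + X^q is an element a of F_q other than k - 1, and X is a root of S(X, a - X), of degree 2: at most 2(q-1)
-- roots. The others remain even if ν is discarded, and they satisfy X^{q⁵} = X, hence lie in K. The argument is carried
-- out in quotients of K[X], so that no field extension is needed. For s = 2, 3 the same is done with the equation
-- between u_0 and u_2 in place of S.

-- Roots cannot simply be counted, since G may have repeated ones, for instance at a node of the
-- curve. Divisibility replaces counting. Modulo the ideal of all f with G dividing f D, the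
-- relation X^(q²) = X holds exactly, so θ = X + X^q is fixed by the q-power map; the product of θ -
-- a over a in K is then θ^(q⁵) - θ = 0, and its factors with a outside F_q are units. Modulo (G, D)
-- it is X^(q⁵) - X that vanishes, a product of distinct linear factors, so a common root enters
-- there only once.
--
-- For s = 2 the equation S(X, X^(q²)) = 0 would not do: θ would be fixed by the q²-power map only,
-- and K does not contain F_(q²). So the q-power map is used for all s, on a cycle whose indices it
-- shifts by one or by two.
--
-- The formula for x works because 1 - x factors too: it is η (m - l u_3) divided by the same
-- denominator, with l = 1 - δ. Thus both equations involve only products of translates of a few
-- functions on the curve, and their relations are polynomial identities with integer coefficients,
-- valid in every characteristic.

open import Defs
open import Data.Nat using (ℕ; _≤_)
import Data.Nat as ℕ
open import Data.Product using (∃) renaming (_×_ to _∧_)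
open import Relation.Nullary using (¬_)
open import Algebra.Bundles using (CommutativeRing)

open import Algebra.Bundles using (CommutativeMonoid)
import Algebra.Properties.CommutativeMonoid.Sum
open import Data.Empty using (⊥; ⊥-elim)
open import Data.Fin as Fin using (Fin; zero; suc; toℕ; fromℕ; inject₁)
open import Data.Fin.Permutation using (Permutation; permutation)
import Data.Fin.Properties as Finₚ
open import Data.Integer as ℤ using (ℤ; +_; -[1+_])
import Data.Integer.Properties as ℤₚ
open import Data.List using (List; []; _∷_; map; foldr; length; filter; tabulate)
open import Data.List.Properties using (length-tabulate)
open import Data.List.Relation.Unary.All as All using (All; []; _∷_)
import Data.List.Relation.Unary.All.Properties as Allₚ
open import Data.List.Relation.Unary.AllPairs using (AllPairs; []; _∷_)
import Data.List.Relation.Unary.AllPairs.Properties as AllPairsₚ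
import Data.List.Relation.Unary.Any as Any
import Data.List.Relation.Unary.Any.Properties as Anyₚ
open import Data.Maybe using (Maybe; just; nothing)
open import Data.Nat using (zero; suc; z≤n; s≤s)
open import Data.Nat.Combinatorics using (nCn≡1; nC1≡n; nCk+nC[k+1]≡[n+1]C[k+1]; k>n⇒nCk≡0) renaming (_C_ to _choose_)
open import Data.Nat.Divisibility using (divides; m∣m*n; ∣⇒≤) renaming (_∣_ to _∣ℕ_)
open import Data.Nat.Primality using (Prime; euclidsLemma; prime⇒nonTrivial)
import Data.Nat.Properties as ℕₚ
open import Data.Product using (∃₂; _,_; proj₁; proj₂)
open import Data.Sum using (inj₁; inj₂)
open import Function using (id; _∘_)
open import Level using (_⊔_) renaming (suc to lsuc)
open import Relation.Binary.PropositionalEquality as ≡ using (_≡_; _≢_)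
open import Relation.Nullary using (Dec; yes; no)
open import Relation.Nullary.Decidable using (_×-dec_; ¬?; map′)
open import Relation.Unary using (Pred; Decidable)

-- Ring solver with integer coefficients

module IntegerCoefficients {c ℓ} (R : CommutativeRing c ℓ) where
  open CommutativeRing R
  open import Algebra.Properties.Ring ring
  open import Algebra.Properties.AbelianGroup +-abelianGroup using (⁻¹-∙-comm)
  open import Algebra.Properties.Semiring.Mult.TCOptimised semiring
  open import Algebra.Solver.Ring.AlmostCommutativeRing
  open import Relation.Binary.Reasoning.Setoid setoid

  -- The optimised multiple reduces `1 × 1#` to `1#`, so that `𝟙` in a solver expression denotes
  -- `1#` itself.
  ⟦_⟧ℤ : ℤ → Carrier
  ⟦ + n ⟧ℤ      = n × 1#
  ⟦ -[1+ n ] ⟧ℤ = - (suc n × 1#)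

  private
    ι : ℕ → Carrier
    ι n = n × 1#

    ι-suc : ∀ n → ι (suc n) ≈ 1# + ι n
    ι-suc n = ×-homo-+ 1# 1 n

    cancel : ∀ a b → (1# + a) - (1# + b) ≈ a - b
    cancel a b = begin
      (1# + a) - (1# + b)       ≈⟨ +-cong (+-comm _ _) (sym (⁻¹-∙-comm _ _)) ⟩
      (a + 1#) + (- 1# + - b)   ≈⟨ +-assoc _ _ _ ⟩
      a + (1# + (- 1# + - b))   ≈⟨ +-congˡ (sym (+-assoc _ _ _)) ⟩
      a + ((1# + - 1#) + - b)   ≈⟨ +-congˡ (+-congʳ (-‿inverseʳ _)) ⟩
      a + (0# + - b)            ≈⟨ +-congˡ (+-identityˡ _) ⟩
      a - b                     ∎

  ⊖-homo : ∀ m n → ⟦ m ℤ.⊖ n ⟧ℤ ≈ ι m - ι n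
  ⊖-homo zero zero = sym (-‿inverseʳ _)
  ⊖-homo zero (suc n) = sym (+-identityˡ _)
  ⊖-homo (suc m) zero = begin
    ι (suc m)        ≈⟨ sym (+-identityʳ _) ⟩
    ι (suc m) + 0#   ≈⟨ +-congˡ (sym -0#≈0#) ⟩
    ι (suc m) - 0#   ∎
  ⊖-homo (suc m) (suc n) = begin
    ⟦ suc m ℤ.⊖ suc n ⟧ℤ    ≡⟨ ≡.cong ⟦_⟧ℤ (ℤₚ.[1+m]⊖[1+n]≡m⊖n m n) ⟩
    ⟦ m ℤ.⊖ n ⟧ℤ            ≈⟨ ⊖-homo m n ⟩
    ι m - ι n               ≈⟨ sym (cancel _ _) ⟩
    (1# + ι m) - (1# + ι n) ≈⟨ +-cong (sym (ι-suc m)) (-‿cong (sym (ι-suc n))) ⟩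
    ι (suc m) - ι (suc n)   ∎

  +-homoℤ : ∀ i j → ⟦ i ℤ.+ j ⟧ℤ ≈ ⟦ i ⟧ℤ + ⟦ j ⟧ℤ
  +-homoℤ (+ m) (+ n) = ×-homo-+ 1# m n
  +-homoℤ (+ m) -[1+ n ] = ⊖-homo m (suc n)
  +-homoℤ -[1+ m ] (+ n) = trans (⊖-homo n (suc m)) (+-comm _ _)
  +-homoℤ -[1+ m ] -[1+ n ] = begin
    - ι (suc (suc (m ℕ.+ n)))     ≡⟨ ≡.cong (λ z → - ι (suc z)) (≡.sym (ℕₚ.+-suc m n)) ⟩
    - ι (suc m ℕ.+ suc n)         ≈⟨ -‿cong (×-homo-+ 1# (suc m) (suc n)) ⟩
    - (ι (suc m) + ι (suc n))     ≈⟨ sym (⁻¹-∙-comm _ _) ⟩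
    - ι (suc m) + - ι (suc n)     ∎

  -‿homoℤ : ∀ i → ⟦ ℤ.- i ⟧ℤ ≈ - ⟦ i ⟧ℤ
  -‿homoℤ (+ zero)  = sym -0#≈0#
  -‿homoℤ (+ suc n) = refl
  -‿homoℤ -[1+ n ]  = sym (-‿involutive _)

  *-homoℤ : ∀ i j → ⟦ i ℤ.* j ⟧ℤ ≈ ⟦ i ⟧ℤ * ⟦ j ⟧ℤ
  *-homoℤ (+ m) (+ n) = trans (reflexive (≡.cong ⟦_⟧ℤ (≡.sym (ℤₚ.pos-* m n)))) (×1-homo-* m n)
  *-homoℤ (+ zero) -[1+ n ] = sym (zeroˡ _)
  *-homoℤ (+ suc m) -[1+ n ] = begin
    - ι (suc m ℕ.* suc n)        ≈⟨ -‿cong (×1-homo-* (suc m) (suc n)) ⟩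
    - (ι (suc m) * ι (suc n))    ≈⟨ -‿distribʳ-* _ _ ⟩
    ι (suc m) * - ι (suc n)      ∎
  *-homoℤ -[1+ m ] (+ zero) = begin
    ⟦ -[1+ m ] ℤ.* + 0 ⟧ℤ        ≡⟨ ≡.cong ⟦_⟧ℤ (ℤₚ.*-zeroʳ -[1+ m ]) ⟩
    0#                           ≈⟨ sym (zeroʳ _) ⟩
    - ι (suc m) * 0#             ∎
  *-homoℤ -[1+ m ] (+ suc n) = begin
    - ι (suc m ℕ.* suc n)        ≈⟨ -‿cong (×1-homo-* (suc m) (suc n)) ⟩
    - (ι (suc m) * ι (suc n))    ≈⟨ -‿distribˡ-* _ _ ⟩
    - ι (suc m) * ι (suc n)      ∎
  *-homoℤ -[1+ m ] -[1+ n ] = begin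
    ι (suc m ℕ.* suc n)          ≈⟨ ×1-homo-* (suc m) (suc n) ⟩
    ι (suc m) * ι (suc n)        ≈⟨ sym (-‿involutive _) ⟩
    - - (ι (suc m) * ι (suc n))  ≈⟨ -‿cong (-‿distribˡ-* _ _) ⟩
    - (- ι (suc m) * ι (suc n))  ≈⟨ -‿distribʳ-* _ _ ⟩
    - ι (suc m) * - ι (suc n)    ∎

  private
    morphism : ℤ.+-*-rawRing -Raw-AlmostCommutative⟶ fromCommutativeRing R
    morphism = record
      { ⟦_⟧ = ⟦_⟧ℤ ; +-homo = +-homoℤ ; *-homo = *-homoℤ ; -‿homo = -‿homoℤ
      ; 0-homo = refl ; 1-homo = refl }

    _coeff≟_ : ∀ i j → Maybe (⟦ i ⟧ℤ ≈ ⟦ j ⟧ℤ)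
    i coeff≟ j with i ℤ.≟ j
    ... | yes ≡.refl = just refl
    ... | no _       = nothing

  open import Algebra.Solver.Ring ℤ.+-*-rawRing (fromCommutativeRing R) morphism _coeff≟_ public
    using (solve; _:+_; _:*_; _:-_; :-_; _:^_; _:=_; con; Polynomial)

  𝟘 𝟙 : ∀ {n} → Polynomial n
  𝟘 = con (+ 0)
  𝟙 = con (+ 1)

module RingLemmas {c ℓ} (R : CommutativeRing c ℓ) where
  open CommutativeRing R
  open import Algebra.Properties.Ring ring using (x∙y⁻¹≈ε⇒x≈y)

  x≈y⇒x-y≈0 : ∀ {x y} → x ≈ y → x - y ≈ 0#
  x≈y⇒x-y≈0 {x} {y} e = trans (+-congʳ e) (-‿inverseʳ y)

  x-y≈0⇒x≈y : ∀ {x y} → x - y ≈ 0# → x ≈ y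
  x-y≈0⇒x≈y {x} {y} = x∙y⁻¹≈ε⇒x≈y x y

  infixr 6 _⊕_
  infix 7 _⊛_

  -- Certificates: the difference of the two sides of a claim is written as a sum of terms c * (x -
  -- y) over known equations x ≈ y. The solver verifies the expression, `⊛` and `⊕` make it zero.
  -- Most coefficients are inferred from the identity given to the solver, hence the many `_ ⊛`.
  _⊛_ : ∀ c {x y} → x ≈ y → c * (x - y) ≈ 0#
  c ⊛ e = trans (*-congˡ (x≈y⇒x-y≈0 e)) (zeroʳ c)

  _⊕_ : ∀ {x y} → x ≈ 0# → y ≈ 0# → x + y ≈ 0#
  p ⊕ q = trans (+-cong p q) (+-identityˡ 0#)

  by-combination : ∀ {x y z} → x - y ≈ z → z ≈ 0# → x ≈ y
  by-combination p q = x-y≈0⇒x≈y (trans p q)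

-- Lyness cycles

module Lyness {c ℓ} (R : CommutativeRing c ℓ) where
  open CommutativeRing R
  open IntegerCoefficients R
  open RingLemmas R

  record Cycle (k u₀ u₁ u₂ u₃ u₄ : Carrier) : Set ℓ where
    constructor cycle
    field
      r₀ : u₀ * u₂ ≈ 1# + u₁
      r₁ : u₁ * u₃ ≈ 1# + u₂
      r₂ : u₂ * u₄ ≈ 1# + u₃
      r₃ : u₃ * u₀ ≈ 1# + u₄
      r₄ : u₄ * u₁ ≈ 1# + u₀
      norm : u₀ * u₁ * u₂ * u₃ * u₄ ≈ k

  -- Satisfied by l = 1 - δ, n = 1 - η and m = δη - 1; in this form the conditions are symmetric under δ ↔ η, l ↔ n.
  record Parameters (k δ η l m n Δ : Carrier) : Set ℓ where
    constructor parameters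
    field
      p₁ : l + m ≈ - (δ * n)
      p₂ : n + m ≈ - (η * l)
      pΔ : m * m - l * n ≈ Δ
      pk : k * Δ ≈ δ * η * m * m

  rotate : ∀ {k u₀ u₁ u₂ u₃ u₄} → Cycle k u₀ u₁ u₂ u₃ u₄ → Cycle k u₁ u₂ u₃ u₄ u₀
  rotate {k} {u₀} {u₁} {u₂} {u₃} {u₄} (cycle r₀ r₁ r₂ r₃ r₄ norm) = cycle r₁ r₂ r₃ r₄ r₀
    (trans (solve 5 (λ a b c d e → b :* c :* d :* e :* a := a :* b :* c :* d :* e) refl u₀ u₁ u₂ u₃ u₄) norm)

  -- The recurrence has no preferred direction. This is needed when the power map in question lowers
  -- the indices.
  reverse : ∀ {k u₀ u₁ u₂ u₃ u₄} → Cycle k u₀ u₁ u₂ u₃ u₄ → Cycle k u₀ u₄ u₃ u₂ u₁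
  reverse {k} {u₀} {u₁} {u₂} {u₃} {u₄} (cycle r₀ r₁ r₂ r₃ r₄ norm) = cycle
    (trans (*-comm _ _) r₃) (trans (*-comm _ _) r₂) (trans (*-comm _ _) r₁) (trans (*-comm _ _) r₀) (trans (*-comm _ _) r₄)
    (trans (solve 5 (λ a b c d e → a :* e :* d :* c :* b := a :* b :* c :* d :* e) refl u₀ u₁ u₂ u₃ u₄) norm)

  swap : ∀ {k δ η l m n Δ} → Parameters k δ η l m n Δ → Parameters k η δ n m l Δ
  swap {k} {δ} {η} {l} {m} {n} {Δ} (parameters p₁ p₂ pΔ pk) = parameters p₂ p₁
    (trans (+-congˡ (-‿cong (*-comm n l))) pΔ)
    (trans pk (*-congʳ (*-congʳ (*-comm δ η))))

  module CycleFacts {k u₀ u₁ u₂ u₃ u₄} (C : Cycle k u₀ u₁ u₂ u₃ u₄) where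
    open Cycle C
    t : Carrier
    t = 1# + u₂ + u₃

    t-product : u₀ * u₂ * u₃ ≈ t
    t-product = by-combination
      (solve 5 (λ u₀ u₁ u₂ u₃ u₄ →
         u₀ :* u₂ :* u₃ :- (𝟙 :+ u₂ :+ u₃)
      := u₂ :* (u₃ :* u₀ :- (𝟙 :+ u₄)) :+ 𝟙 :* (u₂ :* u₄ :- (𝟙 :+ u₃))) refl u₀ u₁ u₂ u₃ u₄)
      (u₂ ⊛ r₃ ⊕ 1# ⊛ r₂)

    -- The product k splits as (u₄ u₁)(u₀ u₂ u₃), where the first factor is 1 + u₀ and the second is
    -- `t`. So t is a function of u₀ alone.
    [1+u]t : (1# + u₀) * t ≈ k
    [1+u]t = by-combination
      (solve 6 (λ u₀ u₁ u₂ u₃ u₄ k → let t = 𝟙 :+ u₂ :+ u₃ in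
         (𝟙 :+ u₀) :* t :- k
      := (:- t) :* (u₄ :* u₁ :- (𝟙 :+ u₀)) :+ ((:- (u₄ :* u₁)) :* (u₀ :* u₂ :* u₃ :- t)
           :+ 𝟙 :* (u₀ :* u₁ :* u₂ :* u₃ :* u₄ :- k))) refl u₀ u₁ u₂ u₃ u₄ k)
      (- t ⊛ r₄ ⊕ - (u₄ * u₁) ⊛ t-product ⊕ 1# ⊛ norm)

    ut : u₀ * t ≈ 1# + 1# + u₄ + u₀ + u₁
    ut = by-combination
      (solve 5 (λ u₀ u₁ u₂ u₃ u₄ →
         u₀ :* (𝟙 :+ u₂ :+ u₃) :- (𝟙 :+ 𝟙 :+ u₄ :+ u₀ :+ u₁)
      := 𝟙 :* (u₀ :* u₂ :- (𝟙 :+ u₁)) :+ 𝟙 :* (u₃ :* u₀ :- (𝟙 :+ u₄))) refl u₀ u₁ u₂ u₃ u₄)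
      (1# ⊛ r₀ ⊕ 1# ⊛ r₃)

    -- The conserved quantity (1 + a)(1 + b)(1 + a + b) / ab of the Lyness map, in its form
    -- symmetric in the five terms.
    trace : 1# + 1# + 1# + u₀ + u₁ + u₂ + u₃ + u₄ ≈ k
    trace = by-combination
      (solve 6 (λ u₀ u₁ u₂ u₃ u₄ k → let t = 𝟙 :+ u₂ :+ u₃ in
         𝟙 :+ 𝟙 :+ 𝟙 :+ u₀ :+ u₁ :+ u₂ :+ u₃ :+ u₄ :- k
      := 𝟙 :* ((𝟙 :+ u₀) :* t :- k) :+ (:- 𝟙) :* (u₀ :* t :- (𝟙 :+ 𝟙 :+ u₄ :+ u₀ :+ u₁))) refl u₀ u₁ u₂ u₃ u₄ k)
      (1# ⊛ [1+u]t ⊕ - 1# ⊛ ut)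

  module Identities {k δ η l m n Δ u₀ u₁ u₂ u₃ u₄}
           (P : Parameters k δ η l m n Δ) (C : Cycle k u₀ u₁ u₂ u₃ u₄) where
    open Parameters P
    open Cycle C
    open CycleFacts C

    -- On the curve, m - n u₀ and m - l u₀ are functions of degree at most two, and so is the
    -- denominator D = n t + η m, as t = k / (1 + u₀). The identity matches the zeros and poles of
    -- their translates by multiples of P.
    ηLLu≈δND : η * (m - l * u₂) * (m - l * u₃) * u₀ ≈ δ * (m - n * u₀) * (n * t + η * m)
    ηLLu≈δND = by-combination
      (solve 12 (λ k δ η l m n Δ u₀ u₁ u₂ u₃ u₄ → let t = 𝟙 :+ u₂ :+ u₃; s = 𝟙 :+ 𝟙 :+ u₄ :+ u₀ :+ u₁ in
        η :* (m :- l :* u₂) :* (m :- l :* u₃) :* u₀ :- δ :* (m :- n :* u₀) :* (n :* t :+ η :* m)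
      := (:- (η :* l :* m)) :* (u₀ :* u₂ :- (𝟙 :+ u₁))
      :+ ((:- (η :* l :* m)) :* (u₃ :* u₀ :- (𝟙 :+ u₄))
      :+ (η :* l :* l :* (u₀ :* u₂ :* u₃ :- t)
      :+ (δ :* n :* n :* (u₀ :* t :- s)
      :+ (Δ :* ((𝟙 :+ 𝟙 :+ 𝟙 :+ u₀ :+ u₁ :+ u₂ :+ u₃ :+ u₄) :- k)
      :+ (𝟙 :* (k :* Δ :- δ :* η :* m :* m)
      :+ ((u₀ :* (η :* m :+ n) :+ (u₁ :+ u₄ :+ 𝟙 :+ 𝟙) :* n :- m :* t) :* (l :+ m :- (:- (δ :* n)))
      :+ ((l :* t :- m :* s) :* (n :+ m :- (:- (η :* l)))
      :+ (𝟙 :+ 𝟙 :+ 𝟙 :+ u₀ :+ u₁ :+ u₂ :+ u₃ :+ u₄) :* (m :* m :- l :* n :- Δ)))))))))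
        refl k δ η l m n Δ u₀ u₁ u₂ u₃ u₄)
      (_ ⊛ r₀ ⊕ _ ⊛ r₃ ⊕ _ ⊛ t-product ⊕ _ ⊛ ut ⊕ _ ⊛ trace ⊕ _ ⊛ pk ⊕ _ ⊛ p₁ ⊕ _ ⊛ p₂ ⊕ _ ⊛ pΔ)

    private
      module C₁ = CycleFacts (rotate C)
      module C₃ = CycleFacts (rotate (rotate (rotate C)))
      module C₄ = CycleFacts (rotate (rotate (rotate (rotate C))))

      utt : u₀ * C₄.t * C₁.t ≈ (1# + u₀) * k
      utt = by-combination
        (solve 6 (λ k u₀ u₁ u₂ u₃ u₄ → let t₁ = 𝟙 :+ u₃ :+ u₄; t₄ = 𝟙 :+ u₁ :+ u₂ in
          u₀ :* t₄ :* t₁ :- (𝟙 :+ u₀) :* k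
        := t₁ :* (u₀ :* u₂ :- (𝟙 :+ u₁)) :+ (𝟙 :+ u₀) :* ((𝟙 :+ u₁) :* t₁ :- k))
          refl k u₀ u₁ u₂ u₃ u₄)
        (_ ⊛ r₀ ⊕ _ ⊛ C₁.[1+u]t)

      t₄t : C₄.t * t ≈ k * u₂
      t₄t = by-combination
        (solve 6 (λ k u₀ u₁ u₂ u₃ u₄ → let t₄ = 𝟙 :+ u₁ :+ u₂; t = 𝟙 :+ u₂ :+ u₃ in
          t₄ :* t :- k :* u₂
        := (:- t) :* (u₄ :* u₁ :* u₂ :- t₄) :+ ((:- (u₄ :* u₁ :* u₂)) :* (u₀ :* u₂ :* u₃ :- t)
          :+ u₂ :* (u₀ :* u₁ :* u₂ :* u₃ :* u₄ :- k)))
          refl k u₀ u₁ u₂ u₃ u₄)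
        (_ ⊛ C₄.t-product ⊕ _ ⊛ t-product ⊕ _ ⊛ norm)

      [1+u₃]s₃ : (1# + u₃) * (1# + 1# + u₂ + u₃ + u₄) ≈ k * u₃
      [1+u₃]s₃ = by-combination
        (solve 6 (λ k u₀ u₁ u₂ u₃ u₄ → let t₃ = 𝟙 :+ u₀ :+ u₁; s₃ = 𝟙 :+ 𝟙 :+ u₂ :+ u₃ :+ u₄ in
          (𝟙 :+ u₃) :* s₃ :- k :* u₃
        := (:- (𝟙 :+ u₃)) :* (u₃ :* t₃ :- s₃) :+ u₃ :* ((𝟙 :+ u₃) :* t₃ :- k))
          refl k u₀ u₁ u₂ u₃ u₄)
        (_ ⊛ C₃.ut ⊕ _ ⊛ C₃.[1+u]t)

    -- The factor `l * t + δ * m` is the denominator for the parameters exchanged by `swap`; it is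
    -- traded for two translates of the original denominator.
    ηN[1+u]D̂≈δuDD : η * (m - n * u₀) * (1# + u₀) * (l * t + δ * m) ≈ δ * u₀ * (n * C₄.t + η * m) * (n * C₁.t + η * m)
    ηN[1+u]D̂≈δuDD = by-combination
      (solve 12 (λ k δ η l m n Δ u₀ u₁ u₂ u₃ u₄ → let t = 𝟙 :+ u₂ :+ u₃; t₁ = 𝟙 :+ u₃ :+ u₄; t₄ = 𝟙 :+ u₁ :+ u₂ in
        η :* (m :- n :* u₀) :* (𝟙 :+ u₀) :* (l :* t :+ δ :* m) :- δ :* u₀ :* (n :* t₄ :+ η :* m) :* (n :* t₁ :+ η :* m)
      := η :* l :* (m :- n :* u₀) :* ((𝟙 :+ u₀) :* t :- k)
      :+ ((:- (δ :* n :* n)) :* (u₀ :* t₄ :* t₁ :- (𝟙 :+ u₀) :* k)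
      :+ ((:- (δ :* n :* η :* m :* u₀)) :* ((𝟙 :+ 𝟙 :+ 𝟙 :+ u₀ :+ u₁ :+ u₂ :+ u₃ :+ u₄) :- k)
      :+ ((η :* u₀ :- (𝟙 :+ u₀)) :* (k :* Δ :- δ :* η :* m :* m)
      :+ ((:- (k :* (n :+ u₀ :* (η :* m :+ n)))) :* (l :+ m :- (:- (δ :* n)))
      :+ (k :* m :* (𝟙 :+ u₀) :* (n :+ m :- (:- (η :* l)))
      :+ k :* (η :* u₀ :- 𝟙 :- u₀) :* (m :* m :- l :* n :- Δ)))))))
        refl k δ η l m n Δ u₀ u₁ u₂ u₃ u₄)
      (_ ⊛ [1+u]t ⊕ _ ⊛ utt ⊕ _ ⊛ trace ⊕ _ ⊛ pk ⊕ _ ⊛ p₁ ⊕ _ ⊛ p₂ ⊕ _ ⊛ pΔ)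

    -- The quotient D D̂ / t, linear in t and u₀ and symmetric under `swap`. Its expression as a
    -- determinant is an additive relation among the products, and the source of the three terms of
    -- the final equation.
    Λ : Carrier
    Λ = n * l * t + (δ * n + η * l) * m + Δ * (1# + u₀)

    DD̂≈tΛ : (n * t + η * m) * (l * t + δ * m) ≈ t * Λ
    DD̂≈tΛ = by-combination
      (solve 9 (λ k δ η l m n Δ u₀ t →
        (n :* t :+ η :* m) :* (l :* t :+ δ :* m) :- t :* (n :* l :* t :+ (δ :* n :+ η :* l) :* m :+ Δ :* (𝟙 :+ u₀))
      := (:- Δ) :* ((𝟙 :+ u₀) :* t :- k) :+ (:- 𝟙) :* (k :* Δ :- δ :* η :* m :* m))
        refl k δ η l m n Δ u₀ t)
      (_ ⊛ [1+u]t ⊕ _ ⊛ pk)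

    Λ-determinant : u₀ * (m - l * u₃) * (m - n * u₂) - (m - l * u₄) * (m - n * u₁) ≈ Λ
    Λ-determinant = by-combination
      (solve 11 (λ δ η l m n Δ u₀ u₁ u₂ u₃ u₄ → let t = 𝟙 :+ u₂ :+ u₃ in
        u₀ :* (m :- l :* u₃) :* (m :- n :* u₂) :- (m :- l :* u₄) :* (m :- n :* u₁)
          :- (n :* l :* t :+ (δ :* n :+ η :* l) :* m :+ Δ :* (𝟙 :+ u₀))
      := (:- (m :* l)) :* (u₃ :* u₀ :- (𝟙 :+ u₄))
      :+ ((:- (m :* n)) :* (u₀ :* u₂ :- (𝟙 :+ u₁))
      :+ (n :* l :* (u₀ :* u₂ :* u₃ :- t)
      :+ ((:- (l :* n)) :* (u₄ :* u₁ :- (𝟙 :+ u₀))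
      :+ ((𝟙 :+ u₀) :* (m :* m :- l :* n :- Δ)
      :+ ((:- m) :* (l :+ m :- (:- (δ :* n)))
      :+ (:- m) :* (n :+ m :- (:- (η :* l)))))))))
        refl δ η l m n Δ u₀ u₁ u₂ u₃ u₄)
      (_ ⊛ r₃ ⊕ _ ⊛ r₀ ⊕ _ ⊛ t-product ⊕ _ ⊛ r₄ ⊕ _ ⊛ pΔ ⊕ _ ⊛ p₁ ⊕ _ ⊛ p₂)

    private
      NLD≈uDΛ-cleared : u₄ * (m - n * u₂) * (m - l * u₁) * (n * t + η * m) ≈ (n * k + η * m * (1# + u₃)) * Λ
      NLD≈uDΛ-cleared = by-combination
        (solve 12 (λ k δ η l m n Δ u₀ u₁ u₂ u₃ u₄ →
          let t = 𝟙 :+ u₂ :+ u₃; t₄ = 𝟙 :+ u₁ :+ u₂; p = 𝟙 :+ u₃; r = 𝟙 :+ u₀ in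
          u₄ :* (m :- n :* u₂) :* (m :- l :* u₁) :* (n :* t :+ η :* m)
            :- (n :* k :+ η :* m :* p) :* (n :* l :* t :+ (δ :* n :+ η :* l) :* m :+ Δ :* r)
        := (m :* m :* n :- n :* m :* (n :* t :+ η :* m)) :* (u₂ :* u₄ :- (𝟙 :+ u₃))
        :+ ((:- (l :* m :* (n :* t :+ η :* m))) :* (u₄ :* u₁ :- (𝟙 :+ u₀))
        :+ (n :* l :* (n :* t :+ η :* m) :* (u₄ :* u₁ :* u₂ :- t₄)
        :+ (m :* m :* n :* (p :* (𝟙 :+ 𝟙 :+ u₂ :+ u₃ :+ u₄) :- k :* u₃)
        :+ ((:- (l :* m :* n)) :* (r :* t :- k)
        :+ (n :* n :* l :* (t₄ :* t :- k :* u₂)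
        :+ ((:- (η :* m :* Δ)) :* (u₃ :* u₀ :- (𝟙 :+ u₄))
        :+ (n :* (p :- r) :* (k :* Δ :- δ :* η :* m :* m)
        :+ ((k :* n :* p :+ η :* m :* (u₄ :+ r :+ p)) :* (m :* m :- l :* n :- Δ)
        :+ (n :* m :* η :* l :* ((𝟙 :+ 𝟙 :+ 𝟙 :+ u₀ :+ u₁ :+ u₂ :+ u₃ :+ u₄) :- k)
        :+ ((:- (k :* n :* m :+ η :* m :* m :* r)) :* (l :+ m :- (:- (δ :* n)))
        :+ (:- (n :* m :* p :* t :+ η :* m :* m :* p)) :* (n :+ m :- (:- (η :* l))))))))))))))
          refl k δ η l m n Δ u₀ u₁ u₂ u₃ u₄)
        (_ ⊛ r₂ ⊕ _ ⊛ r₄ ⊕ _ ⊛ C₄.t-product ⊕ _ ⊛ [1+u₃]s₃ ⊕ _ ⊛ [1+u]t ⊕ _ ⊛ t₄t ⊕ _ ⊛ r₃ ⊕ _ ⊛ pk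
         ⊕ _ ⊛ pΔ ⊕ _ ⊛ trace ⊕ _ ⊛ p₁ ⊕ _ ⊛ p₂)

    -- After multiplication by u₄ the factor u₂ (n t₃ + η m), with t₃ = 1 + u₀ + u₁, becomes (1 +
    -- u₃)(n t₃ + η m) = n k + η m (1 + u₃), linear in u₃. The factor u₄ can be cancelled only in a
    -- domain.
    NLD≈uDΛ : u₄ * ((m - n * u₂) * (m - l * u₁) * (n * t + η * m) - u₂ * (n * C₃.t + η * m) * Λ) ≈ 0#
    NLD≈uDΛ = trans
      (solve 12 (λ k η m n N L D Λ t₃ u₂ u₃ u₄ →
        u₄ :* (N :* L :* D :- u₂ :* (n :* t₃ :+ η :* m) :* Λ)
      := 𝟙 :* (u₄ :* N :* L :* D :- (n :* k :+ η :* m :* (𝟙 :+ u₃)) :* Λ)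
      :+ ((:- (n :* Λ)) :* ((𝟙 :+ u₃) :* t₃ :- k)
      :+ (:- ((n :* t₃ :+ η :* m) :* Λ)) :* (u₂ :* u₄ :- (𝟙 :+ u₃))))
        refl k η m n _ _ _ Λ C₃.t u₂ u₃ u₄)
      (_ ⊛ NLD≈uDΛ-cleared ⊕ _ ⊛ C₃.[1+u]t ⊕ _ ⊛ r₂)

-- Lyness cycles in an integral domain

NoZeroDivisors : ∀ {c ℓ} → CommutativeRing c ℓ → Set (c ⊔ ℓ)
NoZeroDivisors R = ∀ {x y} → ¬ (x ≈ 0#) → x * y ≈ 0# → y ≈ 0#
  where open CommutativeRing R

module Domain {c ℓ} (R : CommutativeRing c ℓ) (noZeroDivisors : NoZeroDivisors R) where
  open CommutativeRing R
  open IntegerCoefficients R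
  open RingLemmas R
  open Lyness R

  nonzero : Carrier → Set ℓ
  nonzero x = ¬ (x ≈ 0#)

  nonzero-* : ∀ {x y} → nonzero x → nonzero y → nonzero (x * y)
  nonzero-* x≉0 y≉0 xy≈0 = y≉0 (noZeroDivisors x≉0 xy≈0)

  nonzero-factorˡ : ∀ {x y} → nonzero (x * y) → nonzero x
  nonzero-factorˡ xy≉0 x≈0 = xy≉0 (trans (*-congʳ x≈0) (zeroˡ _))

  nonzero-factorʳ : ∀ {x y} → nonzero (x * y) → nonzero y
  nonzero-factorʳ xy≉0 y≈0 = xy≉0 (trans (*-congˡ y≈0) (zeroʳ _))

  nonzero-resp : ∀ {x y} → x ≈ y → nonzero x → nonzero y
  nonzero-resp e x≉0 y≈0 = x≉0 (trans e y≈0)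

  cancel : ∀ {a x y} → nonzero a → a * (x - y) ≈ 0# → x ≈ y
  cancel a≉0 e = x-y≈0⇒x≈y (noZeroDivisors a≉0 e)

  by-cancel : ∀ {a x y z} → nonzero a → a * (x - y) ≈ z → z ≈ 0# → x ≈ y
  by-cancel a≉0 e f = cancel a≉0 (trans e f)

  module _ {k δ η l m n Δ} (P : Parameters k δ η l m n Δ) (δ≉0 : nonzero δ) (η≉0 : nonzero η) where
    private
      N L : Carrier → Carrier
      N u = m - n * u
      L u = m - l * u
      D D̂ : Carrier → Carrier → Carrier
      D a b = n * (1# + a + b) + η * m
      D̂ a b = l * (1# + a + b) + δ * m

    module _ {u₀ u₁ u₂ u₃ u₄} (C : Cycle k u₀ u₁ u₂ u₃ u₄)
             (u₀≉0 : nonzero u₀) (u₁≉0 : nonzero u₁) (u₂≉0 : nonzero u₂) (u₄≉0 : nonzero u₄) where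
      open Cycle C
      private
        C₁ = rotate C
        C₂ = rotate C₁
        C₃ = rotate C₂
        C₄ = rotate C₃
        w≉0 : nonzero (1# + u₀)
        w≉0 = nonzero-resp r₄ (nonzero-* u₄≉0 u₁≉0)
        module I = Identities P C
        module Î = Identities (swap P) C

      -- `D̂` is eliminated between `ηLLu≈δND` for the exchanged parameters and `ηN[1+u]D̂≈δuDD`.
      NNN[1+u]≈LDD : N u₀ * N u₂ * N u₃ * (1# + u₀) ≈ L u₀ * D u₁ u₂ * D u₃ u₄
      NNN[1+u]≈LDD = by-cancel (nonzero-* δ≉0 u₀≉0)
        (solve 11 (λ δ η u w N₀ N₂ N₃ L₀ D₄ D₁ D̂ →
          δ :* u :* (N₀ :* N₂ :* N₃ :* w :- L₀ :* D₄ :* D₁)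
        := N₀ :* w :* (δ :* N₂ :* N₃ :* u :- η :* L₀ :* D̂)
        :+ L₀ :* (η :* N₀ :* w :* D̂ :- δ :* u :* D₄ :* D₁))
          refl δ η u₀ (1# + u₀) (N u₀) (N u₂) (N u₃) (L u₀) (D u₁ u₂) (D u₃ u₄) (D̂ u₂ u₃))
        (_ ⊛ Î.ηLLu≈δND ⊕ _ ⊛ I.ηN[1+u]D̂≈δuDD)

      δuNNNN≈ηLLLD : δ * u₀ * (N u₁ * N u₂ * N u₃ * N u₄) ≈ η * L u₄ * L u₀ * L u₁ * D u₂ u₃
      δuNNNN≈ηLLLD = by-cancel (nonzero-* δ≉0 w≉0)
        (solve 16 (λ δ η u₀ u₁ u₄ w N₁ N₂ N₃ N₄ L₀ L₁ L₄ D D̂₁ D̂₄ →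
          δ :* w :* (δ :* u₀ :* (N₁ :* N₂ :* N₃ :* N₄) :- η :* L₄ :* L₀ :* L₁ :* D)
        := u₀ :* (δ :* N₃ :* N₄ :* u₁) :* (δ :* N₁ :* N₂ :* u₄ :- η :* L₄ :* D̂₄)
        :+ (u₀ :* (η :* L₄ :* D̂₄) :* (δ :* N₃ :* N₄ :* u₁ :- η :* L₁ :* D̂₁)
        :+ ((:- (η :* L₄ :* L₁)) :* (δ :* L₀ :* w :* D :- η :* u₀ :* D̂₄ :* D̂₁)
        :+ (:- (δ :* δ :* u₀ :* N₁ :* N₂ :* N₃ :* N₄)) :* (u₄ :* u₁ :- w))))
          refl δ η u₀ u₁ u₄ (1# + u₀) (N u₁) (N u₂) (N u₃) (N u₄) (L u₀) (L u₁) (L u₄)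
               (D u₂ u₃) (D̂ u₃ u₄) (D̂ u₁ u₂))
        (_ ⊛ Identities.ηLLu≈δND (swap P) C₄ ⊕ _ ⊛ Identities.ηLLu≈δND (swap P) C₁ ⊕ _ ⊛ Î.ηN[1+u]D̂≈δuDD ⊕ _ ⊛ r₄)

      uNNNN≈DDΛ : u₀ * (N u₁ * N u₂ * N u₃ * N u₄) ≈ D u₀ u₁ * D u₄ u₀ * I.Λ
      uNNNN≈DDΛ = trans (by-cancel (nonzero-* δ≉0 u₂≉0)
        (solve 14 (λ δ η u₀ u₂ N₁ N₂ N₃ N₄ L₄ L₀ L₁ D₀ D₂ DΛ →
          δ :* u₂ :* (u₀ :* (N₁ :* N₂ :* N₃ :* N₄) :- DΛ :* D₂)
        := u₂ :* (δ :* u₀ :* (N₁ :* N₂ :* N₃ :* N₄) :- η :* L₄ :* L₀ :* L₁ :* D₀)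
        :+ (L₁ :* D₀ :* (η :* L₄ :* L₀ :* u₂ :- δ :* N₂ :* D₂)
        :+ δ :* D₂ :* (N₂ :* L₁ :* D₀ :- u₂ :* DΛ)))
          refl δ η u₀ u₂ (N u₁) (N u₂) (N u₃) (N u₄) (L u₄) (L u₀) (L u₁) (D u₂ u₃) (D u₄ u₀) (D u₀ u₁ * I.Λ))
        (_ ⊛ δuNNNN≈ηLLLD ⊕ _ ⊛ Identities.ηLLu≈δND P C₂ ⊕ _ ⊛ trans (cancel u₄≉0 I.NLD≈uDΛ) (*-assoc _ _ _)))
        (solve 3 (λ a b c → a :* b :* c := a :* c :* b) refl (D u₀ u₁) I.Λ (D u₄ u₀))

      -- This is the norm equation with denominators cleared: x_i is - u_(i+3) N_(i+1) / D_i with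
      -- D_i = D u_(i+2) u_(i+3), and the product of the u_i is k.
      norm-identity : δ * (D u₂ u₃ * D u₃ u₄ * D u₄ u₀ * D u₀ u₁ * D u₁ u₂)
                    ≈ η * k * (N u₀ * (N u₁ * N u₂ * N u₃ * N u₄))
      norm-identity = by-cancel u₀≉0
        (solve 15 (λ δ η k u w t Λ N₀ NNNN D̂ D₀ D₁ D₂ D₃ D₄ →
          u :* (δ :* (D₀ :* D₁ :* D₂ :* D₃ :* D₄) :- η :* k :* (N₀ :* NNNN))
        := (:- (D₀ :* D₂ :* D₃)) :* (η :* N₀ :* w :* D̂ :- δ :* u :* D₄ :* D₁)
        :+ (η :* N₀ :* w :* D₂ :* D₃ :* (D₀ :* D̂ :- t :* Λ)
        :+ ((:- (η :* N₀ :* w :* t)) :* (u :* NNNN :- D₃ :* D₂ :* Λ)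
        :+ η :* u :* N₀ :* NNNN :* (w :* t :- k))))
          refl δ η k u₀ (1# + u₀) (1# + u₂ + u₃) I.Λ (N u₀) (N u₁ * N u₂ * N u₃ * N u₄) (D̂ u₂ u₃)
               (D u₂ u₃) (D u₃ u₄) (D u₄ u₀) (D u₀ u₁) (D u₁ u₂))
        (_ ⊛ I.ηN[1+u]D̂≈δuDD ⊕ _ ⊛ I.DD̂≈tΛ ⊕ _ ⊛ uNNNN≈DDΛ ⊕ _ ⊛ CycleFacts.[1+u]t C)

      ηNNL[1+u]u≈δDDD : nonzero (N u₃) → η * N u₀ * N u₂ * L u₁ * (1# + u₀) * u₃ ≈ δ * D u₁ u₂ * D u₃ u₄ * D u₀ u₁
      ηNNL[1+u]u≈δDDD N₃≉0 = by-cancel (nonzero-* (nonzero-* δ≉0 u₀≉0) N₃≉0)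
        (solve 14 (λ δ η u₀ u₃ w N₀ N₂ N₃ L₀ L₁ D̂ D₁ D₃ D₄ →
          δ :* u₀ :* N₃ :* (η :* N₀ :* N₂ :* L₁ :* w :* u₃ :- δ :* D₄ :* D₁ :* D₃)
        := η :* N₀ :* L₁ :* w :* u₃ :* (δ :* N₂ :* N₃ :* u₀ :- η :* L₀ :* D̂)
        :+ (δ :* N₃ :* D₃ :* (η :* N₀ :* w :* D̂ :- δ :* u₀ :* D₄ :* D₁)
        :+ η :* N₀ :* w :* D̂ :* (η :* L₀ :* L₁ :* u₃ :- δ :* N₃ :* D₃)))
          refl δ η u₀ u₃ (1# + u₀) (N u₀) (N u₂) (N u₃) (L u₀) (L u₁) (D̂ u₂ u₃) (D u₃ u₄) (D u₀ u₁) (D u₁ u₂))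
        (_ ⊛ Î.ηLLu≈δND ⊕ _ ⊛ I.ηN[1+u]D̂≈δuDD ⊕ _ ⊛ Identities.ηLLu≈δND P C₃)

    module _ {u₀ u₁ u₂ u₃ u₄} (C : Cycle k u₀ u₁ u₂ u₃ u₄)
             (u₀≉0 : nonzero u₀) (u₁≉0 : nonzero u₁) (u₂≉0 : nonzero u₂) (u₃≉0 : nonzero u₃) (u₄≉0 : nonzero u₄)
             (D₀≉0 : nonzero (D u₂ u₃)) (D₁≉0 : nonzero (D u₃ u₄)) (D₂≉0 : nonzero (D u₄ u₀))
             (D₃≉0 : nonzero (D u₀ u₁)) (D₄≉0 : nonzero (D u₁ u₂)) where
      open Cycle C
      open Parameters P
      private
        C₁ = rotate C
        C₂ = rotate C₁

        norm₀ = norm-identity C u₀≉0 u₁≉0 u₂≉0 u₄≉0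

        -- The norm identity carries the non-vanishing of the denominators over to the numerators.
        ∏N≉0 : nonzero (N u₀ * (N u₁ * N u₂ * N u₃ * N u₄))
        ∏N≉0 = nonzero-factorʳ (nonzero-resp norm₀
          (nonzero-* δ≉0 (nonzero-* (nonzero-* (nonzero-* (nonzero-* D₀≉0 D₁≉0) D₂≉0) D₃≉0) D₄≉0)))

        N₀≉0 : nonzero (N u₀)
        N₀≉0 = nonzero-factorˡ ∏N≉0
        N₃≉0 : nonzero (N u₃)
        N₃≉0 = nonzero-factorʳ (nonzero-factorˡ (nonzero-factorʳ ∏N≉0))
        N₄≉0 : nonzero (N u₄)
        N₄≉0 = nonzero-factorʳ (nonzero-factorʳ ∏N≉0)

      -- `Λ-determinant` two places further along the cycle, u₂ L₀ N₄ - L₁ N₃ = Λ₂, multiplied by D₀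
      -- D₁ D₂ D₄. Each of its three terms is then rewritten by a multiplicative relation.
      three-term : (1# + u₀) * N u₀ * N u₂ * D u₂ u₃ * D u₄ u₀
         ≈ N u₀ * N u₁ * D u₃ u₄ * D u₄ u₀ + u₀ * N u₁ * N u₃ * D u₃ u₄ * D u₁ u₂
      three-term = by-cancel (nonzero-* (nonzero-* u₂≉0 N₃≉0) N₄≉0)
        (solve 16 (λ u₀ u₂ w₀ w₁ N₀ N₁ N₂ N₃ N₄ L₀ L₁ D₀ D₁ D₂ D₄ Λ →
          u₂ :* N₃ :* N₄ :* (w₀ :* N₀ :* N₂ :* D₀ :* D₂ :- (N₀ :* N₁ :* D₁ :* D₂ :+ u₀ :* N₁ :* N₃ :* D₁ :* D₄))
        := u₂ :* N₄ :* D₀ :* D₂ :* (N₀ :* N₂ :* N₃ :* w₀ :- L₀ :* D₄ :* D₁)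
        :+ ((:- (D₁ :* D₂)) :* (u₂ :* (N₃ :* N₄ :* N₀ :* N₁) :- D₀ :* D₄ :* Λ)
        :+ ((:- (N₃ :* D₁ :* D₄)) :* (N₁ :* N₃ :* N₄ :* w₁ :- L₁ :* D₀ :* D₂)
        :+ (D₀ :* D₁ :* D₂ :* D₄ :* ((u₂ :* L₀ :* N₄ :- L₁ :* N₃) :- Λ)
        :+ (:- (N₃ :* D₁ :* D₄ :* N₁ :* N₃ :* N₄)) :* (u₀ :* u₂ :- w₁)))))
          refl u₀ u₂ (1# + u₀) (1# + u₁) (N u₀) (N u₁) (N u₂) (N u₃) (N u₄) (L u₀) (L u₁)
               (D u₂ u₃) (D u₃ u₄) (D u₄ u₀) (D u₁ u₂) (Identities.Λ P C₂))
        (_ ⊛ NNN[1+u]≈LDD C u₀≉0 u₁≉0 u₂≉0 u₄≉0 ⊕ _ ⊛ uNNNN≈DDΛ C₂ u₂≉0 u₃≉0 u₄≉0 u₁≉0 ⊕ _ ⊛ NNN[1+u]≈LDD C₁ u₁≉0 u₂≉0 u₃≉0 u₀≉0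
          ⊕ _ ⊛ Identities.Λ-determinant P C₂ ⊕ _ ⊛ r₀)

      -- What remains of the second equation after 1 - x_i = η L_(i+3) / D_i is inserted and η L₃ L₄
      -- u₁ is replaced by δ N₁ D₁.
      cleared-equation : δ * ((1# + u₀) * N u₂ * D u₂ u₃ - N u₁ * D u₃ u₄) * D u₄ u₀ * D u₀ u₁
         ≈ η * u₀ * u₃ * (1# + u₀) * N u₁ * N u₂ * N u₃ * L u₁
      cleared-equation = by-cancel N₀≉0
        (solve 15 (λ δ η u₀ u₃ w N₀ N₁ N₂ N₃ L₁ D₀ D₁ D₂ D₃ D₄ →
          N₀ :* (δ :* (w :* N₂ :* D₀ :- N₁ :* D₁) :* D₂ :* D₃ :- η :* u₀ :* u₃ :* w :* N₁ :* N₂ :* N₃ :* L₁)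
        := δ :* D₃ :* (w :* N₀ :* N₂ :* D₀ :* D₂ :- (N₀ :* N₁ :* D₁ :* D₂ :+ u₀ :* N₁ :* N₃ :* D₁ :* D₄))
        :+ (:- (u₀ :* N₁ :* N₃)) :* (η :* N₀ :* N₂ :* L₁ :* w :* u₃ :- δ :* D₄ :* D₁ :* D₃))
          refl δ η u₀ u₃ (1# + u₀) (N u₀) (N u₁) (N u₂) (N u₃) (L u₁)
               (D u₂ u₃) (D u₃ u₄) (D u₄ u₀) (D u₀ u₁) (D u₁ u₂))
        (_ ⊛ three-term ⊕ _ ⊛ ηNNL[1+u]u≈δDDD C u₀≉0 u₁≉0 u₂≉0 u₄≉0 N₃≉0)

      module _ {x₀ x₁ x₂ x₃ x₄}
               (e₀ : x₀ * D u₂ u₃ ≈ - (u₃ * N u₁)) (e₁ : x₁ * D u₃ u₄ ≈ - (u₄ * N u₂))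
               (e₂ : x₂ * D u₄ u₀ ≈ - (u₀ * N u₃)) (e₃ : x₃ * D u₀ u₁ ≈ - (u₁ * N u₄))
               (e₄ : x₄ * D u₁ u₂ ≈ - (u₂ * N u₀)) where

        norm-equation : η * (x₀ * x₁ * x₂ * x₃ * x₄) ≈ - δ
        norm-equation = by-cancel (nonzero-* (nonzero-* (nonzero-* (nonzero-* D₀≉0 D₁≉0) D₂≉0) D₃≉0) D₄≉0)
          (begin
            D₀ * D₁ * D₂ * D₃ * D₄ * (η * (x₀ * x₁ * x₂ * x₃ * x₄) - - δ)
              ≈⟨ solve 12 (λ δ η x₀ x₁ x₂ x₃ x₄ D₀ D₁ D₂ D₃ D₄ →
                   D₀ :* D₁ :* D₂ :* D₃ :* D₄ :* (η :* (x₀ :* x₁ :* x₂ :* x₃ :* x₄) :- (:- δ))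
                 := η :* ((x₀ :* D₀) :* (x₁ :* D₁) :* (x₂ :* D₂) :* (x₃ :* D₃) :* (x₄ :* D₄))
                    :+ δ :* (D₀ :* D₁ :* D₂ :* D₃ :* D₄)) refl δ η x₀ x₁ x₂ x₃ x₄ D₀ D₁ D₂ D₃ D₄ ⟩
            η * ((x₀ * D₀) * (x₁ * D₁) * (x₂ * D₂) * (x₃ * D₃) * (x₄ * D₄)) + δ * (D₀ * D₁ * D₂ * D₃ * D₄)
              ≈⟨ +-cong (*-congˡ (*-cong (*-cong (*-cong (*-cong e₀ e₁) e₂) e₃) e₄)) norm₀ ⟩
            η * ((- (u₃ * N u₁)) * (- (u₄ * N u₂)) * (- (u₀ * N u₃)) * (- (u₁ * N u₄)) * (- (u₂ * N u₀)))
              + η * k * (N u₀ * (N u₁ * N u₂ * N u₃ * N u₄))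
              ≈⟨ solve 12 (λ η k u₀ u₁ u₂ u₃ u₄ N₀ N₁ N₂ N₃ N₄ →
                   η :* ((:- (u₃ :* N₁)) :* (:- (u₄ :* N₂)) :* (:- (u₀ :* N₃)) :* (:- (u₁ :* N₄)) :* (:- (u₂ :* N₀)))
                     :+ η :* k :* (N₀ :* (N₁ :* N₂ :* N₃ :* N₄))
                 := (:- (η :* (N₀ :* (N₁ :* N₂ :* N₃ :* N₄)))) :* (u₀ :* u₁ :* u₂ :* u₃ :* u₄ :- k))
                 refl η k u₀ u₁ u₂ u₃ u₄ (N u₀) (N u₁) (N u₂) (N u₃) (N u₄) ⟩
            - (η * (N u₀ * (N u₁ * N u₂ * N u₃ * N u₄))) * (u₀ * u₁ * u₂ * u₃ * u₄ - k) ∎)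
          (_ ⊛ norm)
          where
          open import Relation.Binary.Reasoning.Setoid setoid
          D₀ = D u₂ u₃
          D₁ = D u₃ u₄
          D₂ = D u₄ u₀
          D₃ = D u₀ u₁
          D₄ = D u₁ u₂

        equation : δ * η * x₁ - η * (x₀ * x₁ * x₂) * (1# - x₃) + (1# - x₀) * (1# - x₁) ≈ 0#
        -- The factor u₁ joins the denominators because `ηLLu≈δND`, applied to L₃ L₄, carries it.
        equation = noZeroDivisors (nonzero-* (nonzero-* (nonzero-* (nonzero-* D₀≉0 D₁≉0) D₂≉0) D₃≉0) u₁≉0)
          (begin
            D₀ * D₁ * D₂ * D₃ * u₁ * (δ * η * x₁ - η * (x₀ * x₁ * x₂) * (1# - x₃) + (1# - x₀) * (1# - x₁))
              ≈⟨ solve 11 (λ δ η u₁ x₀ x₁ x₂ x₃ D₀ D₁ D₂ D₃ →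
                   D₀ :* D₁ :* D₂ :* D₃ :* u₁ :*
                     (δ :* η :* x₁ :- η :* (x₀ :* x₁ :* x₂) :* (𝟙 :- x₃) :+ (𝟙 :- x₀) :* (𝟙 :- x₁))
                 := δ :* η :* (x₁ :* D₁) :* D₀ :* D₂ :* D₃ :* u₁
                    :- η :* u₁ :* ((x₀ :* D₀) :* (x₁ :* D₁) :* (x₂ :* D₂)) :* ((𝟙 :- x₃) :* D₃)
                    :+ ((𝟙 :- x₀) :* D₀) :* ((𝟙 :- x₁) :* D₁) :* D₂ :* D₃ :* u₁)
                 refl δ η u₁ x₀ x₁ x₂ x₃ D₀ D₁ D₂ D₃ ⟩
            δ * η * (x₁ * D₁) * D₀ * D₂ * D₃ * u₁ - η * u₁ * ((x₀ * D₀) * (x₁ * D₁) * (x₂ * D₂)) * ((1# - x₃) * D₃)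
              + ((1# - x₀) * D₀) * ((1# - x₁) * D₁) * D₂ * D₃ * u₁
              ≈⟨ +-cong (+-cong (*-congʳ (*-congʳ (*-congʳ (*-congʳ (*-congˡ e₁)))))
                                (-‿cong (*-cong (*-congˡ (*-cong (*-cong e₀ e₁) e₂)) (complement C₃ e₃))))
                        (*-congʳ (*-congʳ (*-congʳ (*-cong (complement C e₀) (complement C₁ e₁))))) ⟩
            δ * η * (- (u₄ * N u₂)) * D₀ * D₂ * D₃ * u₁
              - η * u₁ * ((- (u₃ * N u₁)) * (- (u₄ * N u₂)) * (- (u₀ * N u₃))) * (η * L u₁)
              + (η * L u₃) * (η * L u₄) * D₂ * D₃ * u₁
              ≈⟨ solve 16 (λ δ η u₀ u₁ u₃ u₄ N₁ N₂ N₃ L₁ L₃ L₄ D₀ D₁ D₂ D₃ → let w = 𝟙 :+ u₀ in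
                   δ :* η :* (:- (u₄ :* N₂)) :* D₀ :* D₂ :* D₃ :* u₁
                     :- η :* u₁ :* ((:- (u₃ :* N₁)) :* (:- (u₄ :* N₂)) :* (:- (u₀ :* N₃))) :* (η :* L₁)
                     :+ (η :* L₃) :* (η :* L₄) :* D₂ :* D₃ :* u₁
                 := (:- η) :* (δ :* (w :* N₂ :* D₀ :- N₁ :* D₁) :* D₂ :* D₃ :- η :* u₀ :* u₃ :* w :* N₁ :* N₂ :* N₃ :* L₁)
                 :+ (η :* D₂ :* D₃ :* (η :* L₃ :* L₄ :* u₁ :- δ :* N₁ :* D₁)
                 :+ (η :* η :* u₀ :* u₃ :* N₁ :* N₂ :* N₃ :* L₁ :- δ :* η :* N₂ :* D₀ :* D₂ :* D₃) :* (u₄ :* u₁ :- w)))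
                 refl δ η u₀ u₁ u₃ u₄ (N u₁) (N u₂) (N u₃) (L u₁) (L u₃) (L u₄) D₀ D₁ D₂ D₃ ⟩
            _ ≈⟨ _ ⊛ cleared-equation ⊕ _ ⊛ Identities.ηLLu≈δND P C₁ ⊕ _ ⊛ r₄ ⟩
            0# ∎)
          where
          open import Relation.Binary.Reasoning.Setoid setoid
          C₃ = rotate C₂
          D₀ = D u₂ u₃
          D₁ = D u₃ u₄
          D₂ = D u₄ u₀
          D₃ = D u₀ u₁

          -- The sum D + u₃ (m - n u₁) collapses: u₁ u₃ = 1 + u₂ removes u₁ and u₂, and n + m = - η
          -- l turns the rest into η (m - l u₃).
          complement : ∀ {u₀ u₁ u₂ u₃ u₄ x} → Cycle k u₀ u₁ u₂ u₃ u₄ → x * D u₂ u₃ ≈ - (u₃ * N u₁) →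
                       (1# - x) * D u₂ u₃ ≈ η * L u₃
          complement {u₁ = u₁} {u₂} {u₃} {x = x} C e = by-combination
            (solve 8 (λ η l m n x u₁ u₂ u₃ → let D = n :* (𝟙 :+ u₂ :+ u₃) :+ η :* m in
              (𝟙 :- x) :* D :- η :* (m :- l :* u₃)
            := (:- 𝟙) :* (x :* D :- (:- (u₃ :* (m :- n :* u₁))))
            :+ ((:- n) :* (u₁ :* u₃ :- (𝟙 :+ u₂))
            :+ u₃ :* (n :+ m :- (:- (η :* l)))))
              refl η l m n x u₁ u₂ u₃)
            (_ ⊛ e ⊕ _ ⊛ Cycle.r₁ C ⊕ _ ⊛ p₂)

-- Finite fields

absorption : ∀ n k → suc k ℕ.* (suc n choose suc k) ≡ suc n ℕ.* (n choose k)
absorption n       zero    = ≡.trans (ℕₚ.*-identityˡ _) (≡.trans (nC1≡n (suc n)) (≡.sym (ℕₚ.*-identityʳ (suc n))))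
absorption zero    (suc k) = ≡.trans (≡.cong (suc (suc k) ℕ.*_) (k>n⇒nCk≡0 {1} {suc (suc k)} (s≤s (s≤s z≤n)))) (ℕₚ.*-zeroʳ (suc (suc k)))
absorption (suc n) (suc k) = begin
  suc (suc k) ℕ.* (suc (suc n) choose suc (suc k))
    ≡⟨ ≡.cong (suc (suc k) ℕ.*_) (≡.sym (nCk+nC[k+1]≡[n+1]C[k+1] (suc n) (suc k))) ⟩
  suc (suc k) ℕ.* (a ℕ.+ b)
    ≡⟨ ℕₚ.*-distribˡ-+ (suc (suc k)) a b ⟩
  a ℕ.+ suc k ℕ.* a ℕ.+ suc (suc k) ℕ.* b
    ≡⟨ ≡.cong₂ (λ x y → a ℕ.+ x ℕ.+ y) (absorption n k) (absorption n (suc k)) ⟩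
  a ℕ.+ suc n ℕ.* (n choose k) ℕ.+ suc n ℕ.* (n choose suc k)
    ≡⟨ ℕₚ.+-assoc a _ _ ⟩
  a ℕ.+ (suc n ℕ.* (n choose k) ℕ.+ suc n ℕ.* (n choose suc k))
    ≡⟨ ≡.cong (a ℕ.+_) (≡.sym (ℕₚ.*-distribˡ-+ (suc n) (n choose k) (n choose suc k))) ⟩
  a ℕ.+ suc n ℕ.* (n choose k ℕ.+ n choose suc k)
    ≡⟨ ≡.cong (λ z → a ℕ.+ suc n ℕ.* z) (nCk+nC[k+1]≡[n+1]C[k+1] n k) ⟩
  suc (suc n) ℕ.* a ∎
  where
  open ≡.≡-Reasoning
  a = suc n choose suc k
  b = suc n choose suc (suc k)

-- By `absorption`, p divides k times the binomial coefficient, and it does not divide k.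
prime∣binomial : ∀ {p k} → Prime p → 0 ℕ.< k → k ℕ.< p → p ∣ℕ p choose k
prime∣binomial {suc p} {suc k} pp _ k<p with euclidsLemma (suc k) (suc p choose suc k) pp
  (≡.subst (suc p ∣ℕ_) (≡.sym (absorption p k)) (m∣m*n (p choose k)))
... | inj₁ p∣k = ⊥-elim (ℕₚ.<⇒≱ k<p (∣⇒≤ p∣k))
... | inj₂ p∣C = p∣C

module Freshman {c ℓ} (A : CommutativeRing c ℓ) where
  open CommutativeRing A hiding (zero)
  open import Algebra.Properties.Semiring.Exp semiring
  open import Algebra.Properties.Semiring.Mult semiring
  open import Algebra.Properties.Semiring.Sum semiring
  import Algebra.Properties.CommutativeSemiring.Binomial commutativeSemiring as Binomial
  open import Relation.Binary.Reasoning.Setoid setoid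

  module _ {p} (pp : Prime p) (p×1≈0 : p × 1# ≈ 0#) where

    p∣n⇒n×x≈0 : ∀ {n} → p ∣ℕ n → ∀ x → n × x ≈ 0#
    p∣n⇒n×x≈0 (divides m ≡.refl) x = begin
      (m ℕ.* p) × x            ≈⟨ ×-congʳ (m ℕ.* p) (sym (*-identityˡ x)) ⟩
      (m ℕ.* p) × (1# * x)     ≈⟨ sym (×-assoc-* (m ℕ.* p) 1# x) ⟩
      ((m ℕ.* p) × 1#) * x     ≈⟨ *-congʳ (×1-homo-* m p) ⟩
      ((m × 1#) * (p × 1#)) * x ≈⟨ *-congʳ (trans (*-congˡ p×1≈0) (zeroʳ _)) ⟩
      0# * x                   ≈⟨ zeroˡ x ⟩
      0#                       ∎

    private
      ends : ∀ n (f : Fin (suc (suc n)) → Carrier) →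
             (∀ i → f (suc (inject₁ i)) ≈ 0#) → sum f ≈ f zero + f (fromℕ (suc n))
      ends n f z = +-congˡ (trans (sum-init-last (f ∘ suc)) (trans (+-congʳ (trans (sum-cong-≋ z) (sum-replicate-zero n))) (+-identityˡ _)))

    freshman : ∀ x y → (x + y) ^ p ≈ x ^ p + y ^ p
    freshman x y = lemma p ≡.refl
      where
      -- A separate exponent can be matched as a successor, which isolating the first and the last
      -- binomial term requires.
      lemma : ∀ m → m ≡ p → (x + y) ^ m ≈ x ^ m + y ^ m
      lemma zero ≡.refl with prime⇒nonTrivial pp
      ... | ()
      lemma (suc m) ≡.refl = begin
        (x + y) ^ suc m                         ≈⟨ Binomial.theorem (suc m) x y ⟩
        sum (Binomial.binomialTerm x y (suc m)) ≈⟨ ends m (Binomial.binomialTerm x y (suc m)) (λ i → p∣n⇒n×x≈0 (prime∣binomial pp (s≤s z≤n)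
                                                     (s≤s (≡.subst (ℕ._< m) (≡.sym (Finₚ.toℕ-inject₁ i)) (Finₚ.toℕ<n i)))) (Binomial.binomial x y (suc m) (suc (inject₁ i)))) ⟩
        (suc m choose 0) × (1# * y ^ suc m) + (suc m choose toℕ (fromℕ (suc m))) × (x ^ toℕ (fromℕ (suc m)) * y ^ (suc m ℕ.∸ toℕ (fromℕ (suc m))))
          ≡⟨ ≡.cong (λ t → (suc m choose 0) × (1# * y ^ suc m) + (suc m choose t) × (x ^ t * y ^ (suc m ℕ.∸ t))) (Finₚ.toℕ-fromℕ (suc m)) ⟩
        (suc m choose 0) × (1# * y ^ suc m) + (suc m choose suc m) × (x ^ suc m * y ^ (m ℕ.∸ m))
          ≡⟨ ≡.cong₂ (λ a b → (suc m choose 0) × (1# * y ^ suc m) + a × (x ^ suc m * y ^ b)) (nCn≡1 (suc m)) (ℕₚ.n∸n≡0 m) ⟩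
        1 × (1# * y ^ suc m) + 1 × (x ^ suc m * 1#)
          ≈⟨ +-cong (trans (×-homo-1 _) (*-identityˡ _)) (trans (×-homo-1 _) (*-identityʳ _)) ⟩
        y ^ suc m + x ^ suc m                   ≈⟨ +-comm _ _ ⟩
        x ^ suc m + y ^ suc m                   ∎

    freshman-iterated : ∀ k x y → (x + y) ^ (p ℕ.^ k) ≈ x ^ (p ℕ.^ k) + y ^ (p ℕ.^ k)
    freshman-iterated zero x y = trans (*-identityʳ _) (+-cong (sym (*-identityʳ x)) (sym (*-identityʳ y)))
    freshman-iterated (suc k) x y = begin
      (x + y) ^ (p ℕ.* p ℕ.^ k)                     ≈⟨ sym (^-assocʳ (x + y) p (p ℕ.^ k)) ⟩
      ((x + y) ^ p) ^ (p ℕ.^ k)                     ≈⟨ ^-congˡ (p ℕ.^ k) (freshman x y) ⟩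
      (x ^ p + y ^ p) ^ (p ℕ.^ k)                   ≈⟨ freshman-iterated k (x ^ p) (y ^ p) ⟩
      (x ^ p) ^ (p ℕ.^ k) + (y ^ p) ^ (p ℕ.^ k)     ≈⟨ +-cong (^-assocʳ x p (p ℕ.^ k)) (^-assocʳ y p (p ℕ.^ k)) ⟩
      x ^ (p ℕ.* p ℕ.^ k) + y ^ (p ℕ.* p ℕ.^ k)     ∎

module _ {c ℓ} (M : CommutativeMonoid c ℓ) where
  open CommutativeMonoid M
  open Algebra.Properties.CommutativeMonoid.Sum M

  sum-single : ∀ {n} (h : Fin n → Carrier) i → (∀ j → j ≢ i → h j ≈ ε) → sum h ≈ h i
  sum-single {suc n} h zero    z = trans
    (∙-congˡ (trans (sum-cong-≋ (λ j → z (suc j) λ ())) (sum-replicate-zero n))) (identityʳ _)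
  sum-single {suc n} h (suc i) z = trans
    (∙-cong (z zero λ ()) (sum-single (h ∘ suc) i (λ j j≢i → z (suc j) (j≢i ∘ Finₚ.suc-injective)))) (identityˡ _)

module FiniteField {c ℓ} {K : CommutativeRing c ℓ} {n} (finite : IsFiniteField K n) where
  open CommutativeRing K hiding (zero)
  open IsFiniteField finite
  open import Algebra.Properties.Semiring.Exp semiring
  open import Algebra.Properties.Semiring.Mult semiring
  open import Algebra.Properties.Ring ring using (+-cancelˡ)
  open import Relation.Binary.Reasoning.Setoid setoid
  private
    module S = Algebra.Properties.CommutativeMonoid.Sum +-commutativeMonoid
    module P = Algebra.Properties.CommutativeMonoid.Sum *-commutativeMonoid

  index : Carrier → Fin n
  index x = proj₁ (enum-surj x)

  enum-index : ∀ x → enum (index x) ≈ x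
  enum-index x = proj₂ (enum-surj x)

  index-cong : ∀ {x y} → x ≈ y → index x ≡ index y
  index-cong {x} {y} e = enum-inj _ _ (trans (enum-index x) (trans e (sym (enum-index y))))

  infix 4 _≟_
  _≟_ : ∀ x y → Dec (x ≈ y)
  x ≟ y = map′ (λ e → trans (sym (enum-index x)) (trans (reflexive (≡.cong enum e)) (enum-index y))) index-cong (index x Fin.≟ index y)

  noZeroDivisors : NoZeroDivisors K
  noZeroDivisors {x} {y} x≉0 e with inverse x x≉0
  ... | z , xz≈1 = begin
    y           ≈⟨ sym (*-identityˡ y) ⟩
    1# * y      ≈⟨ *-congʳ (trans (sym xz≈1) (*-comm x z)) ⟩
    z * x * y   ≈⟨ *-assoc z x y ⟩
    z * (x * y) ≈⟨ *-congˡ e ⟩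
    z * 0#      ≈⟨ zeroʳ z ⟩
    0#          ∎

  private
    bijection : (f g : Carrier → Carrier) → (∀ {x y} → x ≈ y → f x ≈ f y) → (∀ {x y} → x ≈ y → g x ≈ g y) →
                (∀ x → f (g x) ≈ x) → (∀ x → g (f x) ≈ x) → Permutation n n
    bijection f g f-cong g-cong fg gf = permutation (λ i → index (f (enum i))) (λ i → index (g (enum i)))
      (λ i → enum-inj _ _ (trans (enum-index _) (trans (f-cong (enum-index _)) (fg (enum i)))))
      (λ i → enum-inj _ _ (trans (enum-index _) (trans (g-cong (enum-index _)) (gf (enum i)))))

  -- Translation by 1 permutes the elements, so adding n times 1 to their sum does not change it.
  n×1≈0 : n × 1# ≈ 0#
  n×1≈0 = +-cancelˡ (S.sum enum) _ _ (begin
    S.sum enum + n × 1#                      ≈⟨ +-congˡ (sym (S.sum-replicate n)) ⟩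
    S.sum enum + S.sum {n} (λ _ → 1#)        ≈⟨ sym (S.∑-distrib-+ enum (λ _ → 1#)) ⟩
    S.sum (λ i → enum i + 1#)                ≈⟨ sym (S.sum-cong-≋ (λ i → enum-index (enum i + 1#))) ⟩
    S.sum (λ i → enum (index (enum i + 1#))) ≈⟨ sym (S.sum-permute enum translation) ⟩
    S.sum enum                               ≈⟨ sym (+-identityʳ _) ⟩
    S.sum enum + 0#                          ∎)
    where
    translation = bijection (_+ 1#) (_+ - 1#) +-congʳ +-congʳ
      (λ x → trans (+-assoc x _ _) (trans (+-congˡ (-‿inverseˡ 1#)) (+-identityʳ x)))
      (λ x → trans (+-assoc x _ _) (trans (+-congˡ (-‿inverseʳ 1#)) (+-identityʳ x)))

  -- Some power of p annihilates 1 by `n×1≈0`. In a domain p itself must then do so.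
  characteristic : ∀ p k → n ≡ p ℕ.^ k → p × 1# ≈ 0#
  characteristic p k n≡p^k with p × 1# ≟ 0#
  ... | yes e = e
  ... | no  ¬e = ⊥-elim (nonzero k (trans (reflexive (≡.cong (_× 1#) (≡.sym n≡p^k))) n×1≈0))
    where
    nonzero : ∀ k → ¬ ((p ℕ.^ k) × 1# ≈ 0#)
    nonzero zero    e = 0≉1 (sym (trans (sym (+-identityʳ 1#)) e))
    nonzero (suc k) e = nonzero k (noZeroDivisors ¬e (trans (sym (×1-homo-* p (p ℕ.^ k))) e))

  private
    unless-0 : ∀ {a} {B : Set a} → Carrier → B → B → B
    unless-0 x b b′ with x ≟ 0#
    ... | yes _ = b
    ... | no  _ = b′

    ∏-nonzero : ∀ {m} (f : Fin m → Carrier) → (∀ i → ¬ (f i ≈ 0#)) → ¬ (P.sum f ≈ 0#)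
    ∏-nonzero {zero}  f nz e = 0≉1 (sym e)
    ∏-nonzero {suc m} f nz e = ∏-nonzero (f ∘ suc) (nz ∘ suc) (noZeroDivisors (nz zero) e)

  -- Multiplication by a permutes the non-zero elements. To keep products over all of `Fin n`, zero
  -- is replaced by 1 in `f`, and the n factors a are distributed over `g`, away from zero, and `h`,
  -- at zero. Then `g` has product 1 and `h` has product a.
  fermat : .{{_ : ℕ.NonZero n}} → ∀ a → a ^ n ≈ a
  fermat a with a ≟ 0#
  ... | yes a≈0 = trans (^-congˡ n a≈0) (trans (0^ n) (sym a≈0))
    where
    0^ : ∀ m → .{{_ : ℕ.NonZero m}} → 0# ^ m ≈ 0#
    0^ (suc m) = zeroˡ _
  ... | no a≉0 = begin
    a ^ n                    ≈⟨ sym (P.sum-replicate n) ⟩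
    P.sum {n} (λ _ → a)      ≈⟨ P.sum-cong-≋ split ⟩
    P.sum (λ i → g i * h i)  ≈⟨ P.∑-distrib-+ g h ⟩
    P.sum g * P.sum h        ≈⟨ *-cong ∏g≈1 ∏h≈a ⟩
    1# * a                   ≈⟨ *-identityˡ a ⟩
    a                        ∎
    where
    f g h : Fin n → Carrier
    f i = unless-0 (enum i) 1# (enum i)
    g i = unless-0 (enum i) 1# a
    h i = unless-0 (enum i) a 1#

    a⁻¹ = proj₁ (inverse a a≉0)
    a*a⁻¹ : a * a⁻¹ ≈ 1#
    a*a⁻¹ = proj₂ (inverse a a≉0)

    split : ∀ i → a ≈ g i * h i
    split i with enum i ≟ 0#
    ... | yes _ = sym (*-identityˡ a)
    ... | no  _ = sym (*-identityʳ a)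

    ∏h≈a : P.sum h ≈ a
    ∏h≈a = trans (sum-single *-commutativeMonoid h (index 0#) others) here
      where
      others : ∀ j → j ≢ index 0# → h j ≈ 1#
      others j j≢ with enum j ≟ 0#
      ... | yes e = ⊥-elim (j≢ (enum-inj _ _ (trans e (sym (enum-index 0#)))))
      ... | no _  = refl
      here : h (index 0#) ≈ a
      here with enum (index 0#) ≟ 0#
      ... | yes _ = refl
      ... | no ¬e = ⊥-elim (¬e (enum-index 0#))

    scaling : Permutation n n
    scaling = bijection (a *_) (a⁻¹ *_) *-congˡ *-congˡ
      (λ x → trans (sym (*-assoc _ _ _)) (trans (*-congʳ a*a⁻¹) (*-identityˡ x)))
      (λ x → trans (sym (*-assoc _ _ _)) (trans (*-congʳ (trans (*-comm _ _) a*a⁻¹)) (*-identityˡ x)))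

    f-scaled : ∀ i → f (index (a * enum i)) ≈ g i * f i
    f-scaled i with enum i ≟ 0# | enum (index (a * enum i)) ≟ 0#
    ... | yes _ | yes _ = sym (*-identityˡ 1#)
    ... | yes e | no ¬e = ⊥-elim (¬e (trans (enum-index _) (trans (*-congˡ e) (zeroʳ a))))
    ... | no ¬e | yes e = ⊥-elim (¬e (noZeroDivisors a≉0 (trans (sym (enum-index _)) e)))
    ... | no _  | no _  = enum-index _

    f≉0 : ∀ i → ¬ (f i ≈ 0#)
    f≉0 i with enum i ≟ 0#
    ... | yes _ = λ e → 0≉1 (sym e)
    ... | no ¬e = ¬e

    ∏g≈1 : P.sum g ≈ 1#
    ∏g≈1 = begin
      P.sum g                                 ≈⟨ sym (*-identityʳ _) ⟩
      P.sum g * 1#                            ≈⟨ *-congˡ (sym ∏f*y≈1) ⟩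
      P.sum g * (P.sum f * y)                 ≈⟨ sym (*-assoc _ _ _) ⟩
      P.sum g * P.sum f * y                   ≈⟨ *-congʳ (sym (P.∑-distrib-+ g f)) ⟩
      P.sum (λ i → g i * f i) * y             ≈⟨ *-congʳ (sym (P.sum-cong-≋ f-scaled)) ⟩
      P.sum (λ i → f (index (a * enum i))) * y ≈⟨ *-congʳ (sym (P.sum-permute f scaling)) ⟩
      P.sum f * y                             ≈⟨ ∏f*y≈1 ⟩
      1#                                      ∎
      where
      y = proj₁ (inverse (P.sum f) (∏-nonzero f f≉0))
      ∏f*y≈1 : P.sum f * y ≈ 1#
      ∏f*y≈1 = proj₂ (inverse (P.sum f) (∏-nonzero f f≉0))

-- Polynomials

module Polynomials {c ℓ} (K : CommutativeRing c ℓ) where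
  open CommutativeRing K
  open IntegerCoefficients K
  open import Algebra.Properties.Ring ring using (-0#≈0#)
  open import Relation.Binary.Reasoning.Setoid setoid

  Series : Set c
  Series = ℕ → Carrier

  tail : Series → Series
  tail f i = f (suc i)

  -- For arbitrary sequences the laws of the product are proved by recursion on the index, without
  -- regard to the lengths of lists.
  conv : Series → Series → Series
  conv f g zero    = f 0 * g 0
  conv f g (suc n) = f 0 * g (suc n) + conv (tail f) g n

  conv-cong : ∀ {f f′ g g′} → (∀ i → f i ≈ f′ i) → (∀ i → g i ≈ g′ i) → ∀ n → conv f g n ≈ conv f′ g′ n
  conv-cong p q zero    = *-cong (p 0) (q 0)
  conv-cong p q (suc n) = +-cong (*-cong (p 0) (q (suc n))) (conv-cong (λ i → p (suc i)) q n)

  conv-zeroˡ : ∀ {f} g → (∀ i → f i ≈ 0#) → ∀ n → conv f g n ≈ 0#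
  conv-zeroˡ g p zero    = trans (*-congʳ (p 0)) (zeroˡ _)
  conv-zeroˡ g p (suc n) = trans (+-cong (trans (*-congʳ (p 0)) (zeroˡ _)) (conv-zeroˡ g (λ i → p (suc i)) n)) (+-identityˡ 0#)

  conv-constˡ : ∀ {f} g → (∀ i → f (suc i) ≈ 0#) → ∀ n → conv f g n ≈ f 0 * g n
  conv-constˡ g p zero    = refl
  conv-constˡ g p (suc n) = trans (+-congˡ (conv-zeroˡ g p n)) (+-identityʳ _)

  conv-distribʳ : ∀ f g h n → conv (λ i → f i + g i) h n ≈ conv f h n + conv g h n
  conv-distribʳ f g h zero    = distribʳ _ _ _
  conv-distribʳ f g h (suc n) = trans (+-congˡ (conv-distribʳ (tail f) (tail g) h n))
    (solve 5 (λ a b c d e → (a :+ b) :* c :+ (d :+ e) := (a :* c :+ d) :+ (b :* c :+ e)) refl _ _ _ _ _)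

  conv-scaleˡ : ∀ a f g n → conv (λ i → a * f i) g n ≈ a * conv f g n
  conv-scaleˡ a f g zero    = *-assoc _ _ _
  conv-scaleˡ a f g (suc n) = trans (+-congˡ (conv-scaleˡ a (tail f) g n))
    (solve 4 (λ a b c d → a :* b :* c :+ a :* d := a :* (b :* c :+ d)) refl _ _ _ _)

  conv-sucʳ : ∀ f g n → conv f g (suc n) ≈ conv f (tail g) n + f (suc n) * g 0
  conv-sucʳ f g zero    = refl
  conv-sucʳ f g (suc n) = trans (+-congˡ (conv-sucʳ (tail f) g n)) (sym (+-assoc _ _ _))

  conv-comm : ∀ f g n → conv f g n ≈ conv g f n
  conv-comm f g zero    = *-comm _ _
  conv-comm f g (suc n) = begin
    f 0 * g (suc n) + conv (tail f) g n   ≈⟨ +-cong (*-comm _ _) (conv-comm (tail f) g n) ⟩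
    g (suc n) * f 0 + conv g (tail f) n   ≈⟨ +-comm _ _ ⟩
    conv g (tail f) n + g (suc n) * f 0   ≈⟨ sym (conv-sucʳ g f n) ⟩
    conv g f (suc n)                      ∎

  conv-assoc : ∀ f g h n → conv (conv f g) h n ≈ conv f (conv g h) n
  conv-assoc f g h zero    = *-assoc _ _ _
  conv-assoc f g h (suc n) = begin
    f 0 * g 0 * h (suc n) + conv (λ i → f 0 * g (suc i) + conv (tail f) g i) h n
      ≈⟨ +-congˡ (conv-distribʳ _ _ h n) ⟩
    f 0 * g 0 * h (suc n) + (conv (λ i → f 0 * g (suc i)) h n + conv (conv (tail f) g) h n)
      ≈⟨ +-congˡ (+-cong (conv-scaleˡ _ _ h n) (conv-assoc (tail f) g h n)) ⟩
    f 0 * g 0 * h (suc n) + (f 0 * conv (tail g) h n + conv (tail f) (conv g h) n)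
      ≈⟨ solve 5 (λ a b c d e → a :* b :* c :+ (a :* d :+ e) := a :* (b :* c :+ d) :+ e) refl _ _ _ _ _ ⟩
    f 0 * (g 0 * h (suc n) + conv (tail g) h n) + conv (tail f) (conv g h) n ∎

  Poly : Set c
  Poly = List Carrier

  coeff : Poly → Series
  coeff []      i       = 0#
  coeff (a ∷ f) zero    = a
  coeff (a ∷ f) (suc i) = coeff f i

  infix 4 _≋_
  -- Lists may end in zeros, so equality cannot be that of lists. The record keeps f and g inferable
  -- from a proof.
  record _≋_ (f g : Poly) : Set ℓ where
    constructor coeffwise
    field at : ∀ i → coeff f i ≈ coeff g i
  open _≋_ public

  infixl 6 _⊞_
  infixl 7 _⊠_

  -- Opaque, because unfolding concrete polynomials such as X makes unification of equations in K[X] fail.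
  opaque
    _⊞_ : Poly → Poly → Poly
    []      ⊞ g       = g
    (a ∷ f) ⊞ []      = a ∷ f
    (a ∷ f) ⊞ (b ∷ g) = (a + b) ∷ (f ⊞ g)

    _⊠_ : Poly → Poly → Poly
    []      ⊠ g = []
    (a ∷ f) ⊠ g = map (a *_) g ⊞ (0# ∷ f ⊠ g)

    neg : Poly → Poly
    neg = map (λ a → - a)

    C : Carrier → Poly
    C a = a ∷ []

    X : Poly
    X = 0# ∷ 1# ∷ []

    coeff-⊞ : ∀ f g i → coeff (f ⊞ g) i ≈ coeff f i + coeff g i
    coeff-⊞ []      g       i       = sym (+-identityˡ _)
    coeff-⊞ (a ∷ f) []      i       = sym (+-identityʳ _)
    coeff-⊞ (a ∷ f) (b ∷ g) zero    = refl
    coeff-⊞ (a ∷ f) (b ∷ g) (suc i) = coeff-⊞ f g i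

    coeff-neg : ∀ f i → coeff (neg f) i ≈ - coeff f i
    coeff-neg []      i       = sym -0#≈0#
    coeff-neg (a ∷ f) zero    = refl
    coeff-neg (a ∷ f) (suc i) = coeff-neg f i

    coeff-scale : ∀ a f i → coeff (map (a *_) f) i ≈ a * coeff f i
    coeff-scale a []      i       = sym (zeroʳ a)
    coeff-scale a (b ∷ f) zero    = refl
    coeff-scale a (b ∷ f) (suc i) = coeff-scale a f i

    coeff-⊠ : ∀ f g i → coeff (f ⊠ g) i ≈ conv (coeff f) (coeff g) i
    coeff-⊠ []      g i       = sym (conv-zeroˡ (coeff g) (λ _ → refl) i)
    coeff-⊠ (a ∷ f) g zero    = trans (coeff-⊞ (map (a *_) g) _ 0) (trans (+-identityʳ _) (coeff-scale a g 0))
    coeff-⊠ (a ∷ f) g (suc i) = trans (coeff-⊞ (map (a *_) g) _ (suc i)) (+-cong (coeff-scale a g (suc i)) (coeff-⊠ f g i))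

    coeff-C-zero : ∀ a → coeff (C a) 0 ≈ a
    coeff-C-zero a = refl

    coeff-C-suc : ∀ a i → coeff (C a) (suc i) ≈ 0#
    coeff-C-suc a i = refl

  private
    conv-1 : ∀ g n → conv (coeff (C 1#)) g n ≈ g n
    conv-1 g n = trans (conv-constˡ g (coeff-C-suc 1#) n) (trans (*-congʳ (coeff-C-zero 1#)) (*-identityˡ _))

  K[X] : CommutativeRing c ℓ
  K[X] = record
    { Carrier = Poly ; _≈_ = _≋_ ; _+_ = _⊞_ ; _*_ = _⊠_ ; -_ = neg ; 0# = [] ; 1# = C 1#
    ; isCommutativeRing = record
      { isRing = record
        { +-isAbelianGroup = record
          { isGroup = record
            { isMonoid = record
              { isSemigroup = record
                { isMagma = record
                  { isEquivalence = record
                    { refl  = coeffwise λ i → refl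
                    ; sym   = λ p → coeffwise λ i → sym (at p i)
                    ; trans = λ p q → coeffwise λ i → trans (at p i) (at q i) }
                  ; ∙-cong = λ {f} {f′} {g} {g′} p q → coeffwise λ i →
                      trans (coeff-⊞ f g i) (trans (+-cong (at p i) (at q i)) (sym (coeff-⊞ f′ g′ i))) }
                ; assoc = λ f g h → coeffwise λ i → begin
                    coeff (f ⊞ g ⊞ h) i                      ≈⟨ coeff-⊞ (f ⊞ g) h i ⟩
                    coeff (f ⊞ g) i + coeff h i              ≈⟨ +-congʳ (coeff-⊞ f g i) ⟩
                    coeff f i + coeff g i + coeff h i        ≈⟨ +-assoc _ _ _ ⟩
                    coeff f i + (coeff g i + coeff h i)      ≈⟨ +-congˡ (sym (coeff-⊞ g h i)) ⟩
                    coeff f i + coeff (g ⊞ h) i              ≈⟨ sym (coeff-⊞ f (g ⊞ h) i) ⟩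
                    coeff (f ⊞ (g ⊞ h)) i                    ∎ }
              ; identity = (λ f → coeffwise λ i → trans (coeff-⊞ [] f i) (+-identityˡ _))
                         , (λ f → coeffwise λ i → trans (coeff-⊞ f [] i) (+-identityʳ _)) }
            ; inverse = (λ f → coeffwise λ i → trans (coeff-⊞ (neg f) f i) (trans (+-congʳ (coeff-neg f i)) (-‿inverseˡ _)))
                      , (λ f → coeffwise λ i → trans (coeff-⊞ f (neg f) i) (trans (+-congˡ (coeff-neg f i)) (-‿inverseʳ _)))
            ; ⁻¹-cong = λ {f} {g} p → coeffwise λ i → trans (coeff-neg f i) (trans (-‿cong (at p i)) (sym (coeff-neg g i))) }
          ; comm = λ f g → coeffwise λ i → trans (coeff-⊞ f g i) (trans (+-comm _ _) (sym (coeff-⊞ g f i))) }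
        ; *-cong = λ {f} {f′} {g} {g′} p q → coeffwise λ i →
            trans (coeff-⊠ f g i) (trans (conv-cong (at p) (at q) i) (sym (coeff-⊠ f′ g′ i)))
        ; *-assoc = λ f g h → coeffwise λ i → begin
            coeff (f ⊠ g ⊠ h) i                            ≈⟨ coeff-⊠ (f ⊠ g) h i ⟩
            conv (coeff (f ⊠ g)) (coeff h) i               ≈⟨ conv-cong (coeff-⊠ f g) (λ _ → refl) i ⟩
            conv (conv (coeff f) (coeff g)) (coeff h) i    ≈⟨ conv-assoc _ _ _ i ⟩
            conv (coeff f) (conv (coeff g) (coeff h)) i    ≈⟨ conv-cong (λ _ → refl) (λ j → sym (coeff-⊠ g h j)) i ⟩
            conv (coeff f) (coeff (g ⊠ h)) i               ≈⟨ sym (coeff-⊠ f (g ⊠ h) i) ⟩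
            coeff (f ⊠ (g ⊠ h)) i                          ∎
        ; *-identity = (λ f → coeffwise λ i → trans (coeff-⊠ (C 1#) f i) (conv-1 (coeff f) i))
                     , (λ f → coeffwise λ i → trans (coeff-⊠ f (C 1#) i) (trans (conv-comm _ _ i) (conv-1 (coeff f) i)))
        ; distrib = (λ f g h → coeffwise λ i → trans (⊠-comm f (g ⊞ h) i) (trans (⊠-distribʳ f g h i)
                        (trans (+-cong (⊠-comm g f i) (⊠-comm h f i)) (sym (coeff-⊞ (f ⊠ g) (f ⊠ h) i)))))
                  , (λ f g h → coeffwise λ i → trans (⊠-distribʳ f g h i) (sym (coeff-⊞ (g ⊠ f) (h ⊠ f) i))) }
      ; *-comm = λ f g → coeffwise (⊠-comm f g) } }
    where
    ⊠-comm : ∀ f g i → coeff (f ⊠ g) i ≈ coeff (g ⊠ f) i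
    ⊠-comm f g i = trans (coeff-⊠ f g i) (trans (conv-comm _ _ i) (sym (coeff-⊠ g f i)))
    ⊠-distribʳ : ∀ f g h i → coeff ((g ⊞ h) ⊠ f) i ≈ coeff (g ⊠ f) i + coeff (h ⊠ f) i
    ⊠-distribʳ f g h i = begin
      coeff ((g ⊞ h) ⊠ f) i                                         ≈⟨ coeff-⊠ (g ⊞ h) f i ⟩
      conv (coeff (g ⊞ h)) (coeff f) i                              ≈⟨ conv-cong (coeff-⊞ g h) (λ _ → refl) i ⟩
      conv (λ j → coeff g j + coeff h j) (coeff f) i                ≈⟨ conv-distribʳ _ _ _ i ⟩
      conv (coeff g) (coeff f) i + conv (coeff h) (coeff f) i       ≈⟨ sym (+-cong (coeff-⊠ g f i) (coeff-⊠ h f i)) ⟩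
      coeff (g ⊠ f) i + coeff (h ⊠ f) i                             ∎

  private module R = CommutativeRing K[X]

  opaque
    unfolding _⊞_

    C-cong : ∀ {a b} → a ≈ b → C a ≋ C b
    C-cong e = coeffwise λ { zero → e ; (suc i) → refl }

    C-+ : ∀ a b → C (a + b) ≋ C a ⊞ C b
    C-+ a b = R.refl

    C-* : ∀ a b → C (a * b) ≋ C a ⊠ C b
    C-* a b = coeffwise λ { zero → sym (+-identityʳ _) ; (suc i) → refl }

    C-neg : ∀ a → C (- a) ≋ neg (C a)
    C-neg a = R.refl

    C-0 : C 0# ≋ []
    C-0 = coeffwise λ { zero → refl ; (suc i) → refl }

    cons : ∀ a f → a ∷ f ≋ C a ⊞ X ⊠ f
    cons a f = coeffwise λ
      { zero → sym (trans (coeff-⊞ (C a) (X ⊠ f) 0) (trans (+-congˡ (trans (coeff-⊠ X f 0) (zeroˡ _))) (+-identityʳ a)))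
      ; (suc i) → sym (trans (coeff-⊞ (C a) (X ⊠ f) (suc i)) (trans (+-identityˡ _) (trans (coeff-⊠ X f (suc i))
          (trans (+-cong (zeroˡ _) (conv-1 (coeff f) i)) (+-identityˡ _))))) }

  -- Since a may be zero, this only bounds the degree by d, and sums whose leading terms cancel are
  -- covered. That a is non-zero is assumed separately wherever the exact degree matters.
  record Lead (d : ℕ) (a : Carrier) (f : Poly) : Set ℓ where
    constructor lead
    field
      leading : coeff f d ≈ a
      above   : ∀ i → d ℕ.< i → coeff f i ≈ 0#

  Lead-resp : ∀ {d a f g} → f ≋ g → Lead d a f → Lead d a g
  Lead-resp p (lead e z) = lead (trans (sym (at p _)) e) (λ i l → trans (sym (at p i)) (z i l))

  Lead-+ : ∀ {d a b f g} → Lead d a f → Lead d b g → Lead d (a + b) (f ⊞ g)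
  Lead-+ {f = f} {g} (lead e z) (lead e′ z′) = lead (trans (coeff-⊞ f g _) (+-cong e e′))
    (λ i l → trans (coeff-⊞ f g i) (trans (+-cong (z i l) (z′ i l)) (+-identityˡ 0#)))

  Lead-neg : ∀ {d a f} → Lead d a f → Lead d (- a) (neg f)
  Lead-neg {f = f} (lead e z) = lead (trans (coeff-neg f _) (-‿cong e))
    (λ i l → trans (coeff-neg f i) (trans (-‿cong (z i l)) -0#≈0#))

  Lead-weaken : ∀ {d e a f} → d ℕ.< e → Lead d a f → Lead e 0# f
  Lead-weaken d<e (lead _ z) = lead (z _ d<e) (λ i l → z i (ℕₚ.<-trans d<e l))

  Lead-+ˡ : ∀ {d e a b f g} → e ℕ.< d → Lead d a f → Lead e b g → Lead d a (f ⊞ g)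
  Lead-+ˡ e<d p q with Lead-+ p (Lead-weaken e<d q)
  ... | lead e z = lead (trans e (+-identityʳ _)) z

  opaque
    unfolding _⊞_

    Lead-C : ∀ a → Lead 0 a (C a)
    Lead-C a = lead refl λ { (suc i) _ → refl }

    Lead-X : Lead 1 1# X
    Lead-X = lead refl λ { (suc (suc i)) _ → refl ; (suc zero) (s≤s ()) }

  private
    conv-above : ∀ {f g} d e → (∀ i → d ℕ.< i → f i ≈ 0#) → (∀ i → e ℕ.< i → g i ≈ 0#) →
                 ∀ i → d ℕ.+ e ℕ.< i → conv f g i ≈ 0#
    conv-above {f} {g} zero e z z′ i l =
      trans (conv-constˡ g (λ j → z (suc j) (s≤s z≤n)) i) (trans (*-congˡ (z′ i l)) (zeroʳ _))
    conv-above {f} (suc d) e z z′ (suc i) (s≤s l) = trans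
      (+-cong (trans (*-congˡ (z′ (suc i) (s≤s (ℕₚ.≤-trans (ℕₚ.m≤n+m e (suc d)) l)))) (zeroʳ _))
              (conv-above d e (λ j j>d → z (suc j) (s≤s j>d)) z′ i l))
      (+-identityˡ 0#)

    conv-leading : ∀ {f g} d e → (∀ i → d ℕ.< i → f i ≈ 0#) → (∀ i → e ℕ.< i → g i ≈ 0#) →
                   conv f g (d ℕ.+ e) ≈ f d * g e
    conv-leading {f} {g} zero e z z′ = conv-constˡ g (λ j → z (suc j) (s≤s z≤n)) e
    conv-leading {f} (suc d) e z z′ = trans
      (+-cong (trans (*-congˡ (z′ (suc (d ℕ.+ e)) (s≤s (ℕₚ.m≤n+m e d)))) (zeroʳ _))
              (conv-leading d e (λ j j>d → z (suc j) (s≤s j>d)) z′))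
      (+-identityˡ _)

  Lead-* : ∀ {d e a b f g} → Lead d a f → Lead e b g → Lead (d ℕ.+ e) (a * b) (f ⊠ g)
  Lead-* {d} {e} {f = f} {g} (lead p z) (lead p′ z′) = lead
    (trans (coeff-⊠ f g _) (trans (conv-leading d e z z′) (*-cong p p′)))
    (λ i l → trans (coeff-⊠ f g i) (conv-above d e z z′ i l))

  module Degree (noZeroDivisors : NoZeroDivisors K) where

    -- As g has no coefficient beyond d, the condition at i + 1 for b ∷ h is the condition at i for
    -- h. So h vanishes by recursion, and the coefficient at d is then b times the leading
    -- coefficient of g.
    multiple-of-low-degree : ∀ {d a g} → ¬ (a ≈ 0#) → Lead d a g → ∀ h →
      (∀ i → d ℕ.≤ i → conv (coeff h) (coeff g) i ≈ 0#) → h ≋ []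
    multiple-of-low-degree a≉0 g-lead [] z = R.refl
    multiple-of-low-degree {d} {a} {g} a≉0 g-lead (b ∷ h) z = coeffwise λ
      { zero → noZeroDivisors a≉0 (trans (*-comm a b) (trans (*-congˡ (sym (Lead.leading g-lead)))
                 (trans (sym (conv-constˡ (coeff g) (at h≋0) d)) (z d ℕₚ.≤-refl))))
      ; (suc i) → at h≋0 i }
      where
      h≋0 : h ≋ []
      h≋0 = multiple-of-low-degree a≉0 g-lead h λ i d≤i → begin
        conv (coeff h) (coeff g) i                          ≈⟨ sym (+-identityˡ _) ⟩
        0# + conv (coeff h) (coeff g) i                     ≈⟨ +-congʳ (sym (trans (*-congˡ (Lead.above g-lead (suc i) (s≤s d≤i))) (zeroʳ b))) ⟩
        b * coeff g (suc i) + conv (coeff h) (coeff g) i    ≈⟨ z (suc i) (ℕₚ.m≤n⇒m≤1+n d≤i) ⟩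
        0#                                                  ∎

    multiple-of-low-degree-zero : ∀ {d a g f h} → ¬ (a ≈ 0#) → Lead d a g → f ≋ h ⊠ g →
      (∀ i → d ℕ.≤ i → coeff f i ≈ 0#) → f ≋ []
    multiple-of-low-degree-zero {g = g} {f} {h} a≉0 g-lead e z = R.trans e (R.trans (R.*-congʳ {g} h≋0) (R.zeroˡ g))
      where
      h≋0 : h ≋ []
      h≋0 = multiple-of-low-degree a≉0 g-lead h λ i d≤i →
        trans (sym (coeff-⊠ h g i)) (trans (sym (at e i)) (z i d≤i))

-- Products and units

module Products {c ℓ} (A : CommutativeRing c ℓ) where
  open CommutativeRing A
  open IntegerCoefficients A

  ∏ : ∀ {b} {B : Set b} → List B → (B → Carrier) → Carrier
  ∏ xs g = foldr (λ x r → g x * r) 1# xs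

  Unit : Carrier → Set (c ⊔ ℓ)
  Unit x = ∃ λ y → x * y ≈ 1#

  unit-cancel : ∀ {x y} → Unit x → x * y ≈ 0# → y ≈ 0#
  unit-cancel {x} {y} (z , xz≈1) e =
    trans (sym (*-identityˡ y)) (trans (*-congʳ (sym xz≈1))
      (trans (solve 3 (λ x y z → x :* z :* y := z :* (x :* y)) refl x y z) (trans (*-congˡ e) (zeroʳ z))))

  unit-factor : ∀ {x y} → Unit (x * y) → Unit x
  unit-factor (z , e) = _ , trans (sym (*-assoc _ _ _)) e

  unit-resp : ∀ {x y} → x ≈ y → Unit x → Unit y
  unit-resp e (z , xz≈1) = z , trans (*-congʳ (sym e)) xz≈1

  unit-* : ∀ {x y} → Unit x → Unit y → Unit (x * y)
  unit-* {x} {y} (a , p) (b , q) = a * b ,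
    trans (solve 4 (λ x y a b → x :* y :* (a :* b) := (x :* a) :* (y :* b)) refl x y a b) (trans (*-cong p q) (*-identityˡ 1#))

  ∏-cong : ∀ {b} {B : Set b} {g h : B → Carrier} xs → (∀ x → g x ≈ h x) → ∏ xs g ≈ ∏ xs h
  ∏-cong []       p = refl
  ∏-cong (x ∷ xs) p = *-cong (p x) (∏-cong xs p)

  ∏-* : ∀ {b} {B : Set b} (g h : B → Carrier) xs → ∏ xs (λ x → g x * h x) ≈ ∏ xs g * ∏ xs h
  ∏-* g h []       = sym (*-identityˡ 1#)
  ∏-* g h (x ∷ xs) = trans (*-congˡ (∏-* g h xs))
    (solve 4 (λ a b c d → a :* b :* (c :* d) := a :* c :* (b :* d)) refl _ _ _ _)

  -- In a quotient of K[X] a vanishing product need not have a vanishing factor, but unit factors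
  -- can be removed. This is how products over all of K are cut down.
  ∏-filter : ∀ {b p} {B : Set b} {P : Pred B p} (P? : Decidable P) (g : B → Carrier) →
             (∀ x → ¬ P x → Unit (g x)) → ∀ xs → ∃ λ u → Unit u ∧ (∏ xs g ≈ u * ∏ (filter P? xs) g)
  ∏-filter P? g unit [] = 1# , (1# , *-identityˡ 1#) , sym (*-identityˡ 1#)
  ∏-filter P? g unit (x ∷ xs) with P? x | ∏-filter P? g unit xs
  ... | yes _ | u , uu , e = u , uu ,
        trans (*-congˡ e) (solve 3 (λ a b c → a :* (b :* c) := b :* (a :* c)) refl _ _ _)
  ... | no ¬p | u , uu , e = g x * u , unit-* (unit x ¬p) uu , trans (*-congˡ e) (sym (*-assoc _ _ _))

  ∏-filter-zero : ∀ {b p} {B : Set b} {P : Pred B p} (P? : Decidable P) (g : B → Carrier) →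
             (∀ x → ¬ P x → Unit (g x)) → ∀ xs → ∏ xs g ≈ 0# → ∏ (filter P? xs) g ≈ 0#
  ∏-filter-zero P? g unit xs e with ∏-filter P? g unit xs
  ... | u , uu , e′ = unit-cancel uu (trans (sym e′) e)

-- Quotient rings

record Ideal {c ℓ} (A : CommutativeRing c ℓ) p : Set (c ⊔ ℓ ⊔ lsuc p) where
  open CommutativeRing A
  field
    member      : Carrier → Set p
    member-resp : ∀ {x y} → x ≈ y → member x → member y
    member-0    : member 0#
    member-+    : ∀ {x y} → member x → member y → member (x + y)
    member-*    : ∀ a {x} → member x → member (a * x)

module _ {c ℓ p} {A : CommutativeRing c ℓ} (I : Ideal A p) where
  open CommutativeRing A
  open Ideal I
  open IntegerCoefficients A
  open RingLemmas A using (x≈y⇒x-y≈0)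

  -- A one-field record, so that its two arguments can be inferred from a proof.
  record Congruent (x y : Carrier) : Set p where
    constructor congruent
    field difference : member (x - y)

  open Congruent

  ≈⇒congruent : ∀ {x y} → x ≈ y → Congruent x y
  ≈⇒congruent e = congruent (member-resp (sym (x≈y⇒x-y≈0 e)) member-0)

  member⇒congruent-0 : ∀ {x} → member x → Congruent x 0#
  member⇒congruent-0 {x} m = congruent (member-resp (solve 1 (λ x → x := x :- 𝟘) refl x) m)

  congruent-0⇒member : ∀ {x} → Congruent x 0# → member x
  congruent-0⇒member {x} e = member-resp (solve 1 (λ x → x :- 𝟘 := x) refl x) (difference e)

  -- Carrier and operations are kept, so the same polynomial can be regarded modulo several ideals
  -- without any transport. The zero ring is allowed.
  quotient : CommutativeRing c p
  quotient = record
    { Carrier = Carrier ; _≈_ = Congruent ; _+_ = _+_ ; _*_ = _*_ ; -_ = -_ ; 0# = 0# ; 1# = 1#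
    ; isCommutativeRing = record
      { isRing = record
        { +-isAbelianGroup = record
          { isGroup = record
            { isMonoid = record
              { isSemigroup = record
                { isMagma = record
                  { isEquivalence = record
                    { refl  = ≈⇒congruent refl
                    ; sym   = λ {x} {y} p → congruent (member-resp
                        (solve 2 (λ x y → :- 𝟙 :* (x :- y) := y :- x) refl x y) (member-* (- 1#) (difference p)))
                    ; trans = λ {x} {y} {z} p q → congruent (member-resp
                        (solve 3 (λ x y z → (x :- y) :+ (y :- z) := x :- z) refl x y z)
                        (member-+ (difference p) (difference q))) }
                  ; ∙-cong = λ {x} {x′} {y} {y′} p q → congruent (member-resp
                      (solve 4 (λ x x′ y y′ → (x :- x′) :+ (y :- y′) := (x :+ y) :- (x′ :+ y′)) refl x x′ y y′)
                      (member-+ (difference p) (difference q))) }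
                ; assoc = λ x y z → ≈⇒congruent (+-assoc x y z) }
              ; identity = (λ x → ≈⇒congruent (+-identityˡ x)) , (λ x → ≈⇒congruent (+-identityʳ x)) }
            ; inverse = (λ x → ≈⇒congruent (-‿inverseˡ x)) , (λ x → ≈⇒congruent (-‿inverseʳ x))
            ; ⁻¹-cong = λ {x} {y} p → congruent (member-resp
                (solve 2 (λ x y → :- 𝟙 :* (x :- y) := :- x :- (:- y)) refl x y) (member-* (- 1#) (difference p))) }
          ; comm = λ x y → ≈⇒congruent (+-comm x y) }
        ; *-cong = λ {x} {x′} {y} {y′} p q → congruent (member-resp
            (solve 4 (λ x x′ y y′ → y :* (x :- x′) :+ x′ :* (y :- y′) := x :* y :- x′ :* y′) refl x x′ y y′)
            (member-+ (member-* y (difference p)) (member-* x′ (difference q))))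
        ; *-assoc = λ x y z → ≈⇒congruent (*-assoc x y z)
        ; *-identity = (λ x → ≈⇒congruent (*-identityˡ x)) , (λ x → ≈⇒congruent (*-identityʳ x))
        ; distrib = (λ x y z → ≈⇒congruent (distribˡ x y z)) , (λ x y z → ≈⇒congruent (distribʳ x y z)) }
      ; *-comm = λ x y → ≈⇒congruent (*-comm x y) } }

module Ideals {c ℓ} (A : CommutativeRing c ℓ) where
  open CommutativeRing A
  open IntegerCoefficients A

  infix 4 _∣_
  _∣_ : Carrier → Carrier → Set (c ⊔ ℓ)
  g ∣ f = ∃ λ h → f ≈ h * g

  principal : Carrier → Ideal A (c ⊔ ℓ)
  principal g = record
    { member = g ∣_
    ; member-resp = λ { e (h , p) → h , trans (sym e) p }
    ; member-0 = 0# , sym (zeroˡ g)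
    ; member-+ = λ { (h , p) (h′ , p′) → h + h′ , trans (+-cong p p′) (sym (distribʳ g h h′)) }
    ; member-* = λ { a (h , p) → a * h , trans (*-congˡ p) (sym (*-assoc a h g)) } }

  span₂ : Carrier → Carrier → Ideal A (c ⊔ ℓ)
  span₂ g d = record
    { member = λ f → ∃₂ λ h k → f ≈ h * g + k * d
    ; member-resp = λ { e (h , k , p) → h , k , trans (sym e) p }
    ; member-0 = 0# , 0# , sym (trans (+-cong (zeroˡ g) (zeroˡ d)) (+-identityˡ 0#))
    ; member-+ = λ { (h , k , p) (h′ , k′ , p′) → h + h′ , k + k′ , trans (+-cong p p′)
        (solve 6 (λ h k h′ k′ g d → (h :* g :+ k :* d) :+ (h′ :* g :+ k′ :* d)
          := (h :+ h′) :* g :+ (k :+ k′) :* d) refl h k h′ k′ g d) }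
    ; member-* = λ { a (h , k , p) → a * h , a * k , trans (*-congˡ p)
        (solve 5 (λ a h k g d → a :* (h :* g :+ k :* d) := a :* h :* g :+ a :* k :* d) refl a h k g d) } }

  -- The ideal quotient (g : d): it describes what is left of the roots of g, with multiplicity,
  -- when those of d are removed.
  colon : Carrier → Carrier → Ideal A (c ⊔ ℓ)
  colon g d = record
    { member = λ f → g ∣ f * d
    ; member-resp = λ e → P.member-resp (*-congʳ e)
    ; member-0 = P.member-resp (sym (zeroˡ d)) P.member-0
    ; member-+ = λ p q → P.member-resp (sym (distribʳ d _ _)) (P.member-+ p q)
    ; member-* = λ a p → P.member-resp (sym (*-assoc a _ d)) (P.member-* a p) }
    where module P = Ideal (principal g)

-- Evaluation and substitution

module Evaluation {c ℓ a ℓ′} (K : CommutativeRing c ℓ) (A : CommutativeRing a ℓ′)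
  (φ : CommutativeRing.Carrier K → CommutativeRing.Carrier A) where
  private module K = CommutativeRing K
  open Polynomials K
  open CommutativeRing A
  open IntegerCoefficients A
  open import Algebra.Properties.Ring ring using (-0#≈0#)
  open import Algebra.Properties.Semiring.Exp semiring using (_^_)
  open import Algebra.Properties.Semiring.Exp (CommutativeRing.semiring K[X]) using () renaming (_^_ to _^ₚ_)
  open Products A
  open Products K[X] using () renaming (∏ to ∏ₚ)

  -- For A = K this gives values at points; for A = K[X] and φ = `C` it substitutes one polynomial
  -- into another.
  ev : Poly → Carrier → Carrier
  ev []      x = 0#
  ev (a ∷ f) x = φ a + x * ev f x

  record Homomorphism : Set (a ⊔ c ⊔ ℓ ⊔ ℓ′) where
    field
      φ-cong : ∀ {x y} → x K.≈ y → φ x ≈ φ y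
      φ-+ : ∀ x y → φ (x K.+ y) ≈ φ x + φ y
      φ-* : ∀ x y → φ (x K.* y) ≈ φ x * φ y
      φ-neg : ∀ x → φ (K.- x) ≈ - φ x
      φ-0 : φ K.0# ≈ 0#
      φ-1 : φ K.1# ≈ 1#

  module _ (hom : Homomorphism) (x : Carrier) where
    open Homomorphism hom
    open import Relation.Binary.Reasoning.Setoid setoid

    ev-zero : ∀ f → f ≋ [] → ev f x ≈ 0#
    ev-zero []      p = refl
    ev-zero (a ∷ f) p = trans (+-cong (trans (φ-cong (at p 0)) φ-0)
      (trans (*-congˡ (ev-zero f (coeffwise λ i → at p (suc i)))) (zeroʳ x))) (+-identityˡ 0#)

    ev-cong : ∀ {f g} → f ≋ g → ev f x ≈ ev g x
    ev-cong {[]}    {g}     p = sym (ev-zero g (coeffwise λ i → K.sym (at p i)))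
    ev-cong {a ∷ f} {[]}    p = ev-zero (a ∷ f) p
    ev-cong {a ∷ f} {b ∷ g} p = +-cong (φ-cong (at p 0)) (*-congˡ (ev-cong {f} {g} (coeffwise λ i → at p (suc i))))

    opaque
      unfolding _⊞_

      ev-+ : ∀ f g → ev (f ⊞ g) x ≈ ev f x + ev g x
      ev-+ []      g       = sym (+-identityˡ _)
      ev-+ (a ∷ f) []      = sym (+-identityʳ _)
      ev-+ (a ∷ f) (b ∷ g) = trans (+-cong (φ-+ a b) (*-congˡ (ev-+ f g)))
        (solve 5 (λ a b x u v → (a :+ b) :+ x :* (u :+ v) := (a :+ x :* u) :+ (b :+ x :* v)) refl _ _ _ _ _)

      ev-neg : ∀ f → ev (neg f) x ≈ - ev f x
      ev-neg []      = sym -0#≈0#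
      ev-neg (a ∷ f) = trans (+-cong (φ-neg a) (*-congˡ (ev-neg f)))
        (solve 3 (λ a x u → :- a :+ x :* (:- u) := :- (a :+ x :* u)) refl _ _ _)

      ev-scale : ∀ b f → ev (map (b K.*_) f) x ≈ φ b * ev f x
      ev-scale b []      = sym (zeroʳ _)
      ev-scale b (a ∷ f) = trans (+-cong (φ-* b a) (*-congˡ (ev-scale b f)))
        (solve 4 (λ b a x u → b :* a :+ x :* (b :* u) := b :* (a :+ x :* u)) refl _ _ _ _)

      ev-* : ∀ f g → ev (f ⊠ g) x ≈ ev f x * ev g x
      ev-* []      g = sym (zeroˡ _)
      ev-* (a ∷ f) g = begin
        ev (map (a K.*_) g ⊞ (K.0# ∷ f ⊠ g)) x            ≈⟨ ev-+ (map (a K.*_) g) _ ⟩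
        ev (map (a K.*_) g) x + (φ K.0# + x * ev (f ⊠ g) x) ≈⟨ +-cong (ev-scale a g) (+-cong φ-0 (*-congˡ (ev-* f g))) ⟩
        φ a * ev g x + (0# + x * (ev f x * ev g x))
          ≈⟨ solve 4 (λ a x u v → a :* v :+ (𝟘 :+ x :* (u :* v)) := (a :+ x :* u) :* v) refl _ _ _ _ ⟩
        (φ a + x * ev f x) * ev g x                        ∎

      ev-C : ∀ a → ev (C a) x ≈ φ a
      ev-C a = trans (+-congˡ (zeroʳ x)) (+-identityʳ _)

      ev-1 : ev (C K.1#) x ≈ 1#
      ev-1 = trans (ev-C K.1#) φ-1

      ev-X : ev X x ≈ x
      ev-X = trans (+-cong φ-0 (*-congˡ ev-1)) (trans (+-identityˡ _) (*-identityʳ x))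

    ev-^ : ∀ f n → ev (f ^ₚ n) x ≈ ev f x ^ n
    ev-^ f zero      = ev-1
    ev-^ f (suc n) = trans (ev-* f (f ^ₚ n)) (*-congˡ (ev-^ f n))

    ev-∏ : ∀ {b} {B : Set b} (g : B → Poly) xs → ev (∏ₚ xs g) x ≈ ∏ xs (λ y → ev (g y) x)
    ev-∏ g []       = ev-1
    ev-∏ g (y ∷ ys) = trans (ev-* (g y) _) (*-congˡ (ev-∏ g ys))

-- Abstracts the properties of the q-power map that pass to quotient rings.
record Frobenius {c ℓ} (A : CommutativeRing c ℓ) : Set (c ⊔ ℓ) where
  open CommutativeRing A
  field
    F          : Carrier → Carrier
    F-cong     : ∀ {x y} → x ≈ y → F x ≈ F y
    F-+        : ∀ x y → F (x + y) ≈ F x + F y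
    F-*        : ∀ x y → F (x * y) ≈ F x * F y
    F-1        : F 1# ≈ 1#
    F-multiple : ∀ x → ∃ λ y → F x ≈ x * y

  open import Algebra.Properties.Group +-group using (inverseʳ-unique)

  F-0 : ∀ {x} → x ≈ 0# → F x ≈ 0#
  F-0 {x} e = trans (proj₂ (F-multiple x)) (trans (*-congʳ e) (zeroˡ _))

  F-neg : ∀ x → F (- x) ≈ - F x
  F-neg x = inverseʳ-unique (F x) (F (- x)) (trans (sym (F-+ x (- x))) (F-0 (-‿inverseʳ x)))

-- A general endomorphism need not preserve an ideal. Here x - y divides F (x - y), so every ideal
-- is stable and congruences are respected.
quotient-frobenius : ∀ {c ℓ p} {A : CommutativeRing c ℓ} (I : Ideal A p) → Frobenius A → Frobenius (quotient I)
quotient-frobenius {A = A} I frob = record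
  { F = F
  ; F-cong = λ {x} {y} e → congruent (member-resp
      (sym (trans (trans (+-congˡ (sym (F-neg y))) (sym (F-+ x (- y)))) (trans (proj₂ (F-multiple (x - y))) (*-comm _ _))))
      (member-* _ (Congruent.difference e)))
  ; F-+ = λ x y → ≈⇒congruent I (F-+ x y)
  ; F-* = λ x y → ≈⇒congruent I (F-* x y)
  ; F-1 = ≈⇒congruent I F-1
  ; F-multiple = λ x → proj₁ (F-multiple x) , ≈⇒congruent I (proj₂ (F-multiple x)) }
  where
  open CommutativeRing A
  open Ideal I
  open Frobenius frob

-- Roots and linear factors

module Roots {c ℓ} (K : CommutativeRing c ℓ) where
  open CommutativeRing K
  open Polynomials K
  open IntegerCoefficients K[X] using (solve; _:+_; _:*_; _:-_; _:=_)
  private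
    module R = CommutativeRing K[X]
    module E = Evaluation K K id
  open Products K[X] using (∏)
  open RingLemmas K using (x-y≈0⇒x≈y)
  open import Algebra.Properties.Semiring.Exp R.semiring using (_^_)

  identity : E.Homomorphism
  identity = record
    { φ-cong = id ; φ-+ = λ _ _ → refl ; φ-* = λ _ _ → refl ; φ-neg = λ _ → refl ; φ-0 = refl ; φ-1 = refl }

  constants : Evaluation.Homomorphism K K[X] C
  constants = record
    { φ-cong = C-cong ; φ-+ = C-+ ; φ-* = C-* ; φ-neg = C-neg ; φ-0 = C-0 ; φ-1 = R.refl }

  eval : Poly → Carrier → Carrier
  eval = E.ev

  eval-X-C : ∀ a b → eval (X R.- C a) b ≈ b - a
  eval-X-C a b = trans (E.ev-+ identity b X (R.- C a))
    (+-cong (E.ev-X identity b) (trans (E.ev-neg identity b (C a)) (-‿cong (E.ev-C identity b a))))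

  factor : ∀ f a → ∃ λ h → f ≋ C (eval f a) ⊞ (X R.- C a) ⊠ h
  factor []      a = [] , R.sym (R.trans (R.+-cong C-0 (R.zeroʳ (X R.- C a))) (R.+-identityˡ []))
  factor (b ∷ f) a with factor f a
  ... | h , e = C (eval f a) ⊞ X ⊠ h , (begin
    b ∷ f                                                           ≈⟨ cons b f ⟩
    C b ⊞ X ⊠ f                                                     ≈⟨ R.+-congˡ {C b} (R.*-congˡ {X} e) ⟩
    C b ⊞ X ⊠ (C (eval f a) ⊞ (X R.- C a) ⊠ h)                      ≈⟨ solve 5 (λ b x v a h →
        b :+ x :* (v :+ (x :- a) :* h) := (b :+ a :* v) :+ (x :- a) :* (v :+ x :* h)) R.refl (C b) X (C (eval f a)) (C a) h ⟩
    (C b ⊞ C a ⊠ C (eval f a)) ⊞ (X R.- C a) ⊠ (C (eval f a) ⊞ X ⊠ h)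
      ≈⟨ R.+-congʳ {(X R.- C a) ⊠ (C (eval f a) ⊞ X ⊠ h)} (R.trans (R.+-congˡ (R.sym (C-* a (eval f a)))) (R.sym (C-+ b (a * eval f a)))) ⟩
    C (eval (b ∷ f) a) ⊞ (X R.- C a) ⊠ (C (eval f a) ⊞ X ⊠ h)       ∎)
    where open import Relation.Binary.Reasoning.Setoid R.setoid

  linear-factors : List Carrier → Poly
  linear-factors as = ∏ as (λ a → X R.- C a)

  Lead-≈ : ∀ {d a b f} → a ≈ b → Lead d a f → Lead d b f
  Lead-≈ e (lead p z) = lead (trans p e) z

  Lead-∏ : ∀ {b} {B : Set b} {d} {lc : B → Carrier} {g : B → Poly} → (∀ x → Lead d (lc x) (g x)) →
           ∀ xs → Lead (length xs ℕ.* d) (Products.∏ K xs lc) (∏ xs g)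
  Lead-∏ p []       = Lead-C 1#
  Lead-∏ p (x ∷ xs) = Lead-* (p x) (Lead-∏ p xs)

  Lead-X-C : ∀ a → Lead 1 1# (X R.- C a)
  Lead-X-C a = Lead-+ˡ (s≤s z≤n) Lead-X (Lead-neg (Lead-C a))

  ∏-1 : ∀ {b} {B : Set b} (xs : List B) → Products.∏ K xs (λ _ → 1#) ≈ 1#
  ∏-1 []       = refl
  ∏-1 (x ∷ xs) = trans (*-identityˡ _) (∏-1 xs)

  Lead-linear-factors : ∀ as → Lead (length as) 1# (linear-factors as)
  Lead-linear-factors as = ≡.subst (λ d → Lead d 1# (linear-factors as)) (ℕₚ.*-identityʳ (length as))
    (Lead-≈ (∏-1 as) (Lead-∏ Lead-X-C as))

  Lead-X^ : ∀ n → Lead n 1# (X ^ n)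
  Lead-X^ zero    = Lead-C 1#
  Lead-X^ (suc n) = Lead-≈ (*-identityˡ 1#) (Lead-* Lead-X (Lead-X^ n))

  module _ (noZeroDivisors : NoZeroDivisors K) where
    open Degree noZeroDivisors

    factors : ∀ as f → AllPairs (λ a b → ¬ (a ≈ b)) as → All (λ a → eval f a ≈ 0#) as →
              ∃ λ h → f ≋ h ⊠ linear-factors as
    factors []       f _ _ = f , R.sym (R.*-identityʳ f)
    factors (a ∷ as) f (a≉as ∷ distinct) (fa≈0 ∷ fas≈0) with factor f a
    ... | g , e with factors as g distinct (All.zipWith root (a≉as , fas≈0))
      where
      root : ∀ {b} → ¬ (a ≈ b) ∧ (eval f b ≈ 0#) → eval g b ≈ 0#
      root {b} (a≉b , fb≈0) = noZeroDivisors (λ b-a≈0 → a≉b (sym (x-y≈0⇒x≈y b-a≈0))) (begin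
        (b - a) * eval g b                                     ≈⟨ sym (+-identityˡ _) ⟩
        0# + (b - a) * eval g b                                ≈⟨ +-cong (sym fa≈0) (*-congʳ (sym (eval-X-C a b))) ⟩
        eval f a + eval (X R.- C a) b * eval g b               ≈⟨ sym (+-cong (E.ev-C identity b (eval f a)) (E.ev-* identity b (X R.- C a) g)) ⟩
        eval (C (eval f a)) b + eval ((X R.- C a) ⊠ g) b       ≈⟨ sym (E.ev-+ identity b (C (eval f a)) ((X R.- C a) ⊠ g)) ⟩
        eval (C (eval f a) ⊞ (X R.- C a) ⊠ g) b                ≈⟨ sym (E.ev-cong identity b e) ⟩
        eval f b                                               ≈⟨ fb≈0 ⟩
        0#                                                     ∎)
        where open import Relation.Binary.Reasoning.Setoid setoid
    ... | h , e′ = h , (begin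
      f                                            ≈⟨ e ⟩
      C (eval f a) ⊞ (X R.- C a) ⊠ g               ≈⟨ R.trans (R.+-cong (R.trans (C-cong fa≈0) C-0) (R.*-congˡ {X R.- C a} e′)) (R.+-identityˡ _) ⟩
      (X R.- C a) ⊠ (h ⊠ linear-factors as)        ≈⟨ solve 3 (λ x h w → x :* (h :* w) := h :* (x :* w)) R.refl (X R.- C a) h (linear-factors as) ⟩
      h ⊠ ((X R.- C a) ⊠ linear-factors as)        ∎)
      where open import Relation.Binary.Reasoning.Setoid R.setoid

    too-many-roots : ∀ as f → AllPairs (λ a b → ¬ (a ≈ b)) as → All (λ a → eval f a ≈ 0#) as →
                     ¬ (1# ≈ 0#) → (∀ i → length as ℕ.≤ i → coeff f i ≈ 0#) → f ≋ []
    too-many-roots as f distinct roots 1≉0 low with factors as f distinct roots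
    ... | h , e = multiple-of-low-degree-zero {h = h} 1≉0 (Lead-linear-factors as) e low

module _ {c ℓ} (A : CommutativeRing c ℓ) where
  open CommutativeRing A hiding (zero)
  open import Algebra.Properties.Semiring.Exp semiring
  open import Algebra.Properties.CommutativeSemiring.Exp commutativeSemiring using (^-distrib-*)

  power-frobenius : ∀ {q} → 0 ℕ.< q → (∀ x y → (x + y) ^ q ≈ x ^ q + y ^ q) → Frobenius A
  power-frobenius {q} 0<q additive = record
    { F = _^ q
    ; F-cong = ^-congˡ q
    ; F-+ = additive
    ; F-* = λ x y → ^-distrib-* x y q
    ; F-1 = 1^ q
    ; F-multiple = λ x → multiple 0<q x }
    where
    1^ : ∀ m → 1# ^ m ≈ 1#
    1^ zero    = refl
    1^ (suc m) = trans (*-identityˡ _) (1^ m)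
    multiple : ∀ {m} → 0 ℕ.< m → ∀ x → ∃ λ y → x ^ m ≈ x * y
    multiple {suc m} _ x = x ^ m , refl

-- Common roots in a finite field

module Existence {c ℓ} {K : CommutativeRing c ℓ} {n} (finite : IsFiniteField K n)
                 (q : ℕ) (n≡q^5 : n ≡ q ℕ.^ 5) (1<q : 1 ℕ.< q) where
  open CommutativeRing K
  open IsFiniteField finite
  open FiniteField finite
  open Polynomials K
  open Roots K
  open import Algebra.Properties.Semiring.Exp semiring using (_^_; ^-congˡ)
  private
    module R = CommutativeRing K[X]
    module E = Evaluation K K id
    module EX = Evaluation K K[X] C
    module ∏K = Products K
  open import Algebra.Properties.Semiring.Exp R.semiring using () renaming (_^_ to _^ₚ_; ^-assocʳ to ^ₚ-assocʳ; ^-congˡ to ^ₚ-congˡ)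
  open Products K[X] using (∏; ∏-cong)
  open Degree noZeroDivisors
  open RingLemmas K using (x≈y⇒x-y≈0; x-y≈0⇒x≈y)

  1≉0 : ¬ (1# ≈ 0#)
  1≉0 e = 0≉1 (sym e)

  1<n : 1 ℕ.< n
  1<n = ≡.subst (1 ℕ.<_) (≡.sym n≡q^5) (ℕₚ.<-≤-trans 1<q (ℕₚ.m≤m*n q (q ℕ.^ 4) {{ℕₚ.m^n≢0 q 4 {{ℕ.>-nonZero (ℕₚ.<-trans (s≤s z≤n) 1<q)}}}}))

  elements : List Carrier
  elements = tabulate enum

  elements-distinct : AllPairs (λ a b → ¬ (a ≈ b)) elements
  elements-distinct = AllPairsₚ.tabulate⁺ (λ i≢j e → i≢j (enum-inj _ _ e))

  Lead-X^-X : ∀ {m} → 1 ℕ.< m → Lead m 1# (X ^ₚ m R.- X)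
  Lead-X^-X {m} 1<m = Lead-+ˡ 1<m (Lead-X^ m) (Lead-neg Lead-X)

  eval-X^-X : ∀ m a → eval (X ^ₚ m R.- X) a ≈ a ^ m - a
  eval-X^-X m a = trans (E.ev-+ identity a (X ^ₚ m) (R.- X)) (+-cong (trans (E.ev-^ identity a X m) (^-congˡ m (E.ev-X identity a)))
    (trans (E.ev-neg identity a X) (-‿cong (E.ev-X identity a))))

  -- Both sides are monic of degree n, so their difference has degree below n, and by `fermat` it
  -- vanishes at all n elements of K.
  X^n-X-splits : X ^ₚ n R.- X ≋ linear-factors elements
  X^n-X-splits = RingLemmas.x-y≈0⇒x≈y K[X] (too-many-roots noZeroDivisors elements f elements-distinct
      (Allₚ.tabulate⁺ roots) 1≉0 low)
    where
    f = (X ^ₚ n R.- X) R.- linear-factors elements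
    W-lead : Lead n 1# (linear-factors elements)
    W-lead = ≡.subst (λ m → Lead m 1# (linear-factors elements)) (length-tabulate enum) (Lead-linear-factors elements)
    f-lead : Lead n (1# - 1#) f
    f-lead = Lead-+ (Lead-X^-X 1<n) (Lead-neg W-lead)
    low : ∀ i → length elements ℕ.≤ i → coeff f i ≈ 0#
    low i l with ℕₚ.m≤n⇒m<n∨m≡n (≡.subst (ℕ._≤ i) (length-tabulate enum) l)
    ... | inj₁ n<i = Lead.above f-lead i n<i
    ... | inj₂ ≡.refl = trans (Lead.leading f-lead) (-‿inverseʳ 1#)
    vanish : ∀ {a} as → Any.Any (λ b → a ≈ b) as → eval (linear-factors as) a ≈ 0#
    vanish {a} (b ∷ as) (Any.here e) = trans (E.ev-* identity a (X R.- C b) (linear-factors as))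
      (trans (*-congʳ (trans (eval-X-C b a) (x≈y⇒x-y≈0 e))) (zeroˡ _))
    vanish {a} (b ∷ as) (Any.there p) = trans (E.ev-* identity a (X R.- C b) (linear-factors as))
      (trans (*-congˡ (vanish as p)) (zeroʳ _))
    roots : ∀ i → eval f (enum i) ≈ 0#
    roots i = trans (E.ev-+ identity a (X ^ₚ n R.- X) (R.- linear-factors elements)) (trans
      (+-cong (trans (eval-X^-X n a) (x≈y⇒x-y≈0 (fermat {{ℕ.>-nonZero (ℕₚ.<-trans (s≤s z≤n) 1<n)}} a)))
              (trans (E.ev-neg identity a (linear-factors elements)) (-‿cong (vanish elements (Anyₚ.tabulate⁺ {f = enum} i refl)))))
      (-‿inverseʳ 0#))
      where a = enum i

  F : Poly → Poly
  F f = f ^ₚ q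

  F⁵ : Poly → Poly
  F⁵ f = F (F (F (F (F f))))

  ^n≋F⁵ : ∀ f → f ^ₚ n ≋ F⁵ f
  ^n≋F⁵ f = begin
    f ^ₚ n                                ≡⟨ ≡.cong (f ^ₚ_) (≡.trans n≡q^5 (≡.cong (λ z → q ℕ.* (q ℕ.* (q ℕ.* (q ℕ.* z)))) (ℕₚ.*-identityʳ q))) ⟩
    f ^ₚ (q ℕ.* (q ℕ.* (q ℕ.* (q ℕ.* q)))) ≈⟨ R.sym (^ₚ-assocʳ f q _) ⟩
    F f ^ₚ (q ℕ.* (q ℕ.* (q ℕ.* q)))      ≈⟨ R.sym (^ₚ-assocʳ (F f) q _) ⟩
    F (F f) ^ₚ (q ℕ.* (q ℕ.* q))          ≈⟨ R.sym (^ₚ-assocʳ (F (F f)) q _) ⟩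
    F (F (F f)) ^ₚ (q ℕ.* q)              ≈⟨ R.sym (^ₚ-assocʳ (F (F (F f))) q q) ⟩
    F⁵ f                                  ∎
    where open import Relation.Binary.Reasoning.Setoid R.setoid

  -- Substitution of f into the splitting of X^n - X. This makes K usable inside quotients of K[X]:
  -- a class that F fixes is annihilated by the product, although it need not be an element of K.
  ∏-elements : ∀ f → ∏ elements (λ a → f R.- C a) ≋ F⁵ f R.- f
  ∏-elements f = begin
    ∏ elements (λ a → f R.- C a)              ≈⟨ ∏-cong elements (λ a → R.sym (linear a)) ⟩
    ∏ elements (λ a → EX.ev (X R.- C a) f)    ≈⟨ R.sym (EX.ev-∏ constants f (λ a → X R.- C a) elements) ⟩
    EX.ev (linear-factors elements) f         ≈⟨ R.sym (EX.ev-cong constants f X^n-X-splits) ⟩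
    EX.ev (X ^ₚ n R.- X) f                    ≈⟨ EX.ev-+ constants f (X ^ₚ n) (R.- X) ⟩
    EX.ev (X ^ₚ n) f ⊞ EX.ev (R.- X) f
      ≈⟨ R.+-cong (R.trans (EX.ev-^ constants f X n) (^ₚ-congˡ n (EX.ev-X constants f)))
                  (R.trans (EX.ev-neg constants f X) (R.-‿cong (EX.ev-X constants f))) ⟩
    f ^ₚ n R.- f                              ≈⟨ R.+-congʳ {R.- f} (^n≋F⁵ f) ⟩
    F⁵ f R.- f                                ∎
    where
    open import Relation.Binary.Reasoning.Setoid R.setoid
    linear : ∀ a → EX.ev (X R.- C a) f ≋ f R.- C a
    linear a = R.trans (EX.ev-+ constants f X (R.- C a)) (R.+-cong (EX.ev-X constants f)
      (R.trans (EX.ev-neg constants f (C a)) (R.-‿cong (EX.ev-C constants f a))))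

  C-unit : ∀ {a} → ¬ (a ≈ 0#) → Products.Unit K[X] (C a)
  C-unit {a} a≉0 with inverse a a≉0
  ... | b , e = C b , R.trans (R.sym (C-* a b)) (C-cong e)

  C-^ : ∀ a m → C a ^ₚ m ≋ C (a ^ m)
  C-^ a zero    = R.refl
  C-^ a (suc m) = R.trans (R.*-congˡ {C a} (C-^ a m)) (R.sym (C-* a (a ^ m)))

  module _ (F-additive : ∀ f g → F (f ⊞ g) ≋ F f ⊞ F g) where
    frobenius : Frobenius K[X]
    frobenius = power-frobenius K[X] (ℕₚ.<-trans (s≤s z≤n) 1<q) F-additive

    -- G stands for the equation between X and X^q, D for the recurrence, M a for the quadratic that
    -- X satisfies when θ = a, and ν for the root to be avoided. κ is the element of F_q that θ
    -- cannot equal; there alone M a may lose its leading term.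
    module _
      (G D : Poly) (M : Carrier → Poly) (κ ν : Carrier)
      {e} {g₀} (g₀≉0 : ¬ (g₀ ≈ 0#)) (G-lead : Lead e g₀ G) (2q≤e : q ℕ.+ q ℕ.≤ e)
      (κ^q≈κ : κ ^ q ≈ κ)
      {lc : Carrier → Carrier} (M-lead : ∀ a → Lead 2 (lc a) (M a)) (lc≉0 : ∀ a → ¬ (a ≈ κ) → ¬ (lc a ≈ 0#))
      where
      fixed? : ∀ a → Dec ((a ^ q ≈ a) ∧ ¬ (a ≈ κ))
      fixed? a = (a ^ q ≟ a) ×-dec ¬? (a ≟ κ)

      fixed : List Carrier
      fixed = filter fixed? elements

      -- κ is itself a root of X^q - X, which leaves room for at most q - 1 others. The final
      -- comparison of degrees depends on this strict inequality.
      length-fixed : length fixed ℕ.< q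
      length-fixed = ℕₚ.≰⇒> λ q≤l → 1≉0 (trans (sym (Lead.leading (Lead-X^-X 1<q)))
        (at (too-many-roots noZeroDivisors (κ ∷ fixed) (X ^ₚ q R.- X) (κ≉fixed ∷ AllPairsₚ.filter⁺ fixed? elements-distinct)
               (root κ^q≈κ ∷ All.map (root ∘ proj₁) fixed-fixed) 1≉0
               (λ i l≤i → Lead.above (Lead-X^-X 1<q) i (ℕₚ.≤-trans (s≤s q≤l) l≤i))) q))
        where
        fixed-fixed : All (λ a → (a ^ q ≈ a) ∧ ¬ (a ≈ κ)) fixed
        fixed-fixed = Allₚ.all-filter fixed? elements
        κ≉fixed : All (λ a → ¬ (κ ≈ a)) fixed
        κ≉fixed = All.map (λ p e → proj₂ p (sym e)) fixed-fixed
        root : ∀ {a} → a ^ q ≈ a → eval (X ^ₚ q R.- X) a ≈ 0#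
        root {a} p = trans (eval-X^-X q a) (x≈y⇒x-y≈0 p)

      module _
        (split  : Ideals._∣_ K[X] G ((F (F X) R.- X) ⊠ D))
        (type₂  : ∀ (I : Ideal K[X] (c ⊔ ℓ)) → Ideal.member I G → Ideal.member I (F (F X) R.- X) →
                  ∃ λ θ → Congruent I (F θ) θ ∧ Products.Unit (quotient I) (θ R.- C κ)
                          ∧ (∀ a → ∃ λ g → Congruent I (M a) ((θ R.- C a) ⊠ g)))
        (period : ∀ (I : Ideal K[X] (c ⊔ ℓ)) → Ideal.member I G → Ideal.member I D → Congruent I (F⁵ X) X) where

        open Ideals K[X]

        -- Modulo (G : D), `split` makes X a fixed point of F ∘ F, so θ is fixed by F and the
        -- product of θ - a over all a in K vanishes. The factors outside `fixed` are units, and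
        -- each remaining one divides M a.
        annihilator : G ∣ ∏ fixed M ⊠ D
        annihilator = congruent-0⇒member I (Q.trans (Products.∏-cong (quotient I) fixed (λ a → proj₂ (M-factor a)))
          (Q.trans (Products.∏-* (quotient I) (λ a → θ R.- C a) (λ a → proj₁ (M-factor a)) fixed)
          (Q.trans (Q.*-congʳ (Products.∏-filter-zero (quotient I) fixed? (λ a → θ R.- C a) unit elements vanishing))
            (Q.zeroˡ (∏ fixed (λ a → proj₁ (M-factor a)))))))
          where
          I = colon G D
          module Q = CommutativeRing (quotient I)
          module FQ = Frobenius (quotient-frobenius I frobenius)
          t₂ = type₂ I (Ideal.member-resp (principal G) (R.*-comm D G) (D , R.refl)) split
          θ = proj₁ t₂
          Fθ≈θ : Congruent I (F θ) θ
          Fθ≈θ = proj₁ (proj₂ t₂)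
          M-factor = proj₂ (proj₂ (proj₂ t₂))

          vanishing : Congruent I (∏ elements (λ a → θ R.- C a)) []
          vanishing = Q.trans (≈⇒congruent I (∏-elements θ)) (RingLemmas.x≈y⇒x-y≈0 (quotient I) F⁵θ≈θ)
            where
            F-step : ∀ {f} → Congruent I f θ → Congruent I (F f) θ
            F-step e = Q.trans (FQ.F-cong e) Fθ≈θ
            F⁵θ≈θ : Congruent I (F⁵ θ) θ
            F⁵θ≈θ = F-step (F-step (F-step (F-step Fθ≈θ)))

          unit : ∀ a → ¬ ((a ^ q ≈ a) ∧ ¬ (a ≈ κ)) → Products.Unit (quotient I) (θ R.- C a)
          unit a ¬fixed with a ≟ κ
          ... | yes e = Products.unit-resp (quotient I) (≈⇒congruent I (R.+-congˡ {θ} (R.-‿cong (C-cong (sym e))))) (proj₁ (proj₂ (proj₂ t₂)))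
          ... | no a≉κ = Products.unit-factor (quotient I) {θ R.- C a} {w R.- R.1#}
            (Products.unit-resp (quotient I) (Q.sym difference) (proj₁ c-unit , ≈⇒congruent I (proj₂ c-unit)))
            where
            open Frobenius frobenius using (F-multiple; F-neg)
            -- Here (θ - a)(w - 1) = F (θ - a) - (θ - a) = a - a^q. For a outside F_q this is a
            -- non-zero constant, so θ - a is a unit.
            w = proj₁ (F-multiple (θ R.- C a))
            c-unit : Products.Unit K[X] (C (a - a ^ q))
            c-unit = C-unit (λ z → ¬fixed (sym (x-y≈0⇒x≈y z) , a≉κ))
            difference : Congruent I ((θ R.- C a) ⊠ (w R.- R.1#)) (C (a - a ^ q))
            difference = begin
              (θ R.- C a) ⊠ (w R.- R.1#)
                ≈⟨ ≈⇒congruent I (solve 2 (λ x w → x :* (w :- 𝟙) := x :* w :- x) R.refl (θ R.- C a) w) ⟩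
              (θ R.- C a) ⊠ w R.- (θ R.- C a)
                ≈⟨ ≈⇒congruent I (R.+-congʳ {R.- (θ R.- C a)} (R.sym (proj₂ (F-multiple (θ R.- C a))))) ⟩
              F (θ R.- C a) R.- (θ R.- C a)
                ≈⟨ ≈⇒congruent I (R.+-congʳ {R.- (θ R.- C a)} (R.trans (F-additive θ (R.- C a))
                     (R.+-congˡ {F θ} (R.trans (F-neg (C a)) (R.-‿cong (C-^ a q)))))) ⟩
              (F θ R.- C (a ^ q)) R.- (θ R.- C a)
                ≈⟨ Q.+-congʳ {R.- (θ R.- C a)} (Q.+-congʳ {R.- C (a ^ q)} Fθ≈θ) ⟩
              (θ R.- C (a ^ q)) R.- (θ R.- C a)
                ≈⟨ ≈⇒congruent I (solve 3 (λ t b a → (t :- b) :- (t :- a) := a :- b) R.refl θ (C (a ^ q)) (C a)) ⟩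
              C a R.- C (a ^ q)
                ≈⟨ ≈⇒congruent I (R.trans (R.+-congˡ {C a} (R.sym (C-neg (a ^ q)))) (R.sym (C-+ a (- (a ^ q))))) ⟩
              C (a - a ^ q) ∎
              where
              open import Relation.Binary.Reasoning.Setoid Q.setoid
              open IntegerCoefficients K[X]

        -- Modulo (G, D) the product of X - a over all a in K vanishes by `period`, and X - a is a
        -- unit unless a is a common root. As the elements are distinct, no higher power of X - ν is
        -- left.
        X-ν∈span : (∀ a → ¬ (a ≈ ν) → ¬ ((eval G a ≈ 0#) ∧ (eval D a ≈ 0#))) → Ideal.member (span₂ G D) (X R.- C ν)
        X-ν∈span none = congruent-0⇒member I (collapse (filter (_≟ ν) elements) (Allₚ.all-filter (_≟ ν) elements)
          (AllPairsₚ.filter⁺ (_≟ ν) elements-distinct)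
          (Products.∏-filter-zero (quotient I) (_≟ ν) (λ a → X R.- C a) unit elements
            (Q.trans (≈⇒congruent I (∏-elements X)) (RingLemmas.x≈y⇒x-y≈0 (quotient I) (period I G∈I D∈I)))))
          where
          I = span₂ G D
          module Q = CommutativeRing (quotient I)
          G∈I : Ideal.member I G
          G∈I = R.1# , [] , R.sym (R.trans (R.+-cong (R.*-identityˡ G) (R.zeroˡ D)) (R.+-identityʳ G))
          D∈I : Ideal.member I D
          D∈I = [] , R.1# , R.sym (R.trans (R.+-cong (R.zeroˡ G) (R.*-identityˡ D)) (R.+-identityˡ D))

          collapse : ∀ as → All (_≈ ν) as → AllPairs (λ a b → ¬ (a ≈ b)) as →
                     Congruent I (∏ as (λ a → X R.- C a)) [] → Congruent I (X R.- C ν) []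
          -- The empty product is 1, so the quotient is the zero ring in this case.
          collapse [] _ _ e = Q.trans (Q.sym (Q.*-identityˡ (X R.- C ν))) (Q.trans (Q.*-congʳ {X R.- C ν} e) (Q.zeroˡ (X R.- C ν)))
          collapse (a ∷ []) (a≈ν ∷ []) _ e = Q.trans (≈⇒congruent I (R.trans (R.+-congˡ {X} (R.-‿cong (C-cong (sym a≈ν))))
            (R.sym (R.*-identityʳ (X R.- C a))))) e
          collapse (a ∷ b ∷ as) (a≈ν ∷ b≈ν ∷ _) ((a≉b ∷ _) ∷ _) e = ⊥-elim (a≉b (trans a≈ν (sym b≈ν)))

          -- From f = f(a) + (X - a) h, the non-zero constant f(a) is congruent to a multiple of X -
          -- a.
          nonroot : ∀ {f} → Ideal.member I f → ∀ a → ¬ (eval f a ≈ 0#) → Products.Unit (quotient I) (X R.- C a)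
          nonroot {f} f∈I a fa≉0 with factor f a | C-unit fa≉0
          ... | h , e | u , cu≈1 = Products.unit-factor (quotient I) {X R.- C a} {R.- h}
            (Products.unit-resp (quotient I) {C (eval f a)} c≈ (u , ≈⇒congruent I cu≈1))
            where
            open IntegerCoefficients K[X]
            c≈ : Congruent I (C (eval f a)) ((X R.- C a) ⊠ (R.- h))
            c≈ = Q.trans (≈⇒congruent I (R.trans
                (solve 3 (λ c x h → c := (c :+ x :* h) :+ x :* (:- h)) R.refl (C (eval f a)) (X R.- C a) h)
                (R.+-congʳ {(X R.- C a) ⊠ (R.- h)} (R.sym e))))
              (Q.trans (Q.+-congʳ {(X R.- C a) ⊠ (R.- h)} (member⇒congruent-0 I f∈I)) (Q.+-identityˡ ((X R.- C a) ⊠ (R.- h))))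

          unit : ∀ a → ¬ (a ≈ ν) → Products.Unit (quotient I) (X R.- C a)
          unit a a≉ν with eval G a ≟ 0# | eval D a ≟ 0#
          ... | yes p | yes q = ⊥-elim (none a a≉ν (p , q))
          ... | no ¬p | _     = nonroot {G} G∈I a ¬p
          ... | _     | no ¬q = nonroot {D} D∈I a ¬q

        -- If no common root other than ν exists, then X - ν lies in (G, D), so G divides (X - ν) ∏ M, of smaller degree.
        common-root : ∃ λ a → ¬ (a ≈ ν) ∧ (eval G a ≈ 0#) ∧ (eval D a ≈ 0#)
        common-root with Finₚ.any? (λ i → ¬? (enum i ≟ ν) ×-dec ((eval G (enum i) ≟ 0#) ×-dec (eval D (enum i) ≟ 0#)))
        ... | yes (i , p) = enum i , p
        ... | no none = ⊥-elim (contradiction (X-ν∈span λ a a≉ν p → none (index a ,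
                (λ e → a≉ν (trans (sym (enum-index a)) e)) ,
                trans (eval-congʳ G (enum-index a)) (proj₁ p) , trans (eval-congʳ D (enum-index a)) (proj₂ p))) annihilator)
          where
          open IntegerCoefficients K[X]
          eval-congʳ : ∀ f {a b} → a ≈ b → eval f a ≈ eval f b
          eval-congʳ []      e = refl
          eval-congʳ (b ∷ f) e = +-congˡ (*-cong e (eval-congʳ f e))

          ∏lc≉0 : ∀ {as} → All (λ a → ¬ (lc a ≈ 0#)) as → ¬ (∏K.∏ as lc ≈ 0#)
          ∏lc≉0 []       e = 1≉0 e
          ∏lc≉0 (p ∷ ps) e = ∏lc≉0 ps (noZeroDivisors p e)

          contradiction : Ideal.member (span₂ G D) (X R.- C ν) → G ∣ ∏ fixed M ⊠ D → ⊥
          contradiction (h , k , p) (h′ , p′) = ∏lc≉0 (All.map (λ {a} p → lc≉0 a (proj₂ p)) (Allₚ.all-filter fixed? elements))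
            (trans (sym (*-identityˡ _)) (trans (sym (Lead.leading product-lead)) (at product≋0 _)))
            where
            Π = ∏ fixed M
            product-lead : Lead (1 ℕ.+ length fixed ℕ.* 2) (1# * ∏K.∏ fixed lc) ((X R.- C ν) ⊠ Π)
            product-lead = Lead-* (Lead-X-C ν) (Lead-∏ M-lead fixed)
            -- The degree is at most 1 + 2 (q - 1), which is less than 2q.
            degree-bound : 1 ℕ.+ length fixed ℕ.* 2 ℕ.< e
            degree-bound = ℕₚ.≤-trans (≡.subst (2 ℕ.+ length fixed ℕ.* 2 ℕ.≤_) (≡.trans (ℕₚ.*-comm q 2) (≡.cong (q ℕ.+_) (ℕₚ.+-identityʳ q)))
              (ℕₚ.*-monoˡ-≤ 2 length-fixed)) 2q≤e
            multiple : (X R.- C ν) ⊠ Π ≋ (h ⊠ Π ⊞ k ⊠ h′) ⊠ G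
            multiple = R.trans (R.*-congʳ {Π} p) (R.trans
              (solve 5 (λ h g k d π → (h :* g :+ k :* d) :* π := h :* π :* g :+ k :* (π :* d)) R.refl h G k D Π)
              (R.trans (R.+-congˡ {h ⊠ Π ⊠ G} (R.*-congˡ {k} p′))
                (solve 5 (λ h g k d π → h :* π :* g :+ k :* (d :* g) := (h :* π :+ k :* d) :* g) R.refl h G k h′ Π)))
            product≋0 : (X R.- C ν) ⊠ Π ≋ []
            product≋0 = multiple-of-low-degree-zero {h = h ⊠ Π ⊞ k ⊠ h′} g₀≉0 G-lead multiple
              (λ i e≤i → Lead.above product-lead i (ℕₚ.<-≤-trans degree-bound e≤i))

-- The two correspondences

module Correspondences {c ℓ} (A : CommutativeRing c ℓ) where
  open CommutativeRing A
  open IntegerCoefficients A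
  open RingLemmas A
  open Products A
  open Lyness A

  -- In a Lyness cycle with product k one has S₁ k u₀ u₁ = 0 and S₂ k u₀ u₂ = 0. D₁ and D₂ express the recurrence,
  -- with D₂ for the sequence u₀, u₂, u₄, u₁, u₃. M₁ k a z is S₁ k z (a - z), and M₂ k a z is z S₂ k z (a / z).
  S₁ S₂ D₁ M₁ M₂ : Carrier → Carrier → Carrier → Carrier
  S₁ k a b = (1# + a) * (1# + b) * (1# + a + b) - k * a * b
  S₂ k a b = a * b * (1# + a) * (1# + b) - k * (a * b - 1#)
  D₁ a b c = a * c - (1# + b)
  M₁ k a z = (1# + a + z * (a - z)) * (1# + a) - k * z * (a - z)
  M₂ k a z = a * z * z + (a * a + a - k * a + k) * z + a * a

  D₂ : Carrier → Carrier → Carrier → Carrier → Carrier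
  D₂ k a b c = a * b * (1# + b) * c - k

  by-unit : ∀ {a x y z} → Unit a → a * (x - y) ≈ z → z ≈ 0# → x ≈ y
  by-unit u e f = x-y≈0⇒x≈y (unit-cancel u (trans e f))

  module _ (frob : Frobenius A) where
    open Frobenius frob

    F-unit : ∀ {x} → Unit x → Unit (F x)
    F-unit (y , e) = F y , trans (sym (F-* _ y)) (trans (F-cong e) F-1)

    F-1+ : ∀ x → F (1# + x) ≈ 1# + F x
    F-1+ x = trans (F-+ 1# x) (+-congʳ F-1)

    module _ {k z : Carrier} (Fk≈k : F k ≈ k) (k-unit : Unit k) where
      private
        z₁ = F z
        z₂ = F z₁
        z₃ = F z₂
        z₄ = F z₃
        z₅ = F z₄

        F-S₁ : ∀ a b → F (S₁ k a b) ≈ S₁ k (F a) (F b)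
        F-S₁ a b = trans (F-+ _ _) (+-cong
          (trans (F-* _ _) (*-cong (trans (F-* _ _) (*-cong (F-1+ a) (F-1+ b))) (trans (F-+ _ _) (+-congʳ (F-1+ a)))))
          (trans (F-neg _) (-‿cong (trans (F-* _ _) (*-congʳ (trans (F-* _ _) (*-congʳ Fk≈k)))))))

        F-S₂ : ∀ a b → F (S₂ k a b) ≈ S₂ k (F a) (F b)
        F-S₂ a b = trans (F-+ _ _) (+-cong
          (trans (F-* _ _) (*-cong (trans (F-* _ _) (*-cong (F-* a b) (F-1+ a))) (F-1+ b)))
          (trans (F-neg _) (-‿cong (trans (F-* _ _) (*-cong Fk≈k (trans (F-+ _ _) (+-cong (F-* a b) (trans (F-neg 1#) (-‿cong F-1)))))))))

      module First (S≈0 : S₁ k z z₁ ≈ 0#) where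
        private
          S₁₂≈0 : S₁ k z₁ z₂ ≈ 0#
          S₁₂≈0 = trans (sym (F-S₁ z z₁)) (F-0 S≈0)

          -- S₁ takes the value 1 at (0, 0), and z divides z₁. So S₁ k z z₁ = 0 exhibits 1 as a
          -- multiple of z.
          z-unit : Unit z
          z-unit = - ((1# + 1#) * (1# + y) + (1# + y) * w + b * (1# + w) - k * b) , by-combination
            (solve 4 (λ k z b y → let w = z :* (𝟙 :+ y) in
              z :* (:- ((𝟙 :+ 𝟙) :* (𝟙 :+ y) :+ (𝟙 :+ y) :* w :+ b :* (𝟙 :+ w) :- k :* b)) :- 𝟙
            := (:- 𝟙) :* (((𝟙 :+ z) :* (𝟙 :+ b) :* (𝟙 :+ z :+ b) :- k :* z :* b) :- 𝟘)
            :+ (((𝟙 :+ 𝟙) :+ z :+ b :+ w :+ z :* b) :* (b :- z :* y)))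
              refl k z b y)
            (_ ⊛ S≈0 ⊕ _ ⊛ proj₂ (F-multiple z))
            where
            y = proj₁ (F-multiple z)
            b = z₁
            w = z * (1# + y)

          z₁-unit : Unit z₁
          z₁-unit = F-unit z-unit
          z₂-unit : Unit z₂
          z₂-unit = F-unit z₁-unit

          1+z₁-unit : Unit (1# + z₁)
          1+z₁-unit = unit-factor {1# + z₁} {(1# + z) * (1# + z + z₁)} (unit-resp (by-combination
            (solve 3 (λ k z b → k :* z :* b :- (𝟙 :+ b) :* ((𝟙 :+ z) :* (𝟙 :+ z :+ b))
              := (:- 𝟙) :* (((𝟙 :+ z) :* (𝟙 :+ b) :* (𝟙 :+ z :+ b) :- k :* z :* b) :- 𝟘)) refl k z z₁)
            (_ ⊛ S≈0)) (unit-* (unit-* k-unit z-unit) z₁-unit))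

        -- S₁ is symmetric, so z and z₂ are roots of the same quadratic over z₁, with leading
        -- coefficient 1 + z₁ and constant term (1 + z₁)². Eliminating the linear term leaves the
        -- claim times 1 + z₁.
        split : (z₂ - z) * D₁ z z₁ z₂ ≈ 0#
        split = unit-cancel 1+z₁-unit (trans
          (solve 4 (λ k z z₁ z₂ → let S = λ a b → (𝟙 :+ a) :* (𝟙 :+ b) :* (𝟙 :+ a :+ b) :- k :* a :* b in
            (𝟙 :+ z₁) :* ((z₂ :- z) :* (z :* z₂ :- (𝟙 :+ z₁)))
          := z :* (S z₁ z₂ :- 𝟘) :+ (:- z₂) :* (S z z₁ :- 𝟘)) refl k z z₁ z₂)
          (_ ⊛ S₁₂≈0 ⊕ _ ⊛ S≈0))

        -- The recurrence has period five: r₁ and r₂ are images of r₀, and r₄ and r₃ follow from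
        -- them by cancelling units. Comparing r₃ with the image of r₂ gives z₅ ≈ z.
        cycle-of-root : D₁ z z₁ z₂ ≈ 0# → Cycle k z z₁ z₂ z₃ z₄ ∧ (z₅ ≈ z)
        cycle-of-root D≈0 = cycle r₀ r₁ r₂ r₃ r₄ norm , z₅≈z
          where
          r₀ : z * z₂ ≈ 1# + z₁
          r₀ = x-y≈0⇒x≈y D≈0
          next : ∀ {a b c} → a * c ≈ 1# + b → F a * F c ≈ 1# + F b
          next {a} {b} {c} e = trans (sym (F-* a c)) (trans (F-cong e) (F-1+ b))
          r₁ = next r₀
          r₂ = next r₁
          r₃′ = next r₂
          r₄ : z₄ * z₁ ≈ 1# + z
          r₄ = by-unit (unit-* z-unit z₂-unit)
            (solve 5 (λ a b c d e → a :* c :* (e :* b :- (𝟙 :+ a))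
              := a :* b :* (c :* e :- (𝟙 :+ d)) :+ (a :* (b :* d :- (𝟙 :+ c)) :+ (:- a) :* (a :* c :- (𝟙 :+ b)))) refl z z₁ z₂ z₃ z₄)
            (_ ⊛ r₂ ⊕ _ ⊛ r₁ ⊕ _ ⊛ r₀)
          r₃ : z₃ * z ≈ 1# + z₄
          r₃ = by-unit z₁-unit
            (solve 5 (λ a b c d e → b :* (d :* a :- (𝟙 :+ e))
              := a :* (b :* d :- (𝟙 :+ c)) :+ (𝟙 :* (a :* c :- (𝟙 :+ b)) :+ (:- 𝟙) :* (e :* b :- (𝟙 :+ a)))) refl z z₁ z₂ z₃ z₄)
            (_ ⊛ r₁ ⊕ _ ⊛ r₀ ⊕ _ ⊛ r₄)
          z₅≈z : z₅ ≈ z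
          z₅≈z = by-unit (F-unit z₂-unit)
            (solve 4 (λ a d e f → d :* (f :- a) := 𝟙 :* (d :* f :- (𝟙 :+ e)) :+ (:- 𝟙) :* (d :* a :- (𝟙 :+ e))) refl z z₃ z₄ z₅)
            (_ ⊛ r₃′ ⊕ _ ⊛ r₃)
          norm : z * z₁ * z₂ * z₃ * z₄ ≈ k
          norm = by-unit (unit-* z-unit z₁-unit)
            (solve 6 (λ k a b c d e →
                a :* b :* (a :* b :* c :* d :* e :- k)
              := a :* b :* a :* d :* c :* (e :* b :- (𝟙 :+ a))
              :+ ((𝟙 :+ a) :* a :* b :* d :* (a :* c :- (𝟙 :+ b))
              :+ ((𝟙 :+ a) :* (𝟙 :+ b) :* a :* (b :* d :- (𝟙 :+ c))
              :+ ((𝟙 :+ a) :* (𝟙 :+ b) :* (a :* c :- (𝟙 :+ b))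
              :+ 𝟙 :* (((𝟙 :+ a) :* (𝟙 :+ b) :* (𝟙 :+ a :+ b) :- k :* a :* b) :- 𝟘)))))
              refl k z z₁ z₂ z₃ z₄)
            (_ ⊛ r₄ ⊕ _ ⊛ r₀ ⊕ _ ⊛ r₁ ⊕ _ ⊛ r₀ ⊕ _ ⊛ S≈0)

        -- In terms of e = θ - (k - 1) the equation of z and z₁ reads e (z z₁ + e + 2k) = - k², so e
        -- is a unit. M₁ k a z arises from S₁ k z z₁ by putting a - z for z₁, which changes it by a
        -- multiple of θ - a.
        type₂ : z₂ - z ≈ 0# → ∃ λ θ → (F θ ≈ θ) ∧ Unit (θ - (k - 1#)) ∧ (∀ a → ∃ λ g → M₁ k a z ≈ (θ - a) * g)
        type₂ z₂-z≈0 = z + z₁ ,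
          trans (F-+ z z₁) (trans (+-congˡ (x-y≈0⇒x≈y z₂-z≈0)) (+-comm z₁ z)) ,
          unit-factor {z + z₁ - (k - 1#)} { - (z * z₁ + (z + z₁ - (k - 1#)) + (k + k))} (unit-resp (by-combination
            (solve 3 (λ k a b → let e = a :+ b :- (k :- 𝟙) in
               k :* k :- e :* (:- (a :* b :+ e :+ (k :+ k)))
            := 𝟙 :* (((𝟙 :+ a) :* (𝟙 :+ b) :* (𝟙 :+ a :+ b) :- k :* a :* b) :- 𝟘)) refl k z z₁)
            (_ ⊛ S≈0)) (unit-* k-unit k-unit)) ,
          λ a → - ((1# + z) * (z + z₁ + a) + (1# + z) + (1# - z * z) - k * z) , by-combination
            (solve 4 (λ k z b a →
              (𝟙 :+ a :+ z :* (a :- z)) :* (𝟙 :+ a) :- k :* z :* (a :- z)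
                :- (z :+ b :- a) :* (:- ((𝟙 :+ z) :* (z :+ b :+ a) :+ (𝟙 :+ z) :+ (𝟙 :- z :* z) :- k :* z))
            := 𝟙 :* (((𝟙 :+ z) :* (𝟙 :+ b) :* (𝟙 :+ z :+ b) :- k :* z :* b) :- 𝟘)) refl k z z₁ a)
            (_ ⊛ S≈0)

      module Second (S≈0 : S₂ k z z₁ ≈ 0#) where
        private
          S₁₂≈0 : S₂ k z₁ z₂ ≈ 0#
          S₁₂≈0 = trans (sym (F-S₂ z z₁)) (F-0 S≈0)

          z-unit : Unit z
          z-unit = unit-factor {z} { - (z₁ * (1# + z) * (1# + z₁) - k * z₁)} (unit-resp (by-combination
            (solve 3 (λ k a b → k :- a :* (:- (b :* (𝟙 :+ a) :* (𝟙 :+ b) :- k :* b))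
              := 𝟙 :* ((a :* b :* (𝟙 :+ a) :* (𝟙 :+ b) :- k :* (a :* b :- 𝟙)) :- 𝟘)) refl k z z₁)
            (_ ⊛ S≈0)) k-unit)

        -- The elimination of the first correspondence again. The quadratic over z₁ now has leading
        -- coefficient z₁ (1 + z₁) and constant term k, so no unit has to be cancelled.
        split : (z₂ - z) * D₂ k z z₁ z₂ ≈ 0#
        split = trans
          (solve 4 (λ k z z₁ z₂ → let S = λ a b → a :* b :* (𝟙 :+ a) :* (𝟙 :+ b) :- k :* (a :* b :- 𝟙) in
            (z₂ :- z) :* (z :* z₁ :* (𝟙 :+ z₁) :* z₂ :- k)
          := z :* (S z₁ z₂ :- 𝟘) :+ (:- z₂) :* (S z z₁ :- 𝟘)) refl k z z₁ z₂)
          (_ ⊛ S₁₂≈0 ⊕ _ ⊛ S≈0)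

        -- With z, z₁, z₂ as u₀, u₂, u₄, the hypothesis is the product formula k = u₀ u₂ u₄ (u₁ u₃)
        -- with 1 + u₂ for u₁ u₃. The recurrence predicts z z₁ - 1 and z₁ z₂ - 1 as u₁ and u₃; these
        -- have to be identified with z₃ and z₄.
        cycle-of-root : D₂ k z z₁ z₂ ≈ 0# → Cycle k z z₃ z₁ z₄ z₂ ∧ (z₅ ≈ z)
        cycle-of-root D≈0 = cycle (lyness a₀)
          (lyness (trans (F-cong (sym z₅≈z)) a₃)) (lyness a₁)
          (lyness (trans (F-cong (F-cong (sym z₅≈z))) (trans (next a₃) (+-congʳ (*-congˡ z₅≈z)))))
          (lyness (trans (sym z₅≈z) a₂)) norm , z₅≈z
          where
          d₀ : z * z₁ * (1# + z₁) * z₂ ≈ k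
          d₀ = x-y≈0⇒x≈y D≈0
          1+z₁-unit : Unit (1# + z₁)
          1+z₁-unit = unit-factor {1# + z₁} {z * z₁ * z₂} (unit-resp
            (trans (sym d₀) (solve 3 (λ a b c → a :* b :* (𝟙 :+ b) :* c := (𝟙 :+ b) :* (a :* b :* c)) refl z z₁ z₂)) k-unit)
          -- The relation u₄ u₁ = 1 + u₀ with the predicted value of u₁; `backward` is its mirror
          -- image.
          forward : 1# + z ≈ z₂ * (z * z₁ - 1#)
          forward = by-unit (unit-* (unit-* z-unit (F-unit z-unit)) 1+z₁-unit)
            (solve 4 (λ k a b c → a :* b :* (𝟙 :+ b) :* ((𝟙 :+ a) :- c :* (a :* b :- 𝟙))
              := 𝟙 :* ((a :* b :* (𝟙 :+ a) :* (𝟙 :+ b) :- k :* (a :* b :- 𝟙)) :- 𝟘)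
              :+ (:- (a :* b :- 𝟙)) :* (a :* b :* (𝟙 :+ b) :* c :- k)) refl k z z₁ z₂)
            (_ ⊛ S≈0 ⊕ _ ⊛ d₀)
          backward : 1# + z₂ ≈ z * (z₁ * z₂ - 1#)
          backward = by-unit (unit-* (unit-* (F-unit z-unit) (F-unit (F-unit z-unit))) 1+z₁-unit)
            (solve 4 (λ k a b c → b :* c :* (𝟙 :+ b) :* ((𝟙 :+ c) :- a :* (b :* c :- 𝟙))
              := 𝟙 :* ((b :* c :* (𝟙 :+ b) :* (𝟙 :+ c) :- k :* (b :* c :- 𝟙)) :- 𝟘)
              :+ (:- (b :* c :- 𝟙)) :* (a :* b :* (𝟙 :+ b) :* c :- k)) refl k z z₁ z₂)
            (_ ⊛ S₁₂≈0 ⊕ _ ⊛ d₀)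
          forward₁ : 1# + z₁ ≈ z₃ * (z₁ * z₂ - 1#)
          forward₁ = trans (sym (F-1+ z)) (trans (F-cong forward) (trans (F-* _ _)
            (*-congˡ (trans (F-+ _ _) (+-cong (F-* z z₁) (trans (F-neg 1#) (-‿cong F-1)))))))
          w-unit : Unit (z₁ * z₂ - 1#)
          w-unit = unit-factor {z₁ * z₂ - 1#} {z} (unit-resp (trans backward (*-comm _ _))
            (unit-resp (F-1+ z₁) (F-unit 1+z₁-unit)))
          a₀ : z₃ ≈ z * z₁ - 1#
          a₀ = by-unit w-unit
            (solve 4 (λ a b c d → (b :* c :- 𝟙) :* (d :- (a :* b :- 𝟙))
              := (:- 𝟙) :* ((𝟙 :+ b) :- d :* (b :* c :- 𝟙)) :+ b :* ((𝟙 :+ a) :- c :* (a :* b :- 𝟙)))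
              refl z z₁ z₂ z₃)
            (_ ⊛ forward₁ ⊕ _ ⊛ forward)
          next : ∀ {a b d} → d ≈ a * b - 1# → F d ≈ F a * F b - 1#
          next {a} {b} e = trans (F-cong e) (trans (F-+ _ _) (+-cong (F-* a b) (trans (F-neg 1#) (-‿cong F-1))))
          a₁ = next a₀
          a₂ = next a₁
          a₃ = next a₂
          lyness : ∀ {a b d} → d ≈ a * b - 1# → a * b ≈ 1# + d
          lyness {a} {b} {d} e = by-combination
            (solve 3 (λ a b d → a :* b :- (𝟙 :+ d) := (:- 𝟙) :* (d :- (a :* b :- 𝟙))) refl a b d) (_ ⊛ e)
          z₅≈z : z₅ ≈ z
          z₅≈z = by-combination
            (solve 5 (λ a b c d f → f :- a := 𝟙 :* (f :- (c :* d :- 𝟙)) :+ (c :* (d :- (a :* b :- 𝟙))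
              :+ (:- 𝟙) :* ((𝟙 :+ a) :- c :* (a :* b :- 𝟙)))) refl z z₁ z₂ z₃ z₅)
            (_ ⊛ a₂ ⊕ _ ⊛ a₀ ⊕ _ ⊛ forward)
          norm : z * z₃ * z₁ * z₄ * z₂ ≈ k
          norm = by-combination
            (solve 6 (λ k a b c d e → a :* d :* b :* e :* c :- k
              := 𝟙 :* (a :* b :* (𝟙 :+ b) :* c :- k)
              :+ ((:- (a :* b :* c)) :* ((𝟙 :+ b) :- d :* (b :* c :- 𝟙))
              :+ (a :* b :* c :* d) :* (e :- (b :* c :- 𝟙)))) refl k z z₁ z₂ z₃ z₄)
            (_ ⊛ d₀ ⊕ _ ⊛ forward₁ ⊕ _ ⊛ a₁)

        -- Here θ is the product z z₁, already a unit, so that κ = 0; the factor z in M₂ clears the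
        -- denominator of a / z.
        type₂ : z₂ - z ≈ 0# → ∃ λ θ → (F θ ≈ θ) ∧ Unit (θ - 0#) ∧ (∀ a → ∃ λ g → M₂ k a z ≈ (θ - a) * g)
        type₂ z₂-z≈0 = z * z₁ ,
          trans (F-* z z₁) (trans (*-congˡ (x-y≈0⇒x≈y z₂-z≈0)) (*-comm z₁ z)) ,
          unit-resp (solve 1 (λ x → x := x :- 𝟘) refl (z * z₁)) (unit-* z-unit (F-unit z-unit)) ,
          λ a → - (z * z + (z * z₁ + a + 1# - k) * z + z * z₁ + a) , by-combination
            (solve 4 (λ k z b a →
              a :* z :* z :+ (a :* a :+ a :- k :* a :+ k) :* z :+ a :* a
                :- (z :* b :- a) :* (:- (z :* z :+ (z :* b :+ a :+ 𝟙 :- k) :* z :+ z :* b :+ a))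
            := z :* ((z :* b :* (𝟙 :+ z) :* (𝟙 :+ b) :- k :* (z :* b :- 𝟙)) :- 𝟘)) refl k z z₁ a)
            (_ ⊛ S≈0)

-- Cycles in the finite field

module Cycles {c ℓ} {K : CommutativeRing c ℓ} {n} (finite : IsFiniteField K n)
              (q : ℕ) (n≡q^5 : n ≡ q ℕ.^ 5) (1<q : 1 ℕ.< q) where
  open CommutativeRing K hiding (zero)
  open IsFiniteField finite
  open FiniteField finite
  open Polynomials K
  open Roots K
  open Existence finite q n≡q^5 1<q
  open IntegerCoefficients K
  open RingLemmas K
  open Ideals K[X] using (principal)
  open import Algebra.Properties.Semiring.Exp semiring using (_^_; ^-congˡ)
  private
    module R = CommutativeRing K[X]
    module E = Evaluation K K id
    module 𝓚 = Correspondences K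
    module 𝓡 = Correspondences K[X]

    0<q : 0 ℕ.< q
    0<q = ℕₚ.<-trans (s≤s z≤n) 1<q

    -- The rules for this relation follow the shape of a polynomial, so that G and D at z take the
    -- form in which the correspondences over K use them.
    record _at_↦_ (f : Poly) (a b : Carrier) : Set ℓ where
      constructor value
      field value≈ : eval f a ≈ b
    open _at_↦_

    module _ {a : Carrier} where
      infixl 6 _⊕ᵉ_ _⊖ᵉ_
      infixl 7 _⊗ᵉ_
      _⊕ᵉ_ : ∀ {f g x y} → f at a ↦ x → g at a ↦ y → (f ⊞ g) at a ↦ (x + y)
      _⊕ᵉ_ {f} {g} p q = value (trans (E.ev-+ identity a f g) (+-cong (value≈ p) (value≈ q)))
      _⊖ᵉ_ : ∀ {f g x y} → f at a ↦ x → g at a ↦ y → (f R.- g) at a ↦ (x - y)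
      _⊖ᵉ_ {f} {g} p q = value (trans (E.ev-+ identity a f (R.- g))
        (+-cong (value≈ p) (trans (E.ev-neg identity a g) (-‿cong (value≈ q)))))
      _⊗ᵉ_ : ∀ {f g x y} → f at a ↦ x → g at a ↦ y → (f ⊠ g) at a ↦ (x * y)
      _⊗ᵉ_ {f} {g} p q = value (trans (E.ev-* identity a f g) (*-cong (value≈ p) (value≈ q)))
      Fᵉ : ∀ {f b} → f at a ↦ b → F f at a ↦ (b ^ q)
      Fᵉ {f} p = value (trans (E.ev-^ identity a f q) (^-congˡ q (value≈ p)))
      1ᵉ : R.1# at a ↦ 1#
      1ᵉ = value (E.ev-1 identity a)
      Cᵉ : ∀ b → C b at a ↦ b
      Cᵉ b = value (E.ev-C identity a b)
      Xᵉ : X at a ↦ a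
      Xᵉ = value (E.ev-X identity a)

    C-sub : ∀ a b → C (a - b) ≋ C a R.- C b
    C-sub a b = R.trans (C-+ a (- b)) (R.+-congˡ {C a} (C-neg b))

  Lead-+ʳ : ∀ {d e a b f g} → d ℕ.< e → Lead d a f → Lead e b g → Lead e b (f ⊞ g)
  Lead-+ʳ {f = f} {g} d<e p q = Lead-resp (R.+-comm g f) (Lead-+ˡ d<e q p)

  module _ (F-additive : ∀ f g → F (f ⊞ g) ≋ F f ⊞ F g) (K-additive : ∀ x y → (x + y) ^ q ≈ x ^ q + y ^ q)
           (k ν : Carrier) (k^q≈k : k ^ q ≈ k) (k≉0 : ¬ (k ≈ 0#)) where
    private
      frobeniusK : Frobenius K
      frobeniusK = power-frobenius K 0<q K-additive
      k-unit : Products.Unit K k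
      k-unit = inverse k k≉0
      FCk : F (C k) ≋ C k
      FCk = R.trans (C-^ k q) (C-cong k^q≈k)
      Ck-unit : Products.Unit K[X] (C k)
      Ck-unit = C-unit k≉0

      module Q (I : Ideal K[X] (c ⊔ ℓ)) where
        frobQ : Frobenius (quotient I)
        frobQ = quotient-frobenius I (frobenius F-additive)
        FCk′ : Congruent I (F (C k)) (C k)
        FCk′ = ≈⇒congruent I FCk
        Ck-unit′ : Products.Unit (quotient I) (C k)
        Ck-unit′ = proj₁ Ck-unit , ≈⇒congruent I (proj₂ Ck-unit)

    cycle₁ : ∃ λ z → ¬ (z ≈ ν) ∧ Lyness.Cycle K k z (z ^ q) ((z ^ q) ^ q) (((z ^ q) ^ q) ^ q) ((((z ^ q) ^ q) ^ q) ^ q)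
    cycle₁ = z , z≉ν , proj₁ (𝓚.First.cycle-of-root frobeniusK k^q≈k k-unit
        (trans (sym (value≈ ((1ᵉ ⊕ᵉ Xᵉ) ⊗ᵉ (1ᵉ ⊕ᵉ z₁ᵉ) ⊗ᵉ (1ᵉ ⊕ᵉ Xᵉ ⊕ᵉ z₁ᵉ) ⊖ᵉ Cᵉ k ⊗ᵉ Xᵉ ⊗ᵉ z₁ᵉ))) Gz≈0)
        (trans (sym (value≈ (Xᵉ ⊗ᵉ Fᵉ z₁ᵉ ⊖ᵉ (1ᵉ ⊕ᵉ z₁ᵉ)))) Dz≈0))
      where
      G D : Poly
      G = 𝓡.S₁ (C k) X (F X)
      D = 𝓡.D₁ X (F X) (F (F X))
      M : Carrier → Poly
      M a = 𝓡.M₁ (C k) (C a) X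
      lc : Carrier → Carrier
      -- This is k - 1 - a, so it vanishes only at κ = k - 1. The unreduced form is the one produced
      -- by the rules for `Lead`.
      lc a = (1# * (- 1#)) * (1# + a) - k * 1# * (- 1#)

      G-lead : Lead (1 ℕ.+ q ℕ.+ q) (1# * 1# * 1#) G
      G-lead = Lead-+ˡ (s≤s (ℕₚ.m<n+m q {q} 0<q))
        (Lead-* (Lead-* (Lead-+ʳ (s≤s z≤n) (Lead-C 1#) Lead-X) (Lead-+ʳ 0<q (Lead-C 1#) (Lead-X^ q)))
                (Lead-+ʳ 1<q (Lead-+ʳ (s≤s z≤n) (Lead-C 1#) Lead-X) (Lead-X^ q)))
        (Lead-neg (Lead-* (Lead-* (Lead-C k) Lead-X) (Lead-X^ q)))

      M-lead : ∀ a → Lead 2 (lc a) (M a)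
      M-lead a = Lead-+ (Lead-* (Lead-+ʳ (s≤s z≤n) (Lead-+ (Lead-C 1#) (Lead-C a)) (Lead-* Lead-X a-X))
                                (Lead-+ (Lead-C 1#) (Lead-C a)))
                        (Lead-neg (Lead-* (Lead-* (Lead-C k) Lead-X) a-X))
        where
        a-X : Lead 1 (- 1#) (C a R.- X)
        a-X = Lead-+ʳ (s≤s z≤n) (Lead-C a) (Lead-neg Lead-X)

      lc≉0 : ∀ a → ¬ (a ≈ k - 1#) → ¬ (lc a ≈ 0#)
      lc≉0 a a≉ e = a≉ (by-combination (solve 2 (λ a k → a :- (k :- 𝟙)
        := (:- 𝟙) :* (((𝟙 :* (:- 𝟙)) :* (𝟙 :+ a) :- k :* 𝟙 :* (:- 𝟙)) :- 𝟘)) refl a k) (_ ⊛ e))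

      module I (I : Ideal K[X] (c ⊔ ℓ)) (G∈I : Ideal.member I G) = Correspondences.First (quotient I) (Q.frobQ I) {C k} {X}
        (Q.FCk′ I) (Q.Ck-unit′ I) (member⇒congruent-0 I {G} G∈I)

      root = common-root F-additive G D M (k - 1#) ν (λ e → 1≉0 (trans (sym (trans (*-congʳ (*-identityˡ 1#)) (*-identityˡ 1#))) e))
        G-lead (ℕₚ.n≤1+n (q ℕ.+ q))
        (trans (Frobenius.F-+ frobeniusK k (- 1#)) (+-cong k^q≈k (trans (Frobenius.F-neg frobeniusK 1#) (-‿cong (Frobenius.F-1 frobeniusK)))))
        M-lead lc≉0
        (congruent-0⇒member (principal G) {(F (F X) R.- X) ⊠ D} (I.split (principal G) (R.1# , R.sym (R.*-identityˡ G))))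
        (λ I G∈I e → let t = I.type₂ I G∈I (member⇒congruent-0 I e)
                         θ = proj₁ t in
            θ , proj₁ (proj₂ t)
              , Products.unit-resp (quotient I) {θ R.- (C k R.- R.1#)} {θ R.- C (k - 1#)}
                  (≈⇒congruent I (R.+-congˡ {θ} (R.-‿cong (R.sym (C-sub k 1#))))) (proj₁ (proj₂ (proj₂ t)))
              , λ a → proj₂ (proj₂ (proj₂ t)) (C a))
        (λ I G∈I D∈I → proj₂ (I.cycle-of-root I G∈I (member⇒congruent-0 I {D} D∈I)))
      z = proj₁ root
      z≉ν = proj₁ (proj₂ root)
      Gz≈0 = proj₁ (proj₂ (proj₂ root))
      Dz≈0 = proj₂ (proj₂ (proj₂ root))
      z₁ᵉ : F X at z ↦ (z ^ q)
      z₁ᵉ = Fᵉ Xᵉ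

    -- F raises the indices of this cycle by two: the successive q-powers of z are u₀, u₂, u₄, u₁,
    -- u₃.
    cycle₂ : ∃ λ z → ¬ (z ≈ ν) ∧ Lyness.Cycle K k z (((z ^ q) ^ q) ^ q) (z ^ q) ((((z ^ q) ^ q) ^ q) ^ q) ((z ^ q) ^ q)
    cycle₂ = z , z≉ν , proj₁ (𝓚.Second.cycle-of-root frobeniusK k^q≈k k-unit
        (trans (sym (value≈ (Xᵉ ⊗ᵉ z₁ᵉ ⊗ᵉ (1ᵉ ⊕ᵉ Xᵉ) ⊗ᵉ (1ᵉ ⊕ᵉ z₁ᵉ) ⊖ᵉ Cᵉ k ⊗ᵉ (Xᵉ ⊗ᵉ z₁ᵉ ⊖ᵉ 1ᵉ)))) Gz≈0)
        (trans (sym (value≈ (Xᵉ ⊗ᵉ z₁ᵉ ⊗ᵉ (1ᵉ ⊕ᵉ z₁ᵉ) ⊗ᵉ Fᵉ z₁ᵉ ⊖ᵉ Cᵉ k))) Dz≈0))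
      where
      G D : Poly
      G = 𝓡.S₂ (C k) X (F X)
      D = 𝓡.D₂ (C k) X (F X) (F (F X))
      M : Carrier → Poly
      M a = 𝓡.M₂ (C k) (C a) X

      G-lead : Lead (1 ℕ.+ q ℕ.+ 1 ℕ.+ q) (1# * 1# * 1# * 1#) G
      G-lead = Lead-+ˡ (ℕₚ.m<m+n (1 ℕ.+ q) {1 ℕ.+ q} (s≤s z≤n) ⟨≤⟩ ≡.sym (ℕₚ.+-assoc (1 ℕ.+ q) 1 q))
        (Lead-* (Lead-* (Lead-* Lead-X (Lead-X^ q)) (Lead-+ʳ (s≤s z≤n) (Lead-C 1#) Lead-X)) (Lead-+ʳ 0<q (Lead-C 1#) (Lead-X^ q)))
        (Lead-neg (Lead-* (Lead-C k) (Lead-+ˡ (s≤s z≤n) (Lead-* Lead-X (Lead-X^ q)) (Lead-neg (Lead-C 1#)))))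
        where
        _⟨≤⟩_ : ∀ {a b c : ℕ} → a ℕ.< b → b ≡ c → a ℕ.< c
        l ⟨≤⟩ ≡.refl = l

      M-lead : ∀ a → Lead 2 (a * 1# * 1#) (M a)
      M-lead a = Lead-+ˡ (s≤s z≤n) (Lead-+ˡ (s≤s (s≤s z≤n)) (Lead-* (Lead-* (Lead-C a) Lead-X) Lead-X)
          (Lead-* (Lead-+ (Lead-+ (Lead-+ (Lead-* (Lead-C a) (Lead-C a)) (Lead-C a)) (Lead-neg (Lead-* (Lead-C k) (Lead-C a)))) (Lead-C k)) Lead-X))
        (Lead-* (Lead-C a) (Lead-C a))

      module I (I : Ideal K[X] (c ⊔ ℓ)) (G∈I : Ideal.member I G) = Correspondences.Second (quotient I) (Q.frobQ I) {C k} {X}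
        (Q.FCk′ I) (Q.Ck-unit′ I) (member⇒congruent-0 I {G} G∈I)

      root = common-root F-additive G D M 0# ν
        (λ e → 1≉0 (trans (sym (trans (*-congʳ (trans (*-congʳ (*-identityˡ 1#)) (*-identityˡ 1#))) (*-identityˡ 1#))) e))
        G-lead (ℕₚ.≤-trans (ℕₚ.+-monoˡ-≤ q (ℕₚ.m≤n+m q 1)) (ℕₚ.+-monoˡ-≤ q (ℕₚ.m≤m+n (1 ℕ.+ q) 1)))
        (Frobenius.F-0 frobeniusK refl)
        M-lead (λ a a≉0 e → a≉0 (trans (sym (trans (*-identityʳ _) (*-identityʳ _))) e))
        (congruent-0⇒member (principal G) {(F (F X) R.- X) ⊠ D} (I.split (principal G) (R.1# , R.sym (R.*-identityˡ G))))
        (λ I G∈I e → let t = I.type₂ I G∈I (member⇒congruent-0 I e)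
                         θ = proj₁ t in
            θ , proj₁ (proj₂ t)
              , Products.unit-resp (quotient I) {θ R.- R.0#} {θ R.- C 0#}
                  (≈⇒congruent I (R.+-congˡ {θ} (R.-‿cong (R.sym C-0)))) (proj₁ (proj₂ (proj₂ t)))
              , λ a → proj₂ (proj₂ (proj₂ t)) (C a))
        (λ I G∈I D∈I → proj₂ (I.cycle-of-root I G∈I (member⇒congruent-0 I {D} D∈I)))
      z = proj₁ root
      z≉ν = proj₁ (proj₂ root)
      Gz≈0 = proj₁ (proj₂ (proj₂ root))
      Dz≈0 = proj₂ (proj₂ (proj₂ root))
      z₁ᵉ : F X at z ↦ (z ^ q)
      z₁ᵉ = Fᵉ Xᵉ

-- Powers of the Frobenius map

iterate : ∀ {a} {A : Set a} → (A → A) → ℕ → A → A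
iterate f zero    x = x
iterate f (suc j) x = iterate f j (f x)

iterate-+ : ∀ {a} {A : Set a} (f : A → A) i j x → iterate f (i ℕ.+ j) x ≡ iterate f j (iterate f i x)
iterate-+ f zero    j x = ≡.refl
iterate-+ f (suc i) j x = iterate-+ f i j (f x)

iterate-frobenius : ∀ {c ℓ} {A : CommutativeRing c ℓ} → Frobenius A → ℕ → Frobenius A
iterate-frobenius {A = A} frob zero = record
  { F = id ; F-cong = id ; F-+ = λ _ _ → refl ; F-* = λ _ _ → refl ; F-1 = refl
  ; F-multiple = λ x → 1# , sym (*-identityʳ x) }
  where open CommutativeRing A
iterate-frobenius {A = A} frob (suc j) = record
  { F = λ x → I.F (F x)
  ; F-cong = λ e → I.F-cong (F-cong e)
  ; F-+ = λ x y → trans (I.F-cong (F-+ x y)) (I.F-+ (F x) (F y))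
  ; F-* = λ x y → trans (I.F-cong (F-* x y)) (I.F-* (F x) (F y))
  ; F-1 = trans (I.F-cong F-1) I.F-1
  ; F-multiple = λ x → _ , trans (proj₂ (I.F-multiple (F x))) (trans (*-congʳ (proj₂ (F-multiple x))) (*-assoc _ _ _)) }
  where
  open CommutativeRing A
  open Frobenius frob
  module I = Frobenius (iterate-frobenius frob j)

iterate-F : ∀ {c ℓ} {A : CommutativeRing c ℓ} (frob : Frobenius A) j x →
            Frobenius.F (iterate-frobenius frob j) x ≡ iterate (Frobenius.F frob) j x
iterate-F frob zero    x = ≡.refl
iterate-F frob (suc j) x = iterate-F frob j (Frobenius.F frob x)

-- Solution of the two equations

module FieldSolution {c ℓ} {K : CommutativeRing c ℓ} {N} (finite : IsFiniteField K N) (σ : Frobenius K) where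
  open CommutativeRing K
  open IsFiniteField finite
  open FiniteField finite
  open Frobenius σ
  open Domain K noZeroDivisors
  open Lyness K
  open IntegerCoefficients K
  open RingLemmas K

  F-nonzero : ∀ {x} → nonzero x → nonzero (F x)
  F-nonzero {x} x≉0 Fx≈0 with inverse x x≉0
  ... | y , xy≈1 = 0≉1 (trans (sym (zeroˡ (F y))) (trans (*-congʳ (sym Fx≈0)) (trans (sym (F-* x y)) (trans (F-cong xy≈1) F-1))))

  F-sub : ∀ x y → F (x - y) ≈ F x - F y
  F-sub x y = trans (F-+ x (- y)) (+-congˡ (F-neg y))

  module Solution {k δ η l m n Δ ν u₀ u₁ u₂ u₃ u₄} (P : Parameters k δ η l m n Δ) (C : Cycle k u₀ u₁ u₂ u₃ u₄)
    (δ≉0 : nonzero δ) (η≉0 : nonzero η) (m≉0 : nonzero m) (k≉0 : nonzero k)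
    (Fη≈η : F η ≈ η) (Fm≈m : F m ≈ m) (Fn≈n : F n ≈ n)
    (s₀ : F u₀ ≈ u₁) (s₁ : F u₁ ≈ u₂) (s₂ : F u₂ ≈ u₃) (s₃ : F u₃ ≈ u₄) (s₄ : F u₄ ≈ u₀)
    (ν-pole : η * m * (1# + ν) ≈ - (n * k)) (u₀≉ν : ¬ (u₀ ≈ ν)) where
    open Cycle C
    private
      D : Carrier → Carrier → Carrier
      D a b = n * (1# + a + b) + η * m

      F-D : ∀ {a b a′ b′} → F a ≈ a′ → F b ≈ b′ → F (D a b) ≈ D a′ b′
      F-D p q = trans (F-+ _ _) (+-cong
        (trans (F-* _ _) (*-cong Fn≈n (trans (F-+ _ _) (+-cong (trans (F-+ _ _) (+-cong F-1 p)) q))))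
        (trans (F-* _ _) (*-cong Fη≈η Fm≈m)))

      -- Since (1 + u₀) t = k, a vanishing denominator forces η m (1 + u₀) = - n k, which is the
      -- equation defining ν. The other denominators are images of this one under σ.
      D₀≉0 : nonzero (D u₂ u₃)
      D₀≉0 D₀≈0 = u₀≉ν (by-cancel (nonzero-* η≉0 m≉0)
        (solve 7 (λ η m n k u ν t → η :* m :* (u :- ν)
          := (𝟙 :+ u) :* ((n :* t :+ η :* m) :- 𝟘) :+ ((:- n) :* ((𝟙 :+ u) :* t :- k)
          :+ (:- 𝟙) :* (η :* m :* (𝟙 :+ ν) :- (:- (n :* k))))) refl η m n k u₀ ν (1# + u₂ + u₃))
        (_ ⊛ D₀≈0 ⊕ _ ⊛ CycleFacts.[1+u]t C ⊕ _ ⊛ ν-pole))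
      D₁≉0 : nonzero (D u₃ u₄)
      D₁≉0 = nonzero-resp (F-D s₂ s₃) (F-nonzero D₀≉0)
      D₂≉0 : nonzero (D u₄ u₀)
      D₂≉0 = nonzero-resp (F-D s₃ s₄) (F-nonzero D₁≉0)
      D₃≉0 : nonzero (D u₀ u₁)
      D₃≉0 = nonzero-resp (F-D s₄ s₀) (F-nonzero D₂≉0)
      D₄≉0 : nonzero (D u₁ u₂)
      D₄≉0 = nonzero-resp (F-D s₀ s₁) (F-nonzero D₃≉0)

      ∏u≉0 : nonzero (u₀ * u₁ * u₂ * u₃ * u₄)
      ∏u≉0 = nonzero-resp (sym norm) k≉0
      u₄≉0 : nonzero u₄
      u₄≉0 = nonzero-factorʳ ∏u≉0
      u₀≉0 : nonzero u₀
      u₀≉0 = nonzero-resp s₄ (F-nonzero u₄≉0)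
      u₁≉0 : nonzero u₁
      u₁≉0 = nonzero-resp s₀ (F-nonzero u₀≉0)
      u₂≉0 : nonzero u₂
      u₂≉0 = nonzero-resp s₁ (F-nonzero u₁≉0)
      u₃≉0 : nonzero u₃
      u₃≉0 = nonzero-resp s₂ (F-nonzero u₂≉0)

      D₀⁻¹ = proj₁ (inverse _ D₀≉0)

    solution : Carrier
    solution = - (u₃ * (m - n * u₁)) * D₀⁻¹

    private
      x₀ = solution
      x₁ = F x₀
      x₂ = F x₁
      x₃ = F x₂
      x₄ = F x₃

      e₀ : x₀ * D u₂ u₃ ≈ - (u₃ * (m - n * u₁))
      e₀ = trans (*-assoc _ _ _) (trans (*-congˡ (trans (*-comm _ _) (proj₂ (inverse _ D₀≉0)))) (*-identityʳ _))

      next : ∀ {x a b v a′ b′ v′} → F a ≈ a′ → F b ≈ b′ → F v ≈ v′ →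
             x * D a b ≈ - (b * (m - n * v)) → F x * D a′ b′ ≈ - (b′ * (m - n * v′))
      next {x} {a} {b} {v} p q r e = trans (*-congˡ (sym (F-D p q))) (trans (sym (F-* x (D a b))) (trans (F-cong e)
        (trans (F-neg _) (-‿cong (trans (F-* _ _) (*-cong q (trans (F-sub m (n * v))
          (+-cong Fm≈m (-‿cong (trans (F-* n v) (*-cong Fn≈n r)))))))))))

      e₁ = next s₂ s₃ s₁ e₀
      e₂ = next s₃ s₄ s₂ e₁
      e₃ = next s₄ s₀ s₃ e₂
      e₄ = next s₀ s₁ s₄ e₃

    solution-norm : η * (x₀ * x₁ * x₂ * x₃ * x₄) ≈ - δ
    solution-norm = norm-equation P δ≉0 η≉0 C u₀≉0 u₁≉0 u₂≉0 u₃≉0 u₄≉0 D₀≉0 D₁≉0 D₂≉0 D₃≉0 D₄≉0 e₀ e₁ e₂ e₃ e₄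

    solution-equation : δ * η * x₁ - η * (x₀ * x₁ * x₂) * (1# - x₃) + (1# - x₀) * (1# - x₁) ≈ 0#
    solution-equation = equation P δ≉0 η≉0 C u₀≉0 u₁≉0 u₂≉0 u₃≉0 u₄≉0 D₀≉0 D₁≉0 D₂≉0 D₃≉0 D₄≉0 e₀ e₁ e₂ e₃ e₄

-- Choice of the parameters, and of the cycle for each s

module Main {c ℓ} (q : ℕ) (q-prime-power : IsPrimePower q) (K : CommutativeRing c ℓ)
            (finite : IsFiniteField K (q ℕ.^ 5)) where
  open CommutativeRing K hiding (zero)
  open RingOps K
  open IsFiniteField finite
  open FiniteField finite
  open Domain K noZeroDivisors
  open Lyness K
  open IntegerCoefficients K
  open RingLemmas K
  open Polynomials K
  open import Algebra.Properties.Semiring.Exp semiring using (^-homo-*; ^-assocʳ)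
  open import Relation.Binary.Reasoning.Setoid setoid
  private
    module R = CommutativeRing K[X]
    open RingOps K[X] using () renaming (_×_ to _×ₚ_; _^_ to _^ₚ_)

    p j : ℕ
    p = proj₁ q-prime-power
    j = proj₁ (proj₂ q-prime-power)
    p-prime : Prime p
    p-prime = proj₁ (proj₂ (proj₂ q-prime-power))
    q≡p^[1+j] : q ≡ p ℕ.^ suc j
    q≡p^[1+j] = proj₂ (proj₂ (proj₂ q-prime-power))

    1<q : 1 ℕ.< q
    1<q = ≡.subst (1 ℕ.<_) (≡.sym q≡p^[1+j]) (ℕₚ.<-≤-trans (ℕ.nonTrivial⇒n>1 p {{prime⇒nonTrivial p-prime}})
      (ℕₚ.m≤m*n p (p ℕ.^ j) {{ℕₚ.m^n≢0 p j {{ℕ.nonTrivial⇒nonZero p {{prime⇒nonTrivial p-prime}}}}}}))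

    p×1≈0 : p × 1# ≈ 0#
    p×1≈0 = characteristic p (suc j ℕ.* 5) (≡.trans (≡.cong (ℕ._^ 5) q≡p^[1+j]) (ℕₚ.^-*-assoc p (suc j) 5))

    ×-C : ∀ i → i ×ₚ C 1# ≋ C (i × 1#)
    ×-C zero    = R.sym C-0
    ×-C (suc i) = R.trans (R.+-congˡ (×-C i)) (R.sym (C-+ 1# (i × 1#)))

    K-additive : ∀ x y → (x + y) ^ q ≈ x ^ q + y ^ q
    K-additive = ≡.subst (λ q → ∀ x y → (x + y) ^ q ≈ x ^ q + y ^ q) (≡.sym q≡p^[1+j])
      (Freshman.freshman-iterated K p-prime p×1≈0 (suc j))

    K[X]-additive : ∀ f g → (f ⊞ g) ^ₚ q ≋ f ^ₚ q ⊞ g ^ₚ q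
    K[X]-additive = ≡.subst (λ q → ∀ f g → (f ⊞ g) ^ₚ q ≋ f ^ₚ q ⊞ g ^ₚ q) (≡.sym q≡p^[1+j])
      (Freshman.freshman-iterated K[X] p-prime (R.trans (×-C p) (R.trans (C-cong p×1≈0) C-0)) (suc j))

    frob : Frobenius K
    frob = power-frobenius K (ℕₚ.<-trans (s≤s z≤n) 1<q) K-additive
    open Frobenius frob

    ^q^≈iterate : ∀ i x → x ^ (q ℕ.^ i) ≈ iterate F i x
    ^q^≈iterate zero    x = *-identityʳ x
    ^q^≈iterate (suc i) x = trans (sym (^-assocʳ x q (q ℕ.^ i))) (^q^≈iterate i (F x))

    F⁵ : ∀ x → F (F (F (F (F x)))) ≈ x
    F⁵ x = trans (sym (^q^≈iterate 5 x))
      (fermat {{ℕ.>-nonZero (ℕₚ.<-trans (s≤s z≤n) (Existence.1<n finite q ≡.refl 1<q))}} x)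

  module _ (δ ε : Carrier) (δ^q≈δ : δ ^ q ≈ δ) (ε^q≈ε : ε ^ q ≈ ε) (δ≉0 : ¬ (δ ≈ 0#)) (ε≉0 : ¬ (ε ≈ 0#))
           (δ²ε≉1 : ¬ (δ ^ 2 * ε ≈ 1#)) (cubic≉0 : ¬ (δ ^ 3 * ε ^ 2 + (1# - 3 × δ) * ε + 1# ≈ 0#)) where
    private
      η l m n Δ : Carrier
      η = δ * ε
      l = 1# - δ
      m = δ * η - 1#
      n = 1# - η
      Δ = m * m - l * n

      η≉0 : nonzero η
      η≉0 = nonzero-* δ≉0 ε≉0

      m≉0 : nonzero m
      m≉0 m≈0 = δ²ε≉1 (by-combination
        (solve 2 (λ δ ε → δ :* (δ :* 𝟙) :* ε :- 𝟙 := 𝟙 :* ((δ :* (δ :* ε) :- 𝟙) :- 𝟘)) refl δ ε) (_ ⊛ m≈0))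

      Δ≉0 : nonzero Δ
      Δ≉0 = nonzero-resp
        (solve 2 (λ δ ε →
          δ :* (δ :* (δ :* (δ :* 𝟙)) :* (ε :* (ε :* 𝟙)) :+ (𝟙 :- (δ :+ (δ :+ (δ :+ 𝟘)))) :* ε :+ 𝟙)
        := (δ :* (δ :* ε) :- 𝟙) :* (δ :* (δ :* ε) :- 𝟙) :- (𝟙 :- δ) :* (𝟙 :- δ :* ε)) refl δ ε)
        (nonzero-* δ≉0 cubic≉0)

      k ν : Carrier
      k = δ * η * m * m * proj₁ (inverse Δ Δ≉0)
      ν = - (n * k * proj₁ (inverse (η * m) (nonzero-* η≉0 m≉0))) - 1#

      kΔ : k * Δ ≈ δ * η * m * m
      kΔ = trans (*-assoc _ _ _) (trans (*-congˡ (trans (*-comm _ _) (proj₂ (inverse Δ Δ≉0)))) (*-identityʳ _))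

      k≉0 : nonzero k
      k≉0 = nonzero-factorˡ (nonzero-resp (sym kΔ) (nonzero-* (nonzero-* (nonzero-* δ≉0 η≉0) m≉0) m≉0))

      ν-pole : η * m * (1# + ν) ≈ - (n * k)
      ν-pole = by-combination
        (solve 4 (λ a b n k → a :* (𝟙 :+ ((:- (n :* k :* b)) :- 𝟙)) :- (:- (n :* k)) := (:- (n :* k)) :* (a :* b :- 𝟙)) refl
          (η * m) (proj₁ (inverse (η * m) (nonzero-* η≉0 m≉0))) n k)
        (_ ⊛ proj₂ (inverse (η * m) (nonzero-* η≉0 m≉0)))

      parameters-δη : Parameters k δ η l m n Δ
      parameters-δη = parameters
        (solve 2 (λ δ η → (𝟙 :- δ) :+ (δ :* η :- 𝟙) := :- (δ :* (𝟙 :- η))) refl δ η)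
        (solve 2 (λ δ η → (𝟙 :- η) :+ (δ :* η :- 𝟙) := :- (η :* (𝟙 :- δ))) refl δ η)
        refl kΔ

      Fixed : Frobenius K → Carrier → Set ℓ
      Fixed σ x = Frobenius.F σ x ≈ x

      module _ (σ : Frobenius K) where
        private module σ = Frobenius σ
        fixed-1 : Fixed σ 1#
        fixed-1 = σ.F-1
        fixed-* : ∀ {x y} → Fixed σ x → Fixed σ y → Fixed σ (x * y)
        fixed-* p q = trans (σ.F-* _ _) (*-cong p q)
        fixed-sub : ∀ {x y} → Fixed σ x → Fixed σ y → Fixed σ (x - y)
        fixed-sub p q = trans (σ.F-+ _ _) (+-cong p (trans (σ.F-neg _) (-‿cong q)))

      fixed-η : ∀ σ → Fixed σ δ → Fixed σ ε → Fixed σ η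
      fixed-η σ = fixed-* σ
      fixed-m : ∀ σ → Fixed σ δ → Fixed σ ε → Fixed σ m
      fixed-m σ p q = fixed-sub σ (fixed-* σ p (fixed-* σ p q)) (fixed-1 σ)
      fixed-n : ∀ σ → Fixed σ δ → Fixed σ ε → Fixed σ n
      fixed-n σ p q = fixed-sub σ (fixed-1 σ) (fixed-* σ p q)

      -- k is the only solution of k Δ = δ η m², an equation whose coefficients F fixes.
      fixed-k : k ^ q ≈ k
      fixed-k = by-cancel Δ≉0
        (solve 4 (λ Δ k k′ c → Δ :* (k′ :- k) := 𝟙 :* (k′ :* Δ :- c) :+ (:- 𝟙) :* (k :* Δ :- c)) refl Δ k (F k) (δ * η * m * m))
        (_ ⊛ F-kΔ ⊕ _ ⊛ kΔ)
        where
        fm = fixed-m frob δ^q≈δ ε^q≈ε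
        F-kΔ : F k * Δ ≈ δ * η * m * m
        F-kΔ = begin
          F k * Δ              ≈⟨ *-congˡ (sym (fixed-sub frob (fixed-* frob fm fm)
                                    (fixed-* frob (fixed-sub frob (fixed-1 frob) δ^q≈δ) (fixed-n frob δ^q≈δ ε^q≈ε)))) ⟩
          F k * F Δ            ≈⟨ sym (F-* k Δ) ⟩
          F (k * Δ)            ≈⟨ F-cong kΔ ⟩
          F (δ * η * m * m)    ≈⟨ fixed-* frob (fixed-* frob (fixed-* frob δ^q≈δ (fixed-η frob δ^q≈δ ε^q≈ε)) fm) fm ⟩
          δ * η * m * m        ∎

      norm-product : ∀ x → x ^ normExp q ≈ x * F x * F (F x) * F (F (F x)) * F (F (F (F x)))
      norm-product x = trans (^-homo-* x (1 ℕ.+ q ℕ.+ q ℕ.^ 2 ℕ.+ q ℕ.^ 3) (q ℕ.^ 4)) (*-cong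
        (trans (^-homo-* x (1 ℕ.+ q ℕ.+ q ℕ.^ 2) (q ℕ.^ 3)) (*-cong
          (trans (^-homo-* x (1 ℕ.+ q) (q ℕ.^ 2)) (*-congˡ (^q^≈iterate 2 x)))
          (^q^≈iterate 3 x)))
        (^q^≈iterate 4 x))

      module _ (s : ℕ) where
        σ : Frobenius K
        σ = iterate-frobenius frob s
        S : Carrier → Carrier
        S = Frobenius.F σ

        Goal : Set (c ⊔ ℓ)
        Goal = ∃ λ x → (ε * x ^ normExp q ≈ - 1#) ∧
          (δ ^ 2 * ε * x ^ (q ℕ.^ s)
          - δ * ε * x ^ (q ℕ.^ (2 ℕ.* s) ℕ.+ q ℕ.^ s ℕ.+ 1) * (1# - x) ^ (q ℕ.^ (3 ℕ.* s))
          + (1# - x) ^ (q ℕ.^ s ℕ.+ 1) ≈ 0#)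

        ^q^s≈S : ∀ x → x ^ (q ℕ.^ s) ≈ S x
        ^q^s≈S x = trans (^q^≈iterate s x) (reflexive (≡.sym (iterate-F frob s x)))

        ^q^[is]≈S : ∀ i x → x ^ (q ℕ.^ (i ℕ.* s)) ≈ iterate S i x
        ^q^[is]≈S i x = trans (^q^≈iterate (i ℕ.* s) x) (reflexive (iterates i x))
          where
          iterates : ∀ i x → iterate F (i ℕ.* s) x ≡ iterate S i x
          iterates zero    x = ≡.refl
          iterates (suc i) x = ≡.trans (iterate-+ F s (i ℕ.* s) x)
            (≡.trans (≡.cong (iterate F (i ℕ.* s)) (≡.sym (iterate-F frob s x))) (iterates i (S x)))

        fixed-S : ∀ {x} → x ^ q ≈ x → S x ≈ x
        fixed-S {x} e = trans (reflexive (iterate-F frob s x)) (fixed-iterate s)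
          where
          iterate-cong : ∀ i {x y} → x ≈ y → iterate F i x ≈ iterate F i y
          iterate-cong zero    e = e
          iterate-cong (suc i) e = iterate-cong i (F-cong e)
          fixed-iterate : ∀ i → iterate F i x ≈ x
          fixed-iterate zero    = refl
          fixed-iterate (suc i) = trans (iterate-cong i e) (fixed-iterate i)

        -- The last hypothesis says that σ runs through the conjugates of x in another order than F,
        -- so that the product over its orbit is still the norm.
        finish : ∀ {u₀ u₁ u₂ u₃ u₄} → Cycle k u₀ u₁ u₂ u₃ u₄ → ¬ (u₀ ≈ ν) →
          S u₀ ≈ u₁ → S u₁ ≈ u₂ → S u₂ ≈ u₃ → S u₃ ≈ u₄ → S u₄ ≈ u₀ →
          (∀ x → x ^ normExp q ≈ x * S x * S (S x) * S (S (S x)) * S (S (S (S x)))) → Goal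
        finish C u₀≉ν s₀ s₁ s₂ s₃ s₄ permuted = x ,
          -- `solution-norm` is stated with η = δ ε and is δ times the required equation.
          by-cancel δ≉0
            (solve 4 (λ δ ε N N′ → δ :* (ε :* N :- (:- 𝟙)) := δ :* ε :* (N :- N′) :+ 𝟙 :* (δ :* ε :* N′ :- (:- δ))) refl
              δ ε (x ^ normExp q) (x * S x * S (S x) * S (S (S x)) * S (S (S (S x)))))
            (_ ⊛ permuted x ⊕ _ ⊛ X.solution-norm) ,
          (begin
            δ ^ 2 * ε * x ^ (q ℕ.^ s)
              - δ * ε * x ^ (q ℕ.^ (2 ℕ.* s) ℕ.+ q ℕ.^ s ℕ.+ 1) * (1# - x) ^ (q ℕ.^ (3 ℕ.* s))
              + (1# - x) ^ (q ℕ.^ s ℕ.+ 1)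
              ≈⟨ +-cong (+-cong (*-congˡ (^q^s≈S x)) (-‿cong (*-cong (*-congˡ x^) (trans (^q^[is]≈S 3 (1# - x)) S³[1-x]))))
                   (trans (^-homo-* (1# - x) (q ℕ.^ s) 1) (*-congʳ (trans (^q^s≈S (1# - x)) (S[1-] x)))) ⟩
            δ ^ 2 * ε * S x - δ * ε * (S (S x) * S x * (x * 1#)) * (1# - S (S (S x))) + (1# - S x) * ((1# - x) * 1#)
              ≈⟨ solve 6 (λ δ ε x₀ x₁ x₂ x₃ →
                   δ :* (δ :* 𝟙) :* ε :* x₁ :- δ :* ε :* (x₂ :* x₁ :* (x₀ :* 𝟙)) :* (𝟙 :- x₃) :+ (𝟙 :- x₁) :* ((𝟙 :- x₀) :* 𝟙)
                 := δ :* (δ :* ε) :* x₁ :- δ :* ε :* (x₀ :* x₁ :* x₂) :* (𝟙 :- x₃) :+ (𝟙 :- x₀) :* (𝟙 :- x₁))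
                 refl δ ε x (S x) (S (S x)) (S (S (S x))) ⟩
            δ * η * S x - η * (x * S x * S (S x)) * (1# - S (S (S x))) + (1# - x) * (1# - S x)
              ≈⟨ X.solution-equation ⟩
            0# ∎)
          where
          Sδ≈δ = fixed-S δ^q≈δ
          Sε≈ε = fixed-S ε^q≈ε
          module X = FieldSolution.Solution finite σ parameters-δη C δ≉0 η≉0 m≉0 k≉0
            (fixed-η σ Sδ≈δ Sε≈ε) (fixed-m σ Sδ≈δ Sε≈ε) (fixed-n σ Sδ≈δ Sε≈ε) s₀ s₁ s₂ s₃ s₄ ν-pole u₀≉ν
          x = X.solution
          x^ : x ^ (q ℕ.^ (2 ℕ.* s) ℕ.+ q ℕ.^ s ℕ.+ 1) ≈ S (S x) * S x * (x * 1#)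
          x^ = trans (^-homo-* x (q ℕ.^ (2 ℕ.* s) ℕ.+ q ℕ.^ s) 1)
            (*-congʳ (trans (^-homo-* x (q ℕ.^ (2 ℕ.* s)) (q ℕ.^ s)) (*-cong (^q^[is]≈S 2 x) (^q^s≈S x))))
          S[1-] : ∀ y → S (1# - y) ≈ 1# - S y
          S[1-] y = trans (Frobenius.F-+ σ 1# (- y)) (+-cong (Frobenius.F-1 σ) (Frobenius.F-neg σ y))
          S³[1-x] : S (S (S (1# - x))) ≈ 1# - S (S (S x))
          S³[1-x] = trans (Frobenius.F-cong σ (trans (Frobenius.F-cong σ (S[1-] x)) (S[1-] (S x)))) (S[1-] (S (S x)))

      F¹⁰ : ∀ x → F (F (F (F (F (F (F (F (F (F x))))))))) ≈ x
      F¹⁰ x = trans (F⁵ _) (F⁵ x)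
      F¹⁵ : ∀ x → F (F (F (F (F (F (F (F (F (F (F (F (F (F (F x)))))))))))))) ≈ x
      F¹⁵ x = trans (F⁵ _) (F¹⁰ x)

      F-cong₂ : ∀ {x y} → x ≈ y → F (F x) ≈ F (F y)
      F-cong₂ e = F-cong (F-cong e)
      F-cong₃ : ∀ {x y} → x ≈ y → F (F (F x)) ≈ F (F (F y))
      F-cong₃ e = F-cong (F-cong₂ e)

      open Cycles finite q ≡.refl 1<q
      first = cycle₁ K[X]-additive K-additive k ν fixed-k k≉0
      second = cycle₂ K[X]-additive K-additive k ν fixed-k k≉0

    -- F shifts the indices by 1 in `first` and by 2 in `second`, and its s-th iterate has to shift
    -- them by 1 or -1 modulo 5. This selects `first` for s = 1 and 4, `second` for s = 2 and 3; the
    -- cycle is reversed when the shift is -1, that is for s = 2 and 4.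
    conclusion : ∀ s → 1 ≤ s → s ≤ 4 → Goal s
    conclusion 1 _ _ = let z , z≉ν , C = first in
      finish 1 C z≉ν refl refl refl refl (F⁵ z) norm-product
    conclusion 2 _ _ = let z , z≉ν , C = second in
      finish 2 (reverse C) z≉ν refl refl (F-cong (F⁵ z)) refl (F⁵ z) (λ x → trans (norm-product x)
        (trans (solve 5 (λ a b c d e → a :* b :* c :* d :* e := a :* c :* e :* b :* d) refl _ _ _ _ _)
          (*-cong (*-congˡ (sym (F-cong (F⁵ x)))) (sym (F-cong₃ (F⁵ x))))))
    conclusion 3 _ _ = let z , z≉ν , C = second in
      finish 3 C z≉ν refl (F-cong (F⁵ z)) refl (F-cong₂ (F⁵ z)) (F⁵ z) (λ x → trans (norm-product x)
        (trans (solve 5 (λ a b c d e → a :* b :* c :* d :* e := a :* d :* b :* e :* c) refl _ _ _ _ _)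
          (*-cong (*-cong (*-congˡ (sym (F-cong (F⁵ x)))) (sym (F-cong₃ (F-cong (F⁵ x))))) (sym (F-cong₂ (F¹⁰ x))))))
    conclusion 4 _ _ = let z , z≉ν , C = first in
      finish 4 (reverse C) z≉ν refl (F-cong₃ (F⁵ z)) (F-cong₂ (F⁵ z)) (F-cong (F⁵ z)) (F⁵ z) (λ x → trans (norm-product x)
        (trans (solve 5 (λ a b c d e → a :* b :* c :* d :* e := a :* e :* d :* c :* b) refl _ _ _ _ _)
          (*-cong (*-cong (*-congˡ (sym (F-cong₃ (F⁵ x)))) (sym (F-cong₂ (F¹⁰ x)))) (sym (F-cong (F¹⁵ x))))))
    conclusion (suc (suc (suc (suc (suc _))))) _ (s≤s (s≤s (s≤s (s≤s ()))))

theorem4p10 : ∀ {c ℓ} (q : ℕ) → IsPrimePower q →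
    (K : CommutativeRing c ℓ) → IsFiniteField K (q ℕ.^ 5) →
    let open CommutativeRing K in let open RingOps K in
    (s : ℕ) → 1 ≤ s → s ≤ 4 →
    (δ ε : Carrier) →
    δ ^ q ≈ δ → ε ^ q ≈ ε →
    ¬ (δ ≈ 0#) → ¬ (ε ≈ 0#) →
    ¬ (δ ^ 2 * ε ≈ 1#) →
    ¬ (δ ^ 3 * ε ^ 2 + (1# - 3 × δ) * ε + 1# ≈ 0#) →
    ∃ λ x →
    (ε * x ^ normExp q ≈ - 1#) ∧
    (δ ^ 2 * ε * x ^ (q ℕ.^ s)
    - δ * ε * x ^ (q ℕ.^ (2 ℕ.* s) ℕ.+ q ℕ.^ s ℕ.+ 1) * (1# - x) ^ (q ℕ.^ (3 ℕ.* s))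
    + (1# - x) ^ (q ℕ.^ s ℕ.+ 1) ≈ 0#)
theorem4p10 q q-prime-power K finite s 1≤s s≤4 δ ε δ^q≈δ ε^q≈ε δ≉0 ε≉0 δ²ε≉1 cubic≉0 =
  Main.conclusion q q-prime-power K finite δ ε δ^q≈δ ε^q≈ε δ≉0 ε≉0 δ²ε≉1 cubic≉0 s 1≤s s≤4
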